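{- Let $d\ge1$ and $n=3^d$. At a generic Minkowski unit realization $P$ of $H(d,3)$ in $\mathbb{R}^2$, the internal infinitesimal flexibility has dimension exactly $d-1$; the flexes are the independent relative rotations of the $d$ triangles (i.e. modulo trivial motions the infinitesimal flexes are exactly those of the form $v(a)=\sum_{i=1}^d\theta_i\,J\,T_i[a_i]$ with $\theta_1,\dots,\theta_d\in\mathbb{R}$, where $J$ is rotation by $90^\circ$), and the rigidity matrix has rank exactly $2n-3-(d-1)$.
   Context: $H(d,3)=K_3^{\square d}$ is the graph on $\{0,1,2\}^d$ with two words adjacent iff they differ in exactly one coordinate. Minkowski unit realization: for angles $\varphi_1,\dots,\varphi_d$ let $T_i[k]=\tfrac1{\sqrt3}(\cos(\varphi_i+\tfrac{2\pi k}{3}),\sin(\varphi_i+\tfrac{2\pi k}{3}))$, $k=0,1,2$ (unit equilateral triangles), and place $a=(a_1,\dots,a_d)$ at $P(a)=\sum_{i=1}^dT_i[a_i]$. "Generic" means $(\varphi_1,\dots,\varphi_d)$ lies outside some proper real-analytic (measure-zero) subset of parameter space. An infinitesimal flex of $P$ is a map $v:V\to\mathbb{R}^2$ with $(v(a)-v(b))\cdot(P(a)-P(b))=0$ for every edge $ab$; the rigidity matrix is the $|E|\times 2n$ matrix of this linear system. The trivial motions are the $3$-dimensional space of infinitesimal translations and global rotation $v(a)=t+\theta J P(a)$. The internal infinitesimal flexibility is the quotient of the space of infinitesimal flexes by the trivial motions; its dimension is $2n-\mathrm{rank}-3$. -}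

module Defs where

open import Algebra.Apartness.Bundles using (HeytingField)
open import Algebra.Bundles using (AbelianGroup; CommutativeRing; Semiring)
open import Algebra.Module.Bundles using (LeftModule)
import Algebra.Apartness.Bundles as Apartness
import Algebra.Construct.Pointwise as Pointwise
import Algebra.Definitions.RawMonoid as RawMonoidDefinitions
import Algebra.Definitions.RawSemiring as RawSemiringDefinitions
import Algebra.Module.Construct.TensorUnit as TensorUnit
import Algebra.Module.Properties.LeftModule as LeftModuleProperties
import Algebra.Properties.AbelianGroup as AbelianGroupProperties
import Algebra.Properties.CommutativeSemigroup as CommutativeSemigroupProperties
import Algebra.Properties.Ring as RingProperties
open import Data.Bool.Base using (if_then_else_)
open import Data.Fin.Base using (Fin; toℕ; finToFun; remQuot)
open import Data.Fin.Patterns using (0F; 1F)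
open import Data.Fin.Properties using (_≟_; _<?_; any?; all?)
open import Data.List.Base using (List; foldr; filter; cartesianProduct; allFin; length; lookup)
open import Data.List.Relation.Binary.Subset.Propositional using (_⊆_)
open import Data.List.Relation.Unary.Unique.Propositional using (Unique)
open import Data.Nat.Base as ℕ using (ℕ; zero; suc; NonZero; _!)
open import Data.Nat.Properties using (_!≢0)
open import Data.Product using (Σ; ∃; ∃!; _×_; _,_; proj₁; proj₂)
open import Data.Sum.Base using (_⊎_; inj₂)
open import Data.Vec.Base as Vec using (Vec)
open import Data.Vec.Functional using (Vector)
open import Function.Base using (_∘_)
open import Function.Bundles using (_⇔_; Equivalence)
open import Level using (Level; _⊔_) renaming (suc to lsuc)
open import Relation.Binary.Core using (Rel)
open import Relation.Binary.Definitions using (Decidable)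
open import Relation.Binary.PropositionalEquality.Core using (_≡_; _≢_)
open import Relation.Binary.Structures using (IsStrictPartialOrder)
open import Relation.Nullary using (¬_; Dec; does)
open import Relation.Nullary.Decidable using (map′; ¬?; _×-dec_; _→-dec_)
open import Relation.Unary using (Pred)

-- The real numbers, characterised as a Cauchy complete Archimedean ordered
-- field.  Read classically there is exactly one such field up to isomorphism;
-- read constructively the Cauchy reals are one.

record RealNumbers c ℓ₁ ℓ₂ ℓ₃ : Set (lsuc (c ⊔ ℓ₁ ⊔ ℓ₂ ⊔ ℓ₃)) where
  field
    heytingField : HeytingField c ℓ₁ ℓ₂

  open HeytingField heytingField public
  open Apartness.HeytingCommutativeRing heytingCommutativeRing public
    using (commutativeRing)
  open CommutativeRing commutativeRing public
    using (semiring)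
  open Semiring semiring public
    using (rawSemiring)
  open RawSemiringDefinitions rawSemiring public
    using (sum; product; _^_) renaming (_×_ to _·_)

  infix 4 _<_ _ConvergesTo_

  field
    _<_                  : Rel Carrier ℓ₃
    isStrictPartialOrder : IsStrictPartialOrder _≈_ _<_
    #⇔<⊎>                : ∀ {x y} → x # y ⇔ (x < y ⊎ y < x)
    0<1                  : 0# < 1#
    +-monoˡ-<            : ∀ {x y} z → x < y → x + z < y + z
    *-pos                : ∀ {x y} → 0# < x → 0# < y → 0# < x * y
    archimedean          : ∀ x → ∃ λ n → x < n · 1#

  ∣_-_∣<_ : Carrier → Carrier → Carrier → Set ℓ₃
  ∣ x - y ∣< ε = (- ε < x - y) × (x - y < ε)

  IsCauchy : (ℕ → Carrier) → Set (c ⊔ ℓ₃)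
  IsCauchy s = ∀ ε → 0# < ε →
    ∃ λ N → ∀ m n → N ℕ.≤ m → N ℕ.≤ n → ∣ s m - s n ∣< ε

  _ConvergesTo_ : (ℕ → Carrier) → Carrier → Set (c ⊔ ℓ₃)
  s ConvergesTo l = ∀ ε → 0# < ε → ∃ λ N → ∀ n → N ℕ.≤ n → ∣ s n - l ∣< ε

  field
    cauchy-complete : ∀ s → IsCauchy s → ∃ λ l → s ConvergesTo l

  infix 4 _≤_

  _≤_ : Rel Carrier ℓ₃
  x ≤ y = ¬ (y < x)

  partialSum : (ℕ → Carrier) → ℕ → Carrier
  partialSum f N = sum {N} (f ∘ toℕ)

  open IsStrictPartialOrder isStrictPartialOrder using (<-respˡ-≈; <-respʳ-≈)
    renaming (trans to <-trans)

  n·1-pos : ∀ n .{{_ : NonZero n}} → 0# < n · 1#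
  n·1-pos (suc zero)      = <-respʳ-≈ (sym (+-identityʳ 1#)) 0<1
  n·1-pos (suc n@(suc _)) = <-trans (n·1-pos n)
    (<-respˡ-≈ (+-identityˡ (n · 1#)) (+-monoˡ-< (n · 1#) 0<1))

  pos⇒#0 : ∀ {x} → 0# < x → x # 0#
  pos⇒#0 0<x = Equivalence.from #⇔<⊎> (inj₂ 0<x)

  inverse : ∀ x → x # 0# → Carrier
  inverse _ x#0 = proj₁ (#⇒invertible x#0)

  1/ : ∀ n .{{_ : NonZero n}} → Carrier
  1/ n = inverse (n · 1#) (pos⇒#0 (n·1-pos n))

  1/[_!] : ℕ → Carrier
  1/[ n !] = 1/ (n !) {{n !≢0}}

-- cos and sin are the sums of their Taylor series, π is the least positive zero
-- of sin, and √3 is the positive square root; each is thus determined up to _≈_.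

record Trigonometry {c ℓ₁ ℓ₂ ℓ₃} (ℝ : RealNumbers c ℓ₁ ℓ₂ ℓ₃)
                    : Set (c ⊔ ℓ₁ ⊔ ℓ₃) where
  open RealNumbers ℝ

  field
    cos sin    : Carrier → Carrier
    cos-series : ∀ x →
      partialSum (λ k → (- 1#) ^ k * x ^ (2 ℕ.* k) * 1/[ 2 ℕ.* k !])
        ConvergesTo cos x
    sin-series : ∀ x →
      partialSum (λ k → (- 1#) ^ k * x ^ suc (2 ℕ.* k) * 1/[ suc (2 ℕ.* k) !])
        ConvergesTo sin x

    π            : Carrier
    0<π          : 0# < π
    sin-π        : sin π ≈ 0#
    sin-pos<π    : ∀ x → 0# < x → x < π → 0# < sin x

    √3           : Carrier
    0<√3         : 0# < √3
    √3*√3        : √3 * √3 ≈ 3 · 1#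

module LinearAlgebra {c ℓ} (R : CommutativeRing c ℓ) where

  open CommutativeRing R

  scalars : LeftModule ring c ℓ
  scalars = TensorUnit.leftModule

  infixl 9 _^ᴹ_

  _^ᴹ_ : ∀ {i m ℓm} → LeftModule ring m ℓm → (I : Set i) →
         LeftModule ring (i ⊔ m) (i ⊔ ℓm)
  M ^ᴹ I = record
    { _≈ᴹ_ = λ u v → ∀ i → u i ≈ᴹ v i
    ; _+ᴹ_ = λ u v i → u i +ᴹ v i
    ; _*ₗ_ = λ x u i → x *ₗ u i
    ; 0ᴹ   = λ _ → 0ᴹ
    ; -ᴹ_  = λ u i → -ᴹ (u i)
    ; isLeftModule = record
      { isLeftSemimodule = record
        { +ᴹ-isCommutativeMonoid = P.isCommutativeMonoid
        ; isPreleftSemimodule = record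
          { *ₗ-cong      = λ x≈y u≈v i → *ₗ-cong x≈y (u≈v i)
          ; *ₗ-zeroˡ     = λ u i → *ₗ-zeroˡ (u i)
          ; *ₗ-distribʳ  = λ u x y i → *ₗ-distribʳ (u i) x y
          ; *ₗ-identityˡ = λ u i → *ₗ-identityˡ (u i)
          ; *ₗ-assoc     = λ x y u i → *ₗ-assoc x y (u i)
          ; *ₗ-zeroʳ     = λ x i → *ₗ-zeroʳ x
          ; *ₗ-distribˡ  = λ x u v i → *ₗ-distribˡ x (u i) (v i)
          }
        }
      ; -ᴹ‿cong    = P.⁻¹-cong
      ; -ᴹ‿inverse = P.inverse
      }
    }
    where
    open LeftModule M
    module P = AbelianGroup (Pointwise.abelianGroup I +ᴹ-abelianGroup)

  record Subspace {m ℓm} (M : LeftModule ring m ℓm) p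
                  : Set (c ⊔ m ⊔ ℓm ⊔ lsuc p) where
    open LeftModule M
    field
      Member     : Pred Carrierᴹ p
      resp-≈     : ∀ {u v} → u ≈ᴹ v → Member u → Member v
      0-closed   : Member 0ᴹ
      +-closed   : ∀ {u v} → Member u → Member v → Member (u +ᴹ v)
      *ₗ-closed  : ∀ x {u} → Member u → Member (x *ₗ u)

    -ᴹ-closed : ∀ {u} → Member u → Member (-ᴹ u)
    -ᴹ-closed {u} u∈ = resp-≈ -1*u≈-u (*ₗ-closed (- 1#) u∈)
      where
      open LeftModuleProperties M using (inverseˡ-uniqueᴹ)
      -1*u≈-u : - 1# *ₗ u ≈ᴹ -ᴹ u
      -1*u≈-u = inverseˡ-uniqueᴹ (- 1# *ₗ u) u
        (≈ᴹ-trans (+ᴹ-congˡ (≈ᴹ-sym (*ₗ-identityˡ u)))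
        (≈ᴹ-trans (≈ᴹ-sym (*ₗ-distribʳ u (- 1#) 1#))
        (≈ᴹ-trans (*ₗ-congʳ (-‿inverseˡ 1#)) (*ₗ-zeroˡ u))))

  module _ {m ℓm p} {M : LeftModule ring m ℓm} (U : Subspace M p) where
    open LeftModule M
    open Subspace U

    subspaceModule : LeftModule ring (m ⊔ p) ℓm
    subspaceModule = record
      { Carrierᴹ = Σ Carrierᴹ Member
      ; _≈ᴹ_ = λ u v → proj₁ u ≈ᴹ proj₁ v
      ; _+ᴹ_ = λ u v → proj₁ u +ᴹ proj₁ v , +-closed (proj₂ u) (proj₂ v)
      ; _*ₗ_ = λ x u → x *ₗ proj₁ u , *ₗ-closed x (proj₂ u)
      ; 0ᴹ   = 0ᴹ , 0-closed
      ; -ᴹ_  = λ u → -ᴹ proj₁ u , -ᴹ-closed (proj₂ u)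
      ; isLeftModule = record
        { isLeftSemimodule = record
          { +ᴹ-isCommutativeMonoid = record
            { isMonoid = record
              { isSemigroup = record
                { isMagma = record
                  { isEquivalence = record
                    { refl  = ≈ᴹ-refl
                    ; sym   = ≈ᴹ-sym
                    ; trans = ≈ᴹ-trans
                    }
                  ; ∙-cong = +ᴹ-cong
                  }
                ; assoc = λ u v w → +ᴹ-assoc (proj₁ u) (proj₁ v) (proj₁ w)
                }
              ; identity = (λ u → +ᴹ-identityˡ (proj₁ u))
                         , (λ u → +ᴹ-identityʳ (proj₁ u))
              }
            ; comm = λ u v → +ᴹ-comm (proj₁ u) (proj₁ v)
            }
          ; isPreleftSemimodule = record
            { *ₗ-cong      = *ₗ-cong
            ; *ₗ-zeroˡ     = λ u → *ₗ-zeroˡ (proj₁ u)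
            ; *ₗ-distribʳ  = λ u → *ₗ-distribʳ (proj₁ u)
            ; *ₗ-identityˡ = λ u → *ₗ-identityˡ (proj₁ u)
            ; *ₗ-assoc     = λ x y u → *ₗ-assoc x y (proj₁ u)
            ; *ₗ-zeroʳ     = *ₗ-zeroʳ
            ; *ₗ-distribˡ  = λ x u v → *ₗ-distribˡ x (proj₁ u) (proj₁ v)
            }
          }
        ; -ᴹ‿cong    = -ᴹ‿cong
        ; -ᴹ‿inverse = (λ u → -ᴹ‿inverseˡ (proj₁ u))
                     , (λ u → -ᴹ‿inverseʳ (proj₁ u))
        }
      }

    quotientModule : LeftModule ring m p
    quotientModule = record
      { _≈ᴹ_ = _∼_
      ; _+ᴹ_ = _+ᴹ_
      ; _*ₗ_ = _*ₗ_
      ; 0ᴹ   = 0ᴹ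
      ; -ᴹ_  = -ᴹ_
      ; isLeftModule = record
        { isLeftSemimodule = record
          { +ᴹ-isCommutativeMonoid = record
            { isMonoid = record
              { isSemigroup = record
                { isMagma = record
                  { isEquivalence = record
                    { refl  = ≈⇒∼ ≈ᴹ-refl
                    ; sym   = ∼-sym
                    ; trans = ∼-trans
                    }
                  ; ∙-cong = ∼-+-cong
                  }
                ; assoc = λ u v w → ≈⇒∼ (+ᴹ-assoc u v w)
                }
              ; identity = (λ u → ≈⇒∼ (+ᴹ-identityˡ u))
                         , (λ u → ≈⇒∼ (+ᴹ-identityʳ u))
              }
            ; comm = λ u v → ≈⇒∼ (+ᴹ-comm u v)
            }
          ; isPreleftSemimodule = record
            { *ₗ-cong      = λ {x} {y} {u} {v} → ∼-*ₗ-cong {x} {y} {u} {v}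
            ; *ₗ-zeroˡ     = λ u → ≈⇒∼ (*ₗ-zeroˡ u)
            ; *ₗ-distribʳ  = λ u x y → ≈⇒∼ (*ₗ-distribʳ u x y)
            ; *ₗ-identityˡ = λ u → ≈⇒∼ (*ₗ-identityˡ u)
            ; *ₗ-assoc     = λ x y u → ≈⇒∼ (*ₗ-assoc x y u)
            ; *ₗ-zeroʳ     = λ x → ≈⇒∼ (*ₗ-zeroʳ x)
            ; *ₗ-distribˡ  = λ x u v → ≈⇒∼ (*ₗ-distribˡ x u v)
            }
          }
        ; -ᴹ‿cong    = ∼-neg-cong
        ; -ᴹ‿inverse = (λ u → ≈⇒∼ (-ᴹ‿inverseˡ u))
                     , (λ u → ≈⇒∼ (-ᴹ‿inverseʳ u))
        }
      }
      where
      open AbelianGroupProperties +ᴹ-abelianGroup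
        using (⁻¹-∙-comm; ⁻¹-involutive)
      open CommutativeSemigroupProperties
        (AbelianGroup.commutativeSemigroup +ᴹ-abelianGroup) using (interchange)

      _∼_ : Rel Carrierᴹ p
      u ∼ v = Member (u +ᴹ -ᴹ v)

      ≈⇒∼ : ∀ {u v} → u ≈ᴹ v → u ∼ v
      ≈⇒∼ {u} {v} u≈v = resp-≈
        (≈ᴹ-sym (≈ᴹ-trans (+ᴹ-congʳ u≈v) (-ᴹ‿inverseʳ v))) 0-closed

      negate-difference : ∀ u v → -ᴹ (u +ᴹ -ᴹ v) ≈ᴹ -ᴹ u +ᴹ -ᴹ -ᴹ v
      negate-difference u v = ≈ᴹ-sym (⁻¹-∙-comm u (-ᴹ v))

      ∼-neg-cong : ∀ {u v} → u ∼ v → (-ᴹ u) ∼ (-ᴹ v)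
      ∼-neg-cong {u} {v} u∼v = resp-≈ (negate-difference u v) (-ᴹ-closed u∼v)

      ∼-sym : ∀ {u v} → u ∼ v → v ∼ u
      ∼-sym {u} {v} u∼v = resp-≈
        (≈ᴹ-trans (negate-difference u v)
        (≈ᴹ-trans (+ᴹ-comm (-ᴹ u) (-ᴹ -ᴹ v)) (+ᴹ-congʳ (⁻¹-involutive v))))
        (-ᴹ-closed u∼v)

      ∼-trans : ∀ {u v w} → u ∼ v → v ∼ w → u ∼ w
      ∼-trans {u} {v} {w} u∼v v∼w = resp-≈
        (≈ᴹ-trans (+ᴹ-assoc u (-ᴹ v) (v +ᴹ -ᴹ w))
        (+ᴹ-congˡ
          (≈ᴹ-trans (≈ᴹ-sym (+ᴹ-assoc (-ᴹ v) v (-ᴹ w)))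
          (≈ᴹ-trans (+ᴹ-congʳ (-ᴹ‿inverseˡ v)) (+ᴹ-identityˡ (-ᴹ w))))))
        (+-closed u∼v v∼w)

      ∼-+-cong : ∀ {u v s t} → u ∼ v → s ∼ t → (u +ᴹ s) ∼ (v +ᴹ t)
      ∼-+-cong {u} {v} {s} {t} u∼v s∼t = resp-≈
        (≈ᴹ-trans (interchange u (-ᴹ v) s (-ᴹ t)) (+ᴹ-congˡ (⁻¹-∙-comm v t)))
        (+-closed u∼v s∼t)

      ∼-*ₗ-cong : ∀ {x y u v} → x ≈ y → u ∼ v → (x *ₗ u) ∼ (y *ₗ v)
      ∼-*ₗ-cong {x} {y} {u} {v} x≈y u∼v = ∼-trans (resp-≈ eq (*ₗ-closed x u∼v))
        (≈⇒∼ (*ₗ-congʳ x≈y))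
        where
        open LeftModuleProperties M using (inverseˡ-uniqueᴹ)
        eq : x *ₗ (u +ᴹ -ᴹ v) ≈ᴹ x *ₗ u +ᴹ -ᴹ (x *ₗ v)
        eq = ≈ᴹ-trans (*ₗ-distribˡ x u (-ᴹ v))
          (+ᴹ-congˡ (inverseˡ-uniqueᴹ (x *ₗ -ᴹ v) (x *ₗ v)
            (≈ᴹ-trans (≈ᴹ-sym (*ₗ-distribˡ x (-ᴹ v) v))
            (≈ᴹ-trans (*ₗ-congˡ (-ᴹ‿inverseˡ v)) (*ₗ-zeroʳ x)))))

  restrict : ∀ {m ℓm p q} {M : LeftModule ring m ℓm}
             (U : Subspace M p) → Subspace M q → Subspace (subspaceModule U) q
  restrict U W = record
    { Member    = Member ∘ proj₁
    ; resp-≈    = resp-≈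
    ; 0-closed  = 0-closed
    ; +-closed  = +-closed
    ; *ₗ-closed = λ x → *ₗ-closed x
    }
    where open Subspace W

  module _ {m ℓm} (M : LeftModule ring m ℓm) where
    open LeftModule M

    linearCombination : ∀ {k} → Vector Carrier k → Vector Carrierᴹ k → Carrierᴹ
    linearCombination x b =
      RawMonoidDefinitions.sum +ᴹ-rawMonoid (λ i → x i *ₗ b i)

    LinearlyIndependent : ∀ {k} → Vector Carrierᴹ k → Set (c ⊔ ℓ ⊔ ℓm)
    LinearlyIndependent {k} b =
      ∀ (x : Vector Carrier k) → linearCombination x b ≈ᴹ 0ᴹ → ∀ i → x i ≈ 0#

    InSpan : ∀ {k} → Vector Carrierᴹ k → Pred Carrierᴹ (c ⊔ ℓm)
    InSpan {k} b u = ∃ λ (x : Vector Carrier k) → u ≈ᴹ linearCombination x b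

    HasDimension : ℕ → Set (c ⊔ ℓ ⊔ m ⊔ ℓm)
    HasDimension k = ∃ λ (b : Vector Carrierᴹ k) →
      LinearlyIndependent b × (∀ u → InSpan b u)

    span : ∀ {k} → Vector Carrierᴹ k → Subspace M (c ⊔ ℓm)
    span {k} b = record
      { Member    = InSpan b
      ; resp-≈    = λ { u≈v (x , eq) → x , ≈ᴹ-trans (≈ᴹ-sym u≈v) eq }
      ; 0-closed  = (λ _ → 0#) , ≈ᴹ-sym (zeros b)
      ; +-closed  = λ { (x , eq) (y , eq′) → (λ i → x i + y i) ,
                        ≈ᴹ-trans (+ᴹ-cong eq eq′) (≈ᴹ-sym (sums x y b)) }
      ; *ₗ-closed = λ { z (x , eq) → (λ i → z * x i) ,
                        ≈ᴹ-trans (*ₗ-congˡ eq) (≈ᴹ-sym (scalings z x b)) }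
      }
      where
      open CommutativeSemigroupProperties
        (AbelianGroup.commutativeSemigroup +ᴹ-abelianGroup) using (interchange)

      zeros : ∀ {n} (e : Vector Carrierᴹ n) →
              linearCombination (λ _ → 0#) e ≈ᴹ 0ᴹ
      zeros {zero}  e = ≈ᴹ-refl
      zeros {suc n} e = ≈ᴹ-trans
        (+ᴹ-cong (*ₗ-zeroˡ (e 0F)) (zeros (e ∘ Fin.suc))) (+ᴹ-identityˡ 0ᴹ)

      sums : ∀ {n} (x y : Vector Carrier n) (e : Vector Carrierᴹ n) →
             linearCombination (λ i → x i + y i) e ≈ᴹ
             linearCombination x e +ᴹ linearCombination y e
      sums {zero}  x y e = ≈ᴹ-sym (+ᴹ-identityˡ 0ᴹ)
      sums {suc n} x y e = ≈ᴹ-trans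
        (+ᴹ-cong (*ₗ-distribʳ (e 0F) (x 0F) (y 0F))
                 (sums (x ∘ Fin.suc) (y ∘ Fin.suc) (e ∘ Fin.suc)))
        (interchange _ _ _ _)

      scalings : ∀ {n} z (x : Vector Carrier n) (e : Vector Carrierᴹ n) →
                 linearCombination (λ i → z * x i) e ≈ᴹ
                 z *ₗ linearCombination x e
      scalings {zero}  z x e = ≈ᴹ-sym (*ₗ-zeroʳ z)
      scalings {suc n} z x e = ≈ᴹ-trans
        (+ᴹ-cong (*ₗ-assoc z (x 0F) (e 0F))
                 (scalings z (x ∘ Fin.suc) (e ∘ Fin.suc)))
        (≈ᴹ-sym (*ₗ-distribˡ z _ _))

  Matrix : ℕ → ℕ → Set c
  Matrix m n = Vector (Vector Carrier n) m

  columnSpace : ∀ {m n} → Matrix m n → Subspace (scalars ^ᴹ Fin m) (c ⊔ ℓ)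
  columnSpace {m} A = span (scalars ^ᴹ Fin m) (λ j i → A i j)

  HasRank : ∀ {m n} → Matrix m n → ℕ → Set (c ⊔ ℓ)
  HasRank A r = HasDimension (subspaceModule (columnSpace A)) r

module PlaneRigidity {c ℓ} (R : CommutativeRing c ℓ) where

  open CommutativeRing R
  open LinearAlgebra R

  Point : Set c
  Point = Vector Carrier 2

  _∙_ : Point → Point → Carrier
  p ∙ q = p 0F * q 0F + p 1F * q 1F

  J : Point → Point
  J p 0F = - p 1F
  J p 1F = p 0F

  Velocities : ℕ → LeftModule ring c ℓ
  Velocities n = scalars ^ᴹ Fin 2 ^ᴹ Fin n

  infixl 6 _-ⱽ_

  _-ⱽ_ : ∀ {n} → Vector Point n → Vector Point n → Vector Point n
  (u -ⱽ v) a k = u a k - v a k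

  module Framework {ℓA} {n : ℕ} {Adjacent : Rel (Fin n) ℓA}
                   (adjacent? : Decidable Adjacent) (P : Vector Point n) where

    _⊖_ : Point → Point → Point
    (p ⊖ q) k = p k - q k

    IsFlex : Vector Point n → Set (ℓ ⊔ ℓA)
    IsFlex v = ∀ a b → Adjacent a b → (v a ⊖ v b) ∙ (P a ⊖ P b) ≈ 0#

    IsTrivial : Vector Point n → Set (c ⊔ ℓ)
    IsTrivial v = ∃ λ (t : Point) → ∃ λ (θ : Carrier) →
      ∀ a k → v a k ≈ t k + θ * J (P a) k

    private
      open AbelianGroupProperties +-abelianGroup using (⁻¹-∙-comm)
      open CommutativeSemigroupProperties +-commutativeSemigroup using (interchange)
      open RingProperties ring using (-‿distribʳ-*)

      ∙-cong : ∀ p p′ q → (∀ k → p k ≈ p′ k) → p ∙ q ≈ p′ ∙ q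
      ∙-cong p p′ q p≈p′ = +-cong (*-congʳ (p≈p′ 0F)) (*-congʳ (p≈p′ 1F))

      ∙-+ : ∀ p p′ q → (λ k → p k + p′ k) ∙ q ≈ p ∙ q + p′ ∙ q
      ∙-+ p p′ q = trans
        (+-cong (distribʳ (q 0F) (p 0F) (p′ 0F)) (distribʳ (q 1F) (p 1F) (p′ 1F)))
        (interchange _ _ _ _)

      ∙-* : ∀ x p q → (λ k → x * p k) ∙ q ≈ x * (p ∙ q)
      ∙-* x p q = trans
        (+-cong (*-assoc x (p 0F) (q 0F)) (*-assoc x (p 1F) (q 1F)))
        (sym (distribˡ x _ _))

    flexes : Subspace (Velocities n) (ℓ ⊔ ℓA)
    flexes = record
      { Member    = IsFlex
      ; resp-≈    = λ {u} {v} u≈v flex a b ab → trans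
          (∙-cong (v a ⊖ v b) (u a ⊖ u b) (P a ⊖ P b)
            (λ k → sym (+-cong (u≈v a k) (-‿cong (u≈v b k)))))
          (flex a b ab)
      ; 0-closed  = λ a b ab → trans
          (∙-cong (λ _ → 0# - 0#) (λ _ → 0#) (P a ⊖ P b) (λ _ → -‿inverseʳ 0#))
          (trans (+-cong (zeroˡ _) (zeroˡ _)) (+-identityˡ 0#))
      ; +-closed  = λ {u} {v} flexᵘ flexᵛ a b ab → trans
          (∙-cong (λ k → (u a k + v a k) - (u b k + v b k))
                  (λ k → (u a ⊖ u b) k + (v a ⊖ v b) k) (P a ⊖ P b)
            (λ k → trans (+-congˡ (sym (⁻¹-∙-comm (u b k) (v b k))))
                         (interchange _ _ _ _)))
          (trans (∙-+ (u a ⊖ u b) (v a ⊖ v b) (P a ⊖ P b))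
                 (trans (+-cong (flexᵘ a b ab) (flexᵛ a b ab)) (+-identityˡ 0#)))
      ; *ₗ-closed = λ x {u} flex a b ab → trans
          (∙-cong (λ k → x * u a k - x * u b k)
                  (λ k → x * (u a ⊖ u b) k) (P a ⊖ P b)
            (λ k → trans (+-congˡ (-‿distribʳ-* x (u b k)))
                         (sym (distribˡ x _ _))))
          (trans (∙-* x (u a ⊖ u b) (P a ⊖ P b))
                 (trans (*-congˡ (flex a b ab)) (zeroʳ x)))
      }

    trivialMotions : Subspace (Velocities n) (c ⊔ ℓ)
    trivialMotions = record
      { Member    = IsTrivial
      ; resp-≈    = λ { u≈v (t , θ , eq) → t , θ , λ a k →
          trans (sym (u≈v a k)) (eq a k) }
      ; 0-closed  = (λ _ → 0#) , 0# , λ a k →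
          sym (trans (+-identityˡ _) (zeroˡ _))
      ; +-closed  = λ { (t , θ , eq) (t′ , θ′ , eq′) →
          (λ k → t k + t′ k) , θ + θ′ , λ a k →
          trans (+-cong (eq a k) (eq′ a k))
          (trans (interchange _ _ _ _)
                 (+-congˡ (sym (distribʳ (J (P a) k) θ θ′)))) }
      ; *ₗ-closed = λ { x (t , θ , eq) → (λ k → x * t k) , x * θ , λ a k →
          trans (*-congˡ (eq a k))
          (trans (distribˡ x _ _) (+-congˡ (sym (*-assoc x θ _)))) }
      }

    internalFlexibility : LeftModule ring (c ⊔ ℓ ⊔ ℓA) (c ⊔ ℓ)
    internalFlexibility = quotientModule (restrict flexes trivialMotions)

    -- Each edge is listed once, as a pair whose first vertex is the smaller.
    edges : List (Fin n × Fin n)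
    edges = filter (λ (a , b) → a <? b ×-dec adjacent? a b)
                   (cartesianProduct (allFin n) (allFin n))

    -- Column remQuot 2 j = (w , k) holds the coefficients of the unknown v w k.
    rigidityMatrix : Matrix (length edges) (n ℕ.* 2)
    rigidityMatrix e j =
      let a , b = lookup edges e
          w , k = remQuot 2 j
      in (δ a w - δ b w) * (P a k - P b k)
      where
      δ : Fin n → Fin n → Carrier
      δ a w = if does (a ≟ w) then 1# else 0#

-- The vertices of H(d,3): finToFun is a bijection onto {0,1,2}^d.

Vertex : ℕ → Set
Vertex d = Fin (3 ℕ.^ d)

word : ∀ {d} → Vertex d → Fin d → Fin 3
word = finToFun

HammingAdjacent : ∀ d → Rel (Vertex d) _
HammingAdjacent d a b = ∃! _≡_ (λ i → word {d} a i ≢ word {d} b i)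

hammingAdjacent? : ∀ d → Decidable (HammingAdjacent d)
hammingAdjacent? d a b = any? λ i →
  differ? i ×-dec
  map′ (λ f {j} → f j) (λ f j → f {j}) (all? λ j → differ? j →-dec i ≟ j)
  where
  differ? : (i : Fin d) → Dec (word {d} a i ≢ word {d} b i)
  differ? i = ¬? (word {d} a i ≟ word {d} b i)

module Analytic {c ℓ₁ ℓ₂ ℓ₃} (ℝ : RealNumbers c ℓ₁ ℓ₂ ℓ₃) (d : ℕ) where

  open RealNumbers ℝ

  MultiIndex : Set
  MultiIndex = Vec ℕ d

  monomial : Vector Carrier d → MultiIndex → Carrier
  monomial x α = product (λ i → x i ^ Vec.lookup α i)

  infix 4 _SumsTo_

  -- Convergence along the finite sets of multi-indices, directed by inclusion.
  _SumsTo_ : (MultiIndex → Carrier) → Carrier → Set (c ⊔ ℓ₃)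
  f SumsTo l = ∀ ε → 0# < ε → ∃ λ (S₀ : List MultiIndex) →
    ∀ S → Unique S → S₀ ⊆ S → ∣ foldr (λ α s → f α + s) 0# S - l ∣< ε

  IsAnalytic : (Vector Carrier d → Carrier) → Set (c ⊔ ℓ₃)
  IsAnalytic f = ∀ (p : Vector Carrier d) → ∃ λ (a : MultiIndex → Carrier) →
    ∃ λ r → 0# < r × (∀ (x : Vector Carrier d) → (∀ i → ∣ x i - p i ∣< r) →
      (λ α → a α * monomial (λ i → x i - p i) α) SumsTo f x)

  IsNull : ∀ {p} → Pred (Vector Carrier d) p → Set (c ⊔ ℓ₃ ⊔ p)
  IsNull A = ∀ ε → 0# < ε →
    ∃ λ (lower : ℕ → Vector Carrier d) → ∃ λ (upper : ℕ → Vector Carrier d) →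
      (∀ k i → lower k i ≤ upper k i) ×
      (∀ x → A x → ∃ λ k → ∀ i → lower k i ≤ x i × x i ≤ upper k i) ×
      (∀ N → partialSum (λ k → product (λ i → upper k i - lower k i)) N ≤ ε)

  IsProperAnalyticSubset : ∀ {p} → Pred (Vector Carrier d) p → Set (c ⊔ ℓ₁ ⊔ ℓ₃ ⊔ p)
  IsProperAnalyticSubset A =
    (∃ λ f → IsAnalytic f × (∀ x → A x ⇔ f x ≈ 0#)) × (∃ λ x → ¬ A x)

  Generically : ∀ {q} → Pred (Vector Carrier d) q → Set (c ⊔ lsuc ℓ₁ ⊔ ℓ₃ ⊔ q)
  Generically Q = ∃ λ (A : Pred (Vector Carrier d) ℓ₁) →
    IsProperAnalyticSubset A × IsNull A × (∀ φ → ¬ A φ → Q φ)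

module MinkowskiRealization {c ℓ₁ ℓ₂ ℓ₃} {ℝ : RealNumbers c ℓ₁ ℓ₂ ℓ₃}
                            (trigonometry : Trigonometry ℝ) (d : ℕ) where

  open RealNumbers ℝ
  open Trigonometry trigonometry
  open PlaneRigidity commutativeRing public
  open LinearAlgebra commutativeRing public

  triangle : Carrier → Fin 3 → Point
  triangle φ k = λ where
      0F → r * cos angle
      1F → r * sin angle
    where
    r angle : Carrier
    r = inverse √3 (pos⇒#0 0<√3)
    angle = φ + toℕ k · (2 · π * 1/ 3)

  position : Vector Carrier d → Vector Point (3 ℕ.^ d)
  position φ a k = sum (λ i → triangle (φ i) (word {d} a i) k)

  triangleRotation : Vector Carrier d → Fin d → Vector Point (3 ℕ.^ d)
  triangleRotation φ i a = J (triangle (φ i) (word {d} a i))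

  relativeRotations : Vector Carrier d → Vector Carrier d → Vector Point (3 ℕ.^ d)
  relativeRotations φ θ =
    linearCombination (Velocities (3 ℕ.^ d)) θ (triangleRotation φ)

  module Hamming (φ : Vector Carrier d) =
    Framework (hammingAdjacent? d) (position φ)

{-# OPTIONS --safe #-}
module Submission where

-- No genericity is needed: the conclusions hold for every φ, so the exceptional set
-- can be the empty zero set of the constant 1.  A flex moves every triangle rigidly,
-- at some rate.  Around a 4-cycle with sides e, f in directions i ≠ j the rates satisfy
-- (ω - ω′) e = (θ - θ′) f; here ω - ω′ is the same for all edges e of triangle i, and
-- two of them are not parallel, so both differences vanish.  Hence the rate of a
-- triangle depends only on its direction, and the flexes are t + ∑ θᵢ J Tᵢ[aᵢ].
-- A complement of these is given by the velocities that vanish at the origin and, at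
-- the word with a single letter 1 in place i, are parallel to the edge to the origin.
-- The rigidity matrix maps this complement isomorphically onto its column space.
-- That the triangles are equilateral with unit sides follows from cos (2π/3) = -1/2,
-- and hence from the addition formulas, which are Cauchy products of Taylor series.

open import Defs
open import Data.Nat using (ℕ; zero; suc)
open import Data.Product using (Σ; ∃; _×_; _,_; proj₁; proj₂; uncurry)
open import Data.Vec.Functional as Vector using (Vector)
open import Function.Bundles using (_⇔_; _↔_; mk⇔; mk↔ₛ′; Equivalence; Inverse)
import Algebra.Apartness.Properties.HeytingCommutativeRing as HeytingProperties
open import Algebra.Bundles using (CommutativeRing)
open import Algebra.Module.Bundles using (LeftModule)
import Algebra.Properties.AbelianGroup as AbelianGroupProperties
import Algebra.Properties.CommutativeSemiring.Binomial as Binomial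
import Algebra.Properties.CommutativeSemiring.Exp as Exp
import Algebra.Properties.Ring as RingProperties
import Algebra.Properties.Semiring.Mult as Mult
import Algebra.Properties.Semiring.Mult.TCOptimised as OptimisedMult
import Algebra.Properties.Semiring.Sum as Sum
import Algebra.Solver.Ring as RingSolver
open import Algebra.Solver.Ring.AlmostCommutativeRing using (fromCommutativeRing; _-Raw-AlmostCommutative⟶_)
open import Data.Bool.Base using (if_then_else_)
open import Data.Empty using (⊥)
open import Data.Fin.Base as Fin using (Fin; zero; suc; toℕ; fromℕ<; funToFin; combine; remQuot; _↑ˡ_; _↑ʳ_)
open import Data.Fin.Patterns using (0F; 1F; 2F)
import Data.Fin.Properties as Finₚ
open import Data.Integer.Base as ℤ using (ℤ; +_; -[1+_])
import Data.Integer.Properties as ℤₚ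
open import Data.List.Base as List using (List; []; _∷_; length; allFin; cartesianProduct)
open import Data.List.Membership.Propositional using (_∈_)
open import Data.List.Membership.Propositional.Properties
  using (∈-filter⁺; ∈-filter⁻; ∈-cartesianProduct⁺; ∈-allFin; ∈-lookup)
import Data.List.Relation.Unary.All as All
open import Data.List.Relation.Unary.AllPairs using (_∷_)
open import Data.List.Relation.Unary.Any using (here; there; index)
open import Data.List.Relation.Unary.Any.Properties using (lookup-index)
open import Data.List.Relation.Unary.Unique.Propositional using (Unique)
open import Data.Maybe.Base as Maybe using (Maybe)
open import Data.Nat.Base as ℕ using (_!)
open import Data.Nat.Combinatorics using (_C_; k![n∸k]!∣n!; nCk≡n!/k![n-k]!)
open import Data.Nat.DivMod using (m/n*n≡m)
import Data.Nat.Properties as ℕₚ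
open import Data.Nat.Tactic.RingSolver using () renaming (solve-∀ to ℕ-solve-∀)
open import Data.Product.Function.NonDependent.Propositional using (_×-↔_)
open import Data.Sum.Base using (_⊎_; inj₁; inj₂; [_,_])
open import Data.Sum.Function.Propositional using (_⊎-↔_)
open import Data.Unit.Base using (⊤; tt)
open import Data.Vec.Base as Vec using (Vec; []; _∷_; lookup; replicate; tabulate; _[_]≔_)
import Data.Vec.Properties as Vecₚ
open import Function.Base using (id; _∘_)
open import Function.Construct.Composition using (_↔-∘_)
open import Function.Construct.Identity using (↔-id)
open import Relation.Binary.Definitions using (tri<; tri≈; tri>)
open import Relation.Binary.PropositionalEquality.Core as ≡ using (_≡_; _≢_)
open import Relation.Binary.Structures using (IsStrictPartialOrder)
open import Relation.Nullary using (¬_; yes; no; does; contradiction)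
open import Relation.Nullary.Decidable using (dec-true; dec-false; dec⇒maybe; decidable-stable)

-- From `UnitTriangles` to `RigidityRank` the argument takes place over a commutative ring in which
-- 3x² = 0 forces x = 0. The 3 comes from the area of a unit triangle, whose two sides satisfy 4
-- (cross e₁ e₂)² = 3; this cancellation and pairing with unit vectors stand in for divisions. The
-- number d - 1 arises because the global rotation is the sum of the d triangle rotations, so one
-- rate can be normalised to 0. For the addition formulas, convergence of both Taylor series at
-- every point is given, and it already implies that xⁿ/n! tends to 0 for all x. Used at a multiple
-- of x, this decay outweighs the quadratic number of terms in which a Cauchy square and its
-- triangle differ.

-- Polynomial identities and finite sums in a commutative ring

module IntegerCoefficients {c ℓ} (R : CommutativeRing c ℓ) where
  open CommutativeRing R hiding (zero)
  open AbelianGroupProperties +-abelianGroup using (ε⁻¹≈ε; ⁻¹-∙-comm; ⁻¹-involutive)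
  open RingProperties ring using (-‿distribˡ-*; -‿distribʳ-*)
  open OptimisedMult semiring using (×-homo-+; ×1-homo-*; 1+×) renaming (_×_ to _·_)
  open import Relation.Binary.Reasoning.Setoid setoid

  -- The optimised multiple makes `⟦ + 1 ⟧` compute to `1#` and `⟦ + 3 ⟧` to `1# + 1# + 1#`, so
  -- solved identities match such goals definitionally. The multiple of `RealNumbers` ends in `+ 0#`
  -- instead, which is why some identities below spell out a numeral as a nested sum ending in
  -- `con (+ 0)`.
  ⟦_⟧ : ℤ → Carrier
  ⟦ + n ⟧      = n · 1#
  ⟦ -[1+ n ] ⟧ = - (suc n · 1#)

  ⊖-homo : ∀ m n → ⟦ m ℤ.⊖ n ⟧ ≈ m · 1# - n · 1#
  ⊖-homo m       zero    = sym (trans (+-congˡ ε⁻¹≈ε) (+-identityʳ _))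
  ⊖-homo zero    (suc n) = sym (+-identityˡ _)
  ⊖-homo (suc m) (suc n) = begin
    ⟦ suc m ℤ.⊖ suc n ⟧             ≡⟨ ≡.cong ⟦_⟧ (ℤₚ.[1+m]⊖[1+n]≡m⊖n m n) ⟩
    ⟦ m ℤ.⊖ n ⟧                     ≈⟨ ⊖-homo m n ⟩
    m · 1# - n · 1#                 ≈⟨ +-congʳ (+-identityʳ _) ⟨
    (m · 1# + 0#) - n · 1#          ≈⟨ +-congʳ (+-congˡ (-‿inverseʳ 1#)) ⟨
    (m · 1# + (1# - 1#)) - n · 1#   ≈⟨ +-congʳ (+-assoc _ _ _) ⟨
    ((m · 1# + 1#) - 1#) - n · 1#   ≈⟨ +-assoc _ _ _ ⟩
    (m · 1# + 1#) + (- 1# - n · 1#) ≈⟨ +-cong (+-comm _ _) (⁻¹-∙-comm _ _) ⟩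
    (1# + m · 1#) - (1# + n · 1#)   ≈⟨ +-cong (1+× m 1#) (-‿cong (1+× n 1#)) ⟨
    suc m · 1# - suc n · 1#         ∎

  +-homo : ∀ i j → ⟦ i ℤ.+ j ⟧ ≈ ⟦ i ⟧ + ⟦ j ⟧
  +-homo (+ m)      (+ n)      = ×-homo-+ 1# m n
  +-homo (+ m)      (-[1+ n ]) = ⊖-homo m (suc n)
  +-homo (-[1+ m ]) (+ n)      = trans (⊖-homo n (suc m)) (+-comm _ _)
  +-homo (-[1+ m ]) (-[1+ n ]) = begin
    - (suc (suc (m ℕ.+ n)) · 1#)    ≡⟨ ≡.cong (λ k → - (k · 1#)) (ℕₚ.+-suc (suc m) n) ⟨
    - ((suc m ℕ.+ suc n) · 1#)      ≈⟨ -‿cong (×-homo-+ 1# (suc m) (suc n)) ⟩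
    - (suc m · 1# + suc n · 1#)     ≈⟨ ⁻¹-∙-comm _ _ ⟨
    - (suc m · 1#) - (suc n · 1#)   ∎

  -‿homo : ∀ i → ⟦ ℤ.- i ⟧ ≈ - ⟦ i ⟧
  -‿homo (+ zero)   = sym ε⁻¹≈ε
  -‿homo (+ suc n)  = refl
  -‿homo (-[1+ n ]) = sym (⁻¹-involutive _)

  *-homo : ∀ i j → ⟦ i ℤ.* j ⟧ ≈ ⟦ i ⟧ * ⟦ j ⟧
  *-homo (+ m)       (+ n)      = begin
    ⟦ + m ℤ.* + n ⟧ ≡⟨ ≡.cong ⟦_⟧ (ℤₚ.pos-* m n) ⟨
    (m ℕ.* n) · 1#  ≈⟨ ×1-homo-* m n ⟩
    m · 1# * n · 1# ∎
  *-homo (+ zero)    (-[1+ n ]) = sym (zeroˡ _)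
  *-homo (+ suc m)   (-[1+ n ]) =
    trans (-‿cong (×1-homo-* (suc m) (suc n))) (-‿distribʳ-* _ _)
  *-homo (-[1+ m ])  (+ zero)   = begin
    ⟦ -[1+ m ] ℤ.* + zero ⟧ ≡⟨ ≡.cong ⟦_⟧ (ℤₚ.*-zeroʳ -[1+ m ]) ⟩
    0#                      ≈⟨ zeroʳ _ ⟨
    - (suc m · 1#) * 0#     ∎
  *-homo (-[1+ m ])  (+ suc n)  =
    trans (-‿cong (×1-homo-* (suc m) (suc n))) (-‿distribˡ-* _ _)
  *-homo (-[1+ m ])  (-[1+ n ]) = begin
    (suc m ℕ.* suc n) · 1#              ≈⟨ ×1-homo-* (suc m) (suc n) ⟩
    suc m · 1# * suc n · 1#             ≈⟨ ⁻¹-involutive _ ⟨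
    - - (suc m · 1# * suc n · 1#)       ≈⟨ -‿cong (-‿distribˡ-* _ _) ⟩
    - (- (suc m · 1#) * suc n · 1#)     ≈⟨ -‿distribʳ-* _ _ ⟩
    - (suc m · 1#) * - (suc n · 1#)     ∎

  morphism : ℤ.+-*-rawRing -Raw-AlmostCommutative⟶ fromCommutativeRing R
  morphism = record
    { ⟦_⟧    = ⟦_⟧
    ; +-homo = +-homo
    ; *-homo = *-homo
    ; -‿homo = -‿homo
    ; 0-homo = refl
    ; 1-homo = refl
    }

  coefficient≟ : ∀ i j → Maybe (⟦ i ⟧ ≈ ⟦ j ⟧)
  coefficient≟ i j = Maybe.map (λ i≡j → reflexive (≡.cong ⟦_⟧ i≡j)) (dec⇒maybe (i ℤₚ.≟ j))

  open RingSolver ℤ.+-*-rawRing (fromCommutativeRing R) morphism coefficient≟ public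
    using (solve; con; _:+_; _:*_; _:-_; :-_; _:=_)

module RingLemmas {c ℓ} (R : CommutativeRing c ℓ) where
  open CommutativeRing R hiding (zero)
  open AbelianGroupProperties +-abelianGroup public
    using () renaming (x∙y⁻¹≈ε⇒x≈y to x-y≈0⇒x≈y; x≈y⇒x∙y⁻¹≈ε to x≈y⇒x-y≈0; ε⁻¹≈ε to -0≈0)

  infixl 7 _*0 
  infixl 6 _+0_

  -- The multiplier is implicit, so a proof that ∑ aᵢ hᵢ vanishes lists only the proofs of hᵢ ≈ 0;
  -- the aᵢ are read off the polynomial identity given to `modulo`.
  _*0 : ∀ {x y} → y ≈ 0# → x * y ≈ 0#
  y≈0 *0 = trans (*-congˡ y≈0) (zeroʳ _)

  _+0_ : ∀ {x y} → x ≈ 0# → y ≈ 0# → x + y ≈ 0#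
  x≈0 +0 y≈0 = trans (+-cong x≈0 y≈0) (+-identityˡ 0#)

  -- Where x ≈ y follows from hypotheses hᵢ ≈ 0, it does so through a polynomial
  -- identity x = y + ∑ aᵢ hᵢ.
  modulo : ∀ {x y z} → x ≈ y + z → z ≈ 0# → x ≈ y
  modulo x≈y+z z≈0 = trans x≈y+z (trans (+-congˡ z≈0) (+-identityʳ _))

module SumLemmas {c ℓ} (R : CommutativeRing c ℓ) where
  open CommutativeRing R hiding (zero)
  open Sum semiring public using (sum; sum-cong-≋; ∑-distrib-+; *-distribˡ-sum; sum-replicate-zero; ∑-comm)
  open IntegerCoefficients R
  open RingLemmas R

  sum-zero : ∀ {n} (f : Vector Carrier n) → (∀ i → f i ≈ 0#) → sum f ≈ 0#
  sum-zero {n} f f≈0 = trans (sum-cong-≋ f≈0) (sum-replicate-zero n)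

  sum-neg : ∀ {n} (f : Vector Carrier n) → sum (λ i → - f i) ≈ - sum f
  sum-neg {zero}  f = sym -0≈0
  sum-neg {suc n} f = trans (+-congˡ (sum-neg (f ∘ suc)))
    (solve 2 (λ x y → :- x :+ :- y := :- (x :+ y)) refl _ _)

  sum-minus : ∀ {n} (f g : Vector Carrier n) → sum (λ i → f i - g i) ≈ sum f - sum g
  sum-minus f g = trans (∑-distrib-+ f (λ i → - g i)) (+-congˡ (sum-neg g))

  sum-single : ∀ {n} (f : Vector Carrier n) i → (∀ j → j ≢ i → f j ≈ 0#) → sum f ≈ f i
  sum-single f zero    f≈0 =
    trans (+-congˡ (sum-zero (f ∘ suc) (λ j → f≈0 (suc j) λ ()))) (+-identityʳ _)
  sum-single f (suc i) f≈0 =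
    trans (+-cong (f≈0 zero λ ()) (sum-single (f ∘ suc) i
      (λ j j≢i → f≈0 (suc j) (j≢i ∘ Finₚ.suc-injective)))) (+-identityˡ _)

  sum-minus-single : ∀ {n} (f g : Vector Carrier n) i → (∀ j → j ≢ i → f j ≈ g j) →
                     sum f - sum g ≈ f i - g i
  sum-minus-single f g i f≈g = trans (sym (sum-minus f g))
    (sum-single (λ j → f j - g j) i (λ j j≢i → x≈y⇒x-y≈0 (f≈g j j≢i)))

-- Infinitesimal rigidity of a unit equilateral triangle

module UnitTriangles {c ℓ} (R : CommutativeRing c ℓ) where
  open CommutativeRing R hiding (zero)
  open PlaneRigidity R
  open IntegerCoefficients R
  open RingLemmas R
  open SumLemmas R

  infixl 6 _⊖_

  _⊖_ : Point → Point → Point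
  (p ⊖ q) k = p k - q k

  3# : Carrier
  3# = 1# + 1# + 1#

  -- What the rigidity argument takes from the reals beyond the ring axioms. It allows cancelling a
  -- cross product D with 4 D² = 3, and passing from μ² = 0 to μ = 0.
  TripleSquaresVanish : Set _
  TripleSquaresVanish = ∀ x → 3# * (x * x) ≈ 0# → x ≈ 0#

  UnitEquilateral : Vector Point 3 → Set _
  UnitEquilateral T = ∀ k l → k ≢ l → (T k ⊖ T l) ∙ (T k ⊖ T l) ≈ 1#

  ∙-congˡ : ∀ p {q q′} → (∀ k → q k ≈ q′ k) → p ∙ q ≈ p ∙ q′
  ∙-congˡ p q≈q′ = +-cong (*-congˡ (q≈q′ 0F)) (*-congˡ (q≈q′ 1F))

  ∙-congʳ : ∀ q {p p′} → (∀ k → p k ≈ p′ k) → p ∙ q ≈ p′ ∙ q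
  ∙-congʳ q p≈p′ = +-cong (*-congʳ (p≈p′ 0F)) (*-congʳ (p≈p′ 1F))

  -- Expansion of v in the orthonormal pair e, J e, in which the component along e vanishes.
  perpendicular-to-unit : ∀ v e → e ∙ e ≈ 1# → v ∙ e ≈ 0# → ∀ k → v k ≈ (v ∙ J e) * J e k
  perpendicular-to-unit v e e²≈1 v⊥e 0F = modulo
    (solve 4 (λ v₀ v₁ e₀ e₁ → v₀ := (v₀ :* (:- e₁) :+ v₁ :* e₀) :* (:- e₁)
      :+ (e₀ :* (v₀ :* e₀ :+ v₁ :* e₁) :+ (:- v₀) :* (e₀ :* e₀ :+ e₁ :* e₁ :- con (+ 1)))) refl
      (v 0F) (v 1F) (e 0F) (e 1F))
    (v⊥e *0 +0 (x≈y⇒x-y≈0 e²≈1) *0)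
  perpendicular-to-unit v e e²≈1 v⊥e 1F = modulo
    (solve 4 (λ v₀ v₁ e₀ e₁ → v₁ := (v₀ :* (:- e₁) :+ v₁ :* e₀) :* e₀
      :+ (e₁ :* (v₀ :* e₀ :+ v₁ :* e₁) :+ (:- v₁) :* (e₀ :* e₀ :+ e₁ :* e₁ :- con (+ 1)))) refl
      (v 0F) (v 1F) (e 0F) (e 1F))
    (v⊥e *0 +0 (x≈y⇒x-y≈0 e²≈1) *0)

  cross : Point → Point → Carrier
  cross p q = p 0F * q 1F - p 1F * q 0F

  module _ (vanish : TripleSquaresVanish) {T : Vector Point 3} (equilateral : UnitEquilateral T) where

    private
      e₁ e₂ : Point
      e₁ = T 1F ⊖ T 0F
      e₂ = T 2F ⊖ T 0F

      |e₁| : e₁ ∙ e₁ ≈ 1#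
      |e₁| = equilateral 1F 0F λ ()

      |e₂| : e₂ ∙ e₂ ≈ 1#
      |e₂| = equilateral 2F 0F λ ()

      -- Polarisation: 2 e₁∙e₂ = |e₁|² + |e₂|² - |e₂ - e₁|² = 1 + 1 - 1. The doubled form avoids the
      -- fraction 1/2.
      2e₁∙e₂ : (e₁ ∙ e₂ + e₁ ∙ e₂) - 1# ≈ 0#
      2e₁∙e₂ = modulo
        (solve 6 (λ a a′ b b′ c c′ → 
          let inner = (b :- a) :* (c :- a) :+ (b′ :- a′) :* (c′ :- a′)
              sq = λ x x′ y y′ → (x :- y) :* (x :- y) :+ (x′ :- y′) :* (x′ :- y′) :- con (+ 1) in
          inner :+ inner :- con (+ 1) := con (+ 0) :+
            (sq b b′ a a′ :+ (sq c c′ a a′ :+ con -[1+ 0 ] :* sq c c′ b b′)))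
          refl (T 0F 0F) (T 0F 1F) (T 1F 0F) (T 1F 1F) (T 2F 0F) (T 2F 1F))
        (x≈y⇒x-y≈0 |e₁| +0 (x≈y⇒x-y≈0 |e₂| +0 (x≈y⇒x-y≈0 (equilateral 2F 1F λ ())) *0))

    -- Lagrange's identity gives 4 (cross e₁ e₂)² = 3.
    cross-cancel : ∀ x → x * cross e₁ e₂ ≈ 0# → x ≈ 0#
    cross-cancel x xD≈0 = vanish x (modulo
      (solve 5 (λ x a a′ b b′ →
        let D = a :* b′ :- a′ :* b
            |a| = a :* a :+ a′ :* a′
            |b| = b :* b :+ b′ :* b′
            ab = a :* b :+ a′ :* b′ in
        con (+ 3) :* (x :* x) := con (+ 0) :+
          ((con (+ 4) :* x :* D) :* (x :* D)
          :+ ((:- (con (+ 4) :* x :* x :* |b|)) :* (|a| :- con (+ 1))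
          :+ ((:- (con (+ 4) :* x :* x)) :* (|b| :- con (+ 1))
          :+ (x :* x :* (ab :+ ab :+ con (+ 1))) :* (ab :+ ab :- con (+ 1))))))
        refl x (e₁ 0F) (e₁ 1F) (e₂ 0F) (e₂ 1F))
      (xD≈0 *0 +0 ((x≈y⇒x-y≈0 |e₁|) *0 +0 ((x≈y⇒x-y≈0 |e₂|) *0 +0 2e₁∙e₂ *0))))

    -- The two sides at corner 0 turn at rates α and β by perpendicularity. The condition on the
    -- third side then reads (α - β) cross e₁ e₂ = 0 up to sign, and the cross product cancels.
    triangle-rigid : (V : Vector Point 3) →
      (∀ k l → (V k ⊖ V l) ∙ (T k ⊖ T l) ≈ 0#) →
      ∃ λ ω → ∀ k i → V k i ≈ V 0F i + ω * (J (T k) i - J (T 0F) i)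
    triangle-rigid V flex = α , λ where
        0F 0F → solve 3 (λ v ω t → v := v :+ ω :* (:- t :- :- t)) refl (V 0F 0F) α (T 0F 1F)
        0F 1F → solve 3 (λ v ω t → v := v :+ ω :* (t :- t)) refl (V 0F 1F) α (T 0F 0F)
        1F 0F → x-rate (rate₁ 0F)
        1F 1F → y-rate (rate₁ 1F)
        2F 0F → x-rate (trans (rate₂ 0F) (*-congʳ (sym α≈β)))
        2F 1F → y-rate (trans (rate₂ 1F) (*-congʳ (sym α≈β)))
      where
      v₁ v₂ : Point
      v₁ = V 1F ⊖ V 0F
      v₂ = V 2F ⊖ V 0F
      α β : Carrier
      α = v₁ ∙ J e₁
      β = v₂ ∙ J e₂
      rate₁ : ∀ k → v₁ k ≈ α * J e₁ k
      rate₁ = perpendicular-to-unit v₁ e₁ |e₁| (flex 1F 0F)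
      rate₂ : ∀ k → v₂ k ≈ β * J e₂ k
      rate₂ = perpendicular-to-unit v₂ e₂ |e₂| (flex 2F 0F)

      x-rate : ∀ {v v′ ω t t′} → v - v′ ≈ ω * (- (t - t′)) → v ≈ v′ + ω * (- t - (- t′))
      x-rate {v} {v′} {ω} {t} {t′} eq = modulo
        (solve 5 (λ v v′ ω t t′ → v := v′ :+ ω :* (:- t :- :- t′) :+ (v :- v′ :- ω :* (:- (t :- t′))))
          refl v v′ ω t t′)
        (x≈y⇒x-y≈0 eq)
      y-rate : ∀ {v v′ x} → v - v′ ≈ x → v ≈ v′ + x
      y-rate {v} {v′} {x} eq = modulo
        (solve 3 (λ v v′ x → v := v′ :+ x :+ (v :- v′ :- x)) refl v v′ x) (x≈y⇒x-y≈0 eq)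

      α≈β : α ≈ β
      α≈β = x-y≈0⇒x≈y _ _ (cross-cancel (α - β) (modulo
        (solve 12 (λ t₀ t₀′ t₁ t₁′ t₂ t₂′ v₀ v₀′ v₁ v₁′ v₂ v₂′ →
          let a = t₁ :- t₀ ; a′ = t₁′ :- t₀′ ; b = t₂ :- t₀ ; b′ = t₂′ :- t₀′
              p = v₁ :- v₀ ; p′ = v₁′ :- v₀′ ; q = v₂ :- v₀ ; q′ = v₂′ :- v₀′
              α = p :* (:- a′) :+ p′ :* a
              β = q :* (:- b′) :+ q′ :* b in
          (α :- β) :* (a :* b′ :- a′ :* b) := con (+ 0) :+
          (((v₂ :- v₁) :* (t₂ :- t₁) :+ (v₂′ :- v₁′) :* (t₂′ :- t₁′)) :* con -[1+ 0 ]
          :+ ((b :- a) :* (q :- β :* (:- b′)) :+ ((b′ :- a′) :* (q′ :- β :* b)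
          :+ ((a :- b) :* (p :- α :* (:- a′)) :+ (a′ :- b′) :* (p′ :- α :* a))))))
          refl
          (T 0F 0F) (T 0F 1F) (T 1F 0F) (T 1F 1F) (T 2F 0F) (T 2F 1F)
          (V 0F 0F) (V 0F 1F) (V 1F 0F) (V 1F 1F) (V 2F 0F) (V 2F 1F))
        (trans (*-congʳ (flex 2F 1F)) (zeroˡ _) +0
          ((x≈y⇒x-y≈0 (rate₂ 0F)) *0 +0 ((x≈y⇒x-y≈0 (rate₂ 1F)) *0 +0
          ((x≈y⇒x-y≈0 (rate₁ 0F)) *0 +0 (x≈y⇒x-y≈0 (rate₁ 1F)) *0))))))

-- Flexes as velocity fields on words

Word : ℕ → Set
Word = Vec (Fin 3)

origin : ∀ {d} → Word d
origin = replicate _ 0F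

unit : ∀ {d} → Fin d → Word d
unit i = origin [ i ]≔ 1F

module FlexesOfWords {c ℓ} (R : CommutativeRing c ℓ) (vanish : UnitTriangles.TripleSquaresVanish R) where
  open CommutativeRing R hiding (zero)
  open PlaneRigidity R
  open IntegerCoefficients R
  open RingLemmas R
  open SumLemmas R
  open UnitTriangles R
  open import Relation.Binary.Reasoning.Setoid setoid

  -- An edge is a word with one place overwritten in two ways. Updates compute on `l ∷ w`, so the
  -- restriction of a flex to the words with first letter l is a flex without any transport.
  IsWordFlex : ∀ {d} → (Fin d → Vector Point 3) → (Word d → Point) → Set _
  IsWordFlex T V = ∀ w i k l → (V (w [ i ]≔ k) ⊖ V (w [ i ]≔ l)) ∙ (T i k ⊖ T i l) ≈ 0#

  -- Rotation of the triangle about its corner 0 at unit rate. With this normalisation the letter 0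
  -- contributes nothing, and `turns` vanishes at `origin`.
  turn : Vector Point 3 → Fin 3 → Point
  turn T k = J (T k) ⊖ J (T 0F)

  turns : ∀ {d} → (Fin d → Vector Point 3) → Vector Carrier d → Word d → Point
  turns T θ w k = sum (λ i → θ i * turn (T i) (lookup w i) k)

  |turn| : ∀ {T k} → UnitEquilateral T → k ≢ 0F → turn T k ∙ turn T k ≈ 1#
  |turn| {T} {k} equilateral k≢0 = trans
    (solve 4 (λ a a′ b b′ → let sq = λ x → x :* x in
       sq (:- a′ :- :- b′) :+ sq (a :- b) := sq (a :- b) :+ sq (a′ :- b′)) refl
      (T k 0F) (T k 1F) (T 0F 0F) (T 0F 1F))
    (equilateral k 0F k≢0)

  turn-0 : ∀ T i → turn T 0F i ≈ 0#
  turn-0 T i = -‿inverseʳ (J (T 0F) i)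

  turns-origin : ∀ {d} T θ k → turns {d} T θ origin k ≈ 0#
  turns-origin T θ k = sum-zero _ (λ i → trans
    (*-congˡ (trans (reflexive (≡.cong (λ l → turn (T i) l k) (Vecₚ.lookup-replicate i 0F)))
      (turn-0 (T i) k))) (zeroʳ _))

  turns-unit : ∀ {d} T θ (i : Fin d) k → turns T θ (unit i) k ≈ θ i * turn (T i) 1F k
  turns-unit T θ i k = trans
    (sum-single (λ j → θ j * turn (T j) (lookup (unit i) j) k) i λ j j≢i → trans
      (*-congˡ (trans (reflexive (≡.cong (λ l → turn (T j) l k)
        (≡.trans (Vecₚ.lookup∘updateAt′ j i j≢i origin) (Vecₚ.lookup-replicate j 0F))))
        (turn-0 (T j) k))) (zeroʳ _))
    (*-congˡ (reflexive (≡.cong (λ l → turn (T i) l k) (Vecₚ.lookup∘updateAt i origin))))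

  -- Pairing x e with e gives x, since e ∙ e = 1.
  scaled-unit-zero : ∀ x {e : Point} → e ∙ e ≈ 1# → (∀ k → x * e k ≈ 0#) → x ≈ 0#
  scaled-unit-zero x {e} |e| xe≈0 = modulo
    (solve 3 (λ x e e′ → x := con (+ 0) :+
      (e :* (x :* e) :+ (e′ :* (x :* e′) :+ (:- x) :* (e :* e :+ e′ :* e′ :- con (+ 1)))))
      refl x (e 0F) (e 1F))
    (xe≈0 0F *0 +0 (xe≈0 1F *0 +0 (x≈y⇒x-y≈0 |e|) *0))

  -- f cannot be parallel to two edges of a triangle: the cross product of the
  -- equations for k = 1 and k = 2 is μ² cross (T₁ - T₀) (T₂ - T₀) = 0.
  parallel-to-two-edges : ∀ {T} → UnitEquilateral T → ∀ μ (Δ : Vector Carrier 3) {f : Point} →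
    f ∙ f ≈ 1# → (∀ k i → μ * turn T k i ≈ Δ k * f i) → ∀ k → Δ k ≈ 0#
  parallel-to-two-edges {T} equilateral μ Δ {f} |f| eq k = scaled-unit-zero (Δ k) |f| λ i →
    trans (sym (eq k i)) (trans (*-congʳ μ≈0) (zeroˡ _))
    where
    μ²D≈0 : μ * μ * cross (T 1F ⊖ T 0F) (T 2F ⊖ T 0F) ≈ 0#
    μ²D≈0 = modulo
      (solve 11 (λ μ a a′ b b′ o o′ Δ₁ Δ₂ f f′ →
        μ :* μ :* ((a :- o) :* (b′ :- o′) :- (a′ :- o′) :* (b :- o)) := con (+ 0) :+
        (μ :* (b :- o) :* (μ :* (:- a′ :- :- o′) :- Δ₁ :* f)
        :+ (μ :* (b′ :- o′) :* (μ :* (a :- o) :- Δ₁ :* f′)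
        :+ (Δ₁ :* f :* (μ :* (b :- o) :- Δ₂ :* f′)
        :+ (:- (Δ₁ :* f′)) :* (μ :* (:- b′ :- :- o′) :- Δ₂ :* f))))) refl
        μ (T 1F 0F) (T 1F 1F) (T 2F 0F) (T 2F 1F) (T 0F 0F) (T 0F 1F) (Δ 1F) (Δ 2F) (f 0F) (f 1F))
      (x≈y⇒x-y≈0 (eq 1F 0F) *0 +0 (x≈y⇒x-y≈0 (eq 1F 1F) *0 +0
        (x≈y⇒x-y≈0 (eq 2F 1F) *0 +0 x≈y⇒x-y≈0 (eq 2F 0F) *0)))
    μ≈0 : μ ≈ 0#
    μ≈0 = vanish μ (trans (*-congˡ (cross-cancel vanish {T} equilateral (μ * μ) μ²D≈0)) (zeroʳ _))

  -- Induction on the length. The slice with first letter l has rates `θ l` by induction, and the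
  -- head triangle over a tail w has a rate `ω w`. The 4-cycles through `origin` and `unit i` give
  -- `θ l i ≈ θ 0F i`. A word is then reached from the origin by turning the head first, at rate
  -- `ω origin`, and the tail afterwards.
  flex-form : ∀ {d} (T : Fin d → Vector Point 3) → (∀ i → UnitEquilateral (T i)) →
    ∀ V → IsWordFlex T V → ∃ λ θ → ∀ w k → V w k ≈ V origin k + turns T θ w k
  flex-form {zero}  T equilateral V flex = (λ ()) , λ { [] k → sym (+-identityʳ _) }
  flex-form {suc d} T equilateral V flex = (ω origin Vector.∷ θ 0F) , form
    where
    head-rate : ∀ w → ∃ λ ω → ∀ l k → V (l ∷ w) k ≈ V (0F ∷ w) k + ω * turn (T 0F) l k
    head-rate w = triangle-rigid vanish {T 0F} (equilateral 0F) (λ k → V (k ∷ w)) (flex (0F ∷ w) 0F)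

    ω : Word d → Carrier
    ω w = proj₁ (head-rate w)

    tail-form : ∀ l → ∃ λ θ → ∀ w k → V (l ∷ w) k ≈ V (l ∷ origin) k + turns (T ∘ suc) θ w k
    tail-form l = flex-form (T ∘ suc) (equilateral ∘ suc) (λ w → V (l ∷ w))
      (λ w i → flex (l ∷ w) (suc i))

    θ : Fin 3 → Vector Carrier d
    θ l = proj₁ (tail-form l)

    tail-unit : ∀ l i k → V (l ∷ unit i) k ≈ V (l ∷ origin) k + θ l i * turn (T (suc i)) 1F k
    tail-unit l i k = trans (proj₂ (tail-form l) (unit i) k)
      (+-congˡ (turns-unit (T ∘ suc) (θ l) i k))

    -- The velocity at `l ∷ unit i` is computed from that at `0F ∷ origin` along both routes: head
    -- before tail, and tail before head.
    four-cycle : ∀ i l k → (ω (unit i) - ω origin) * turn (T 0F) l k ≈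
                           (θ l i - θ 0F i) * turn (T (suc i)) 1F k
    four-cycle i l k = modulo
      (solve 10 (λ ω₁ ω₀ e θ₁ θ₀ f v₀₀ v₀₁ v₁₀ v₁₁ →
        (ω₁ :- ω₀) :* e := (θ₁ :- θ₀) :* f :+
          ((v₁₁ :- (v₁₀ :+ θ₁ :* f)) :+ ((con -[1+ 0 ]) :* (v₁₁ :- (v₀₁ :+ ω₁ :* e))
          :+ (v₁₀ :- (v₀₀ :+ ω₀ :* e) :+ (con -[1+ 0 ]) :* (v₀₁ :- (v₀₀ :+ θ₀ :* f)))))) refl
        (ω (unit i)) (ω origin) (turn (T 0F) l k) (θ l i) (θ 0F i) (turn (T (suc i)) 1F k)
        (V (0F ∷ origin) k) (V (0F ∷ unit i) k) (V (l ∷ origin) k) (V (l ∷ unit i) k))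
      (x≈y⇒x-y≈0 (tail-unit l i k) +0 (x≈y⇒x-y≈0 (proj₂ (head-rate (unit i)) l k) *0 +0
        (x≈y⇒x-y≈0 (proj₂ (head-rate origin) l k) +0 x≈y⇒x-y≈0 (tail-unit 0F i k) *0)))

    θ-constant : ∀ l i → θ l i ≈ θ 0F i
    θ-constant l i = x-y≈0⇒x≈y _ _ (parallel-to-two-edges {T 0F} (equilateral 0F)
      (ω (unit i) - ω origin) (λ l → θ l i - θ 0F i)
      (|turn| {T (suc i)} {1F} (equilateral (suc i)) λ ()) (four-cycle i) l)

    form : ∀ w k → V w k ≈ V origin k + turns T (ω origin Vector.∷ θ 0F) w k
    form (l ∷ w) k = begin
      V (l ∷ w) k                                       ≈⟨ proj₂ (tail-form l) w k ⟩
      V (l ∷ origin) k + turns (T ∘ suc) (θ l) w k      ≈⟨ +-cong (proj₂ (head-rate origin) l k)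
        (sum-cong-≋ (λ i → *-congʳ (θ-constant l i))) ⟩
      V origin k + ω origin * turn (T 0F) l k + turns (T ∘ suc) (θ 0F) w k
        ≈⟨ +-assoc _ _ _ ⟩
      V origin k + turns T (ω origin Vector.∷ θ 0F) (l ∷ w) k ∎

-- Hamming frameworks

funToFin-cong : ∀ {m n} {f g : Fin m → Fin n} → (∀ i → f i ≡ g i) → funToFin f ≡ funToFin g
funToFin-cong {zero}  f≗g = ≡.refl
funToFin-cong {suc m} f≗g = ≡.cong₂ combine (f≗g zero) (funToFin-cong (f≗g ∘ suc))

vertex : ∀ {d} → Word d → Vertex d
vertex w = funToFin (lookup w)

letters : ∀ {d} → Vertex d → Word d
letters {d} a = tabulate (word {d} a)

word-vertex : ∀ {d} (w : Word d) i → word {d} (vertex w) i ≡ lookup w i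
word-vertex w = Finₚ.finToFun-funToFin (lookup w)

vertex-letters : ∀ {d} (a : Vertex d) → vertex {d} (letters {d} a) ≡ a
vertex-letters {d} a = ≡.trans (funToFin-cong (Vecₚ.lookup∘tabulate (word {d} a)))
  (Finₚ.funToFin-finToFin {d} a)

vertex-adjacent : ∀ {d} (w : Word d) i {k l} → k ≢ l →
                  HammingAdjacent d (vertex (w [ i ]≔ k)) (vertex (w [ i ]≔ l))
vertex-adjacent w i {k} {l} k≢l = i
  , (λ eq → k≢l (≡.trans (≡.sym (at k)) (≡.trans eq (at l))))
  , λ {j} wk≢wl → decidable-stable (i Finₚ.≟ j) λ i≢j →
      wk≢wl (≡.trans (elsewhere k (i≢j ∘ ≡.sym)) (≡.sym (elsewhere l (i≢j ∘ ≡.sym))))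
  where
  at : ∀ k → word (vertex (w [ i ]≔ k)) i ≡ k
  at k = ≡.trans (word-vertex (w [ i ]≔ k) i) (Vecₚ.lookup∘updateAt i w)
  elsewhere : ∀ k {j} → j ≢ i → word (vertex (w [ i ]≔ k)) j ≡ lookup w j
  elsewhere k {j} j≢i = ≡.trans (word-vertex (w [ i ]≔ k) j) (Vecₚ.lookup∘updateAt′ j i j≢i w)

adjacent-agree : ∀ {d a b} → ((i , _) : HammingAdjacent d a b) → ∀ j → j ≢ i → word {d} a j ≡ word {d} b j
adjacent-agree {d} {a} {b} (i , _ , unique) j j≢i =
  decidable-stable (word {d} a j Finₚ.≟ word {d} b j) (λ a≢b → j≢i (≡.sym (unique a≢b)))

module HammingFramework {c ℓ} (R : CommutativeRing c ℓ) (vanish : UnitTriangles.TripleSquaresVanish R)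
    {d : ℕ} (T : Fin d → Vector (PlaneRigidity.Point R) 3)
    (equilateral : ∀ i → UnitTriangles.UnitEquilateral R (T i)) where
  open CommutativeRing R hiding (zero)
  open PlaneRigidity R
  open LinearAlgebra R
  open IntegerCoefficients R
  open RingLemmas R
  open SumLemmas R
  open UnitTriangles R using (∙-congˡ; ∙-congʳ) renaming (_⊖_ to _∸ᵖ_)
  open FlexesOfWords R vanish
  open import Relation.Binary.Reasoning.Setoid setoid

  -- For `T i = triangle (φ i)` this unfolds to `position φ`, so what is shown here for arbitrary
  -- unit triangles applies to `Hamming φ` definitionally.
  P : Vector Point (3 ℕ.^ d)
  P a k = sum (λ i → T i (word {d} a i) k)

  open Framework (hammingAdjacent? d) P

  rotation : Fin d → Vector Point (3 ℕ.^ d)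
  rotation i a = J (T i (word {d} a i))

  rotations : Vector Carrier d → Vector Point (3 ℕ.^ d)
  rotations θ a k = sum (λ i → θ i * rotation i a k)

  linearCombination-at : ∀ {n m} x (b : Vector (Vector Point m) n) a k →
    linearCombination (Velocities m) x b a k ≈ sum (λ i → x i * b i a k)
  linearCombination-at {zero}  x b a k = refl
  linearCombination-at {suc n} x b a k = +-congˡ (linearCombination-at (x ∘ suc) (b ∘ suc) a k)

  edge-vector : ∀ a b → ((i , _) : HammingAdjacent d a b) → ∀ k →
                P a k - P b k ≈ T i (word {d} a i) k - T i (word {d} b i) k
  edge-vector a b ab@(i , _) k = sum-minus-single
    (λ i → T i (word {d} a i) k) (λ i → T i (word {d} b i) k) i
    (λ j j≢i → reflexive (≡.cong (λ l → T j l k) (adjacent-agree ab j j≢i)))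

  -- On an edge of direction i the velocity difference is J e, perpendicular to e. The ends of any
  -- other edge share their letter at place i and have equal velocities.
  rotation-flex : ∀ i → IsFlex (rotation i)
  rotation-flex i a b ab@(j , _) with i Finₚ.≟ j
  ... | yes ≡.refl = trans
    (∙-congˡ (rotation i a ⊖ rotation i b) (edge-vector a b ab))
    (solve 4 (λ p p′ q q′ → (:- p′ :- :- q′) :* (p :- q) :+ (p :- q) :* (p′ :- q′) := con (+ 0)) refl
      (T i (word {d} a i) 0F) (T i (word {d} a i) 1F) (T i (word {d} b i) 0F) (T i (word {d} b i) 1F))
  ... | no i≢j = trans
    (∙-congʳ (P a ⊖ P b) {rotation i a ⊖ rotation i b} {λ _ → 0#}
      (λ k → x≈y⇒x-y≈0 (reflexive (≡.cong (λ l → J (T i l) k) (adjacent-agree ab i i≢j)))))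
    (trans (zeroˡ _) refl +0 zeroˡ _)

  rotations-flex : ∀ θ → IsFlex (linearCombination (Velocities (3 ℕ.^ d)) θ rotation)
  rotations-flex θ = lc-flex θ rotation rotation-flex
    where
    open Subspace flexes
    lc-flex : ∀ {n} (x : Vector Carrier n) b → (∀ i → IsFlex (b i)) →
              IsFlex (linearCombination (Velocities (3 ℕ.^ d)) x b)
    lc-flex {zero}  x b flex = 0-closed
    lc-flex {suc n} x b flex = +-closed {u = λ a k → x 0F * b 0F a k}
      {v = linearCombination (Velocities (3 ℕ.^ d)) (x ∘ suc) (b ∘ suc)}
      (*ₗ-closed (x 0F) {b 0F} (flex 0F)) (lc-flex (x ∘ suc) (b ∘ suc) (flex ∘ suc))

  trivial-flex : ∀ v → IsTrivial v → IsFlex v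
  trivial-flex v (t , θ , eq) a b _ = trans
    (∙-congʳ (P a ⊖ P b) (λ k → +-cong (eq a k) (-‿cong (eq b k))))
    (solve 7 (λ t t′ θ p p′ q q′ →
      (t :+ θ :* (:- p′) :- (t :+ θ :* (:- q′))) :* (p :- q)
      :+ (t′ :+ θ :* p :- (t′ :+ θ :* q)) :* (p′ :- q′) := con (+ 0)) refl
      (t 0F) (t 1F) θ (P a 0F) (P a 1F) (P b 0F) (P b 1F))

  flex⇒word-flex : ∀ v → IsFlex v → IsWordFlex T (v ∘ vertex)
  flex⇒word-flex v flex w i k l with k Finₚ.≟ l
  -- `IsWordFlex` also ranges over k = l, which is not an edge; there the velocity difference is
  -- zero.
  ... | yes ≡.refl = trans
    (∙-congʳ (T i k ∸ᵖ T i k) (λ j → -‿inverseʳ (v (vertex (w [ i ]≔ k)) j)))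
    (zeroˡ _ +0 zeroˡ _)
  ... | no k≢l = trans
    (∙-congˡ (v (vertex (w [ i ]≔ k)) ∸ᵖ v (vertex (w [ i ]≔ l))) λ j → sym (trans
      (edge-vector _ _ (vertex-adjacent w i k≢l) j)
      (+-cong (reflexive (≡.cong (λ l → T i l j) (at k)))
        (-‿cong (reflexive (≡.cong (λ l → T i l j) (at l)))))))
    (flex _ _ (vertex-adjacent w i k≢l))
    where
    at : ∀ k → word {d} (vertex (w [ i ]≔ k)) i ≡ k
    at k = ≡.trans (word-vertex (w [ i ]≔ k) i) (Vecₚ.lookup∘updateAt i w)

  rotations-turns : ∀ θ a b k → (∀ i → word {d} b i ≡ 0F) →
                    rotations θ a k - rotations θ b k ≈ turns T θ (letters {d} a) k
  rotations-turns θ a b k b≡0 = trans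
    (sym (sum-minus (λ i → θ i * rotation i a k) (λ i → θ i * rotation i b k)))
    (sum-cong-≋ λ i → trans
      (solve 3 (λ θ x y → θ :* x :- θ :* y := θ :* (x :- y)) refl _ _ _)
      (*-congˡ (+-cong
        (reflexive (≡.cong (λ l → J (T i l) k) (≡.sym (Vecₚ.lookup∘tabulate (word {d} a) i))))
        (-‿cong (reflexive (≡.cong (λ l → J (T i l) k) (b≡0 i)))))))

  word-origin : ∀ i → word {d} (vertex {d} origin) i ≡ 0F
  word-origin i = ≡.trans (word-vertex {d} origin i) (Vecₚ.lookup-replicate i 0F)

  rigid-form : ∀ v → IsFlex v → ∃ λ (t : Point) → ∃ λ θ → ∀ a k → v a k ≈ t k + rotations θ a k
  rigid-form v flex = t , θ , λ a k → begin
    v a k                                 ≡⟨ ≡.cong (λ a → v a k) (vertex-letters {d} a) ⟨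
    v (vertex {d} (letters {d} a)) k      ≈⟨ form (letters {d} a) k ⟩
    v o k + turns T θ (letters {d} a) k   ≈⟨ +-congˡ (rotations-turns θ a o k word-origin) ⟨
    v o k + (rotations θ a k - rotations θ o k)
      ≈⟨ solve 3 (λ x y z → x :+ (y :- z) := x :- z :+ y) refl _ _ _ ⟩
    t k + rotations θ a k ∎
    where
    o : Vertex d
    o = vertex {d} origin
    word-form : ∃ λ θ → ∀ w k → v (vertex w) k ≈ v o k + turns T θ w k
    word-form = flex-form T equilateral (v ∘ vertex) (flex⇒word-flex v flex)
    θ = proj₁ word-form
    form = proj₂ word-form
    -- `turns` is normalised at the origin and `rotations` is not; the translation absorbs the
    -- difference.
    t : Point
    t k = v o k - rotations θ o k

  -- Between `unit i` and `origin` the translation and all other rotations cancel, which leaves θᵢ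
  -- times a unit vector. The translation t is included for the later use modulo trivial motions.
  rotations-independent : ∀ (t : Point) θ → (∀ a k → t k + rotations θ a k ≈ 0#) → ∀ i → θ i ≈ 0#
  rotations-independent t θ zero-field i = scaled-unit-zero (θ i)
    (|turn| {T i} {1F} (equilateral i) λ ()) λ k → modulo
      (solve 4 (λ x t r s → x := con (+ 0) :+ (t :+ r :+ (con -[1+ 0 ] :* (t :+ s) :+
        con -[1+ 0 ] :* (r :- s :- x)))) refl
        (θ i * turn (T i) 1F k) (t k) (rotations θ (vertex {d} (unit i)) k) (rotations θ (vertex {d} origin) k))
      (zero-field (vertex {d} (unit i)) k +0 (zero-field (vertex {d} origin) k *0 +0
        (x≈y⇒x-y≈0 (difference k)) *0))
    where
    difference : ∀ k → rotations θ (vertex {d} (unit i)) k - rotations θ (vertex {d} origin) k ≈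
                       θ i * turn (T i) 1F k
    difference k = trans (rotations-turns θ (vertex {d} (unit i)) (vertex {d} origin) k word-origin)
      (trans (sum-cong-≋ λ j → *-congˡ (+-congʳ (reflexive (≡.cong (λ l → J (T j l) k)
        (≡.trans (Vecₚ.lookup∘tabulate (word {d} (vertex {d} (unit i))) j) (word-vertex {d} (unit i) j))))))
        (turns-unit T θ i k))

  independent : LinearlyIndependent (Velocities (3 ℕ.^ d)) rotation
  independent θ θ≈0 = rotations-independent (λ _ → 0#) θ λ a k → trans (+-identityˡ _)
    (trans (sym (linearCombination-at θ rotation a k)) (θ≈0 a k))

  -- The one relation between the triangle rotations modulo trivial motions: turning all triangles
  -- at the same rate is the global rotation.
  J-position : ∀ a k → J (P a) k ≈ sum (λ i → rotation i a k)
  J-position a 0F = sym (sum-neg (λ i → T i (word {d} a i) 1F))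
  J-position a 1F = refl

  flex⇔rotations+trivial : ∀ v → IsFlex v ⇔
    (∃ λ θ → IsTrivial (v -ⱽ linearCombination (Velocities (3 ℕ.^ d)) θ rotation))
  flex⇔rotations+trivial v = mk⇔ to from
    where
    to : IsFlex v → _
    to flex with rigid-form v flex
    -- The trivial part can be a pure translation, since a global rotation is already a combination
    -- of the triangle rotations.
    ... | t , θ , form = θ , t , 0# , λ a k → trans
      (+-cong (form a k) (-‿cong (linearCombination-at θ rotation a k)))
      (solve 3 (λ t r x → t :+ r :- r := t :+ con (+ 0) :* x) refl _ _ _)
    from : _ → IsFlex v
    from (θ , trivial) = resp-≈ {u = λ a k → (v a k - relative a k) + relative a k} {v = v}
      (λ a k → solve 2 (λ x y → x :- y :+ y := x) refl _ _)
      (+-closed {u = v -ⱽ relative} {v = relative} (trivial-flex _ trivial) (rotations-flex θ))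
      where
      open Subspace flexes
      relative = linearCombination (Velocities (3 ℕ.^ d)) θ rotation

-- Dimension of the internal flexibility

module InternalFlexibility {c ℓ} (R : CommutativeRing c ℓ) (vanish : UnitTriangles.TripleSquaresVanish R)
    {d : ℕ} (T : Fin (suc d) → Vector (PlaneRigidity.Point R) 3)
    (equilateral : ∀ i → UnitTriangles.UnitEquilateral R (T i)) where
  open CommutativeRing R hiding (zero)
  open PlaneRigidity R
  open LinearAlgebra R
  open IntegerCoefficients R
  open RingLemmas R
  open SumLemmas R
  open HammingFramework R vanish T equilateral
  open Framework (hammingAdjacent? (suc d)) P
  open import Relation.Binary.Reasoning.Setoid setoid

  -- Modulo the global rotation triangle 0 can be held still, so the rotations of the other d
  -- triangles represent all classes.
  tailSum : Vector Carrier d → Vertex (suc d) → Fin 2 → Carrier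
  tailSum x a k = sum (λ i → x i * rotation (suc i) a k)

  tailTotal : Vertex (suc d) → Fin 2 → Carrier
  tailTotal a k = sum (λ i → rotation (suc i) a k)

  tailSum-minus : ∀ x θ a k → tailSum (λ i → x i - θ) a k ≈ tailSum x a k - θ * tailTotal a k
  tailSum-minus x θ a k = begin
    tailSum (λ i → x i - θ) a k
      ≈⟨ sum-cong-≋ (λ i → solve 3 (λ x θ r → (x :- θ) :* r := x :* r :- θ :* r) refl
           (x i) θ (rotation (suc i) a k)) ⟩
    sum (λ i → x i * rotation (suc i) a k - θ * rotation (suc i) a k)
      ≈⟨ sum-minus (λ i → x i * rotation (suc i) a k) (λ i → θ * rotation (suc i) a k) ⟩
    tailSum x a k - sum (λ i → θ * rotation (suc i) a k)
      ≈⟨ +-congˡ (-‿cong (*-distribˡ-sum θ (λ i → rotation (suc i) a k))) ⟨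
    tailSum x a k - θ * tailTotal a k ∎

  -- By `J-position`, moving the trivial motion to the left gives a vanishing combination with rate
  -- -θ for triangle 0 and xᵢ - θ for the others. Independence yields θ = 0 first, and then xᵢ = 0.
  trivial-tailSum : ∀ x (t : Point) θ → (∀ a k → tailSum x a k ≈ t k + θ * J (P a) k) → ∀ i → x i ≈ 0#
  trivial-tailSum x t θ eq i = modulo
    (solve 2 (λ x θ → x := con (+ 0) :+ (x :- θ :+ con -[1+ 0 ] :* (:- θ))) refl (x i) θ)
    (y≈0 (suc i) +0 y≈0 0F *0)
    where
    y : Vector Carrier (suc d)
    y = (- θ) Vector.∷ λ i → x i - θ
    zero-field : ∀ a k → - t k + rotations y a k ≈ 0#
    zero-field a k = begin
      - t k + rotations y a k
        ≈⟨ +-congˡ (+-congˡ (trans (tailSum-minus x θ a k)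
             (+-congʳ (trans (eq a k) (+-congˡ (*-congˡ (J-position a k))))))) ⟩
      - t k + (- θ * rotation 0F a k + (t k + θ * (rotation 0F a k + tailTotal a k) - θ * tailTotal a k))
        ≈⟨ solve 4 (λ t θ r s → :- t :+ (:- θ :* r :+ (t :+ θ :* (r :+ s) :- θ :* s)) := con (+ 0)) refl
             (t k) θ (rotation 0F a k) (tailTotal a k) ⟩
      0# ∎
    y≈0 : ∀ i → y i ≈ 0#
    y≈0 = rotations-independent (λ k → - t k) y zero-field

  -- Subtracting the rate of triangle 0 from all rates changes the flex by a global rotation only.
  tail-form : ∀ (v : Vector Point (3 ℕ.^ suc d)) (t : Point) θ → (∀ a k → v a k ≈ t k + rotations θ a k) →
    ∀ a k → v a k - tailSum (λ i → θ (suc i) - θ 0F) a k ≈ t k + θ 0F * J (P a) k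
  tail-form v t θ form a k = begin
    v a k - tailSum (λ i → θ (suc i) - θ 0F) a k
      ≈⟨ +-cong (form a k) (-‿cong (tailSum-minus (θ ∘ suc) (θ 0F) a k)) ⟩
    t k + (θ 0F * rotation 0F a k + tailSum (θ ∘ suc) a k) - (tailSum (θ ∘ suc) a k - θ 0F * tailTotal a k)
      ≈⟨ solve 5 (λ t θ r q s → t :+ (θ :* r :+ q) :- (q :- θ :* s) := t :+ θ :* (r :+ s)) refl
           (t k) (θ 0F) (rotation 0F a k) (tailSum (θ ∘ suc) a k) (tailTotal a k) ⟩
    t k + θ 0F * (rotation 0F a k + tailTotal a k)  ≈⟨ +-congˡ (*-congˡ (J-position a k)) ⟨
    t k + θ 0F * J (P a) k ∎

  Flex : Set _
  Flex = Σ (Vector Point (3 ℕ.^ suc d)) IsFlex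

  basis : Vector Flex d
  basis i = rotation (suc i) , rotation-flex (suc i)

  combination-at : ∀ {n} x (b : Vector Flex n) a k →
    proj₁ (linearCombination internalFlexibility x b) a k ≈ sum (λ i → x i * proj₁ (b i) a k)
  combination-at {zero}  x b a k = refl
  combination-at {suc n} x b a k = +-congˡ (combination-at (x ∘ suc) (b ∘ suc) a k)

  basis-independent : LinearlyIndependent internalFlexibility basis
  -- Vanishing in the quotient means that the combination minus zero is a trivial motion; the
  -- subtracted zero is removed here.
  basis-independent x (t , θ , eq) = trivial-tailSum x t θ λ a k → trans
    (sym (trans (+-congˡ -0≈0) (trans (+-identityʳ _) (combination-at x basis a k)))) (eq a k)

  basis-spans : ∀ v → InSpan internalFlexibility basis v
  basis-spans (v , flex) = let t , θ , form = rigid-form v flex in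
    (λ i → θ (suc i) - θ 0F) , t , θ 0F , λ a k →
      trans (+-congˡ (-‿cong (combination-at (λ i → θ (suc i) - θ 0F) basis a k))) (tail-form v t θ form a k)

  dimension : HasDimension internalFlexibility d
  dimension = basis , basis-independent , basis-spans

-- The rank of the rigidity matrix

-- Kept indexes coordinates for the complement of the flexes: the velocities that
-- vanish at the origin and lie on a line at each unit word.  With the first letter
-- fixed to 0 these are again of this form; with first letter 1 only the velocity
-- at the origin of the remaining letters is confined to a line (Pinned).
Full : ℕ → Set
Full d = Word d × Fin 2

Pinned : ℕ → Set
Pinned zero    = ⊤
Pinned (suc d) = Pinned d ⊎ (Full d ⊎ Full d)

Kept : ℕ → Set
Kept zero    = ⊥
Kept (suc d) = Kept d ⊎ (Pinned d ⊎ Full d)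

fullCount pinnedCount keptCount : ℕ → ℕ
fullCount d = 3 ℕ.^ d ℕ.* 2
pinnedCount zero    = 1
pinnedCount (suc d) = pinnedCount d ℕ.+ (fullCount d ℕ.+ fullCount d)
keptCount zero    = 0
keptCount (suc d) = keptCount d ℕ.+ (pinnedCount d ℕ.+ fullCount d)

letters-vertex : ∀ {d} (w : Word d) → letters {d} (vertex w) ≡ w
letters-vertex w = ≡.trans (Vecₚ.tabulate-cong (word-vertex w)) (Vecₚ.tabulate∘lookup w)

enumerateFull : ∀ d → Fin (fullCount d) ↔ Full d
enumerateFull d =
  (mk↔ₛ′ (letters {d}) vertex letters-vertex (vertex-letters {d}) ×-↔ ↔-id (Fin 2))
    ↔-∘ Finₚ.*↔× {3 ℕ.^ d} {2}

enumeratePinned : ∀ d → Fin (pinnedCount d) ↔ Pinned d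
enumeratePinned zero    = Finₚ.1↔⊤
enumeratePinned (suc d) =
  (enumeratePinned d ⊎-↔ ((enumerateFull d ⊎-↔ enumerateFull d) ↔-∘ Finₚ.+↔⊎)) ↔-∘ Finₚ.+↔⊎

enumerateKept : ∀ d → Fin (keptCount d) ↔ Kept d
enumerateKept zero    = Finₚ.0↔⊥
enumerateKept (suc d) =
  (enumerateKept d ⊎-↔ ((enumeratePinned d ⊎-↔ enumerateFull d) ↔-∘ Finₚ.+↔⊎)) ↔-∘ Finₚ.+↔⊎

1+pinnedCount : ∀ d → 1 ℕ.+ pinnedCount d ≡ fullCount d
1+pinnedCount zero    = ≡.refl
1+pinnedCount (suc d) = ≡.trans
  (≡.cong (ℕ._+ (fullCount d ℕ.+ fullCount d)) (1+pinnedCount d))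
  (identity (3 ℕ.^ d))
  where
  identity : ∀ n → n ℕ.* 2 ℕ.+ (n ℕ.* 2 ℕ.+ n ℕ.* 2) ≡ 3 ℕ.* n ℕ.* 2
  identity = ℕ-solve-∀

-- The 2 + d lost coordinates are the two at the origin and one at each unit word, as many as the
-- parameters (t, θ) of a flex.
keptCount+2+d : ∀ d → keptCount d ℕ.+ (2 ℕ.+ d) ≡ 2 ℕ.* 3 ℕ.^ d
keptCount+2+d zero    = ≡.refl
keptCount+2+d (suc d) = ≡.trans (rearrange (keptCount d) (pinnedCount d) (fullCount d) d)
  (≡.trans (≡.cong₂ (λ x y → x ℕ.+ (y ℕ.+ fullCount d)) (keptCount+2+d d) (1+pinnedCount d))
    (identity (3 ℕ.^ d)))
  where
  rearrange : ∀ k p f d → k ℕ.+ (p ℕ.+ f) ℕ.+ (2 ℕ.+ suc d) ≡ k ℕ.+ (2 ℕ.+ d) ℕ.+ (1 ℕ.+ p ℕ.+ f)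
  rearrange = ℕ-solve-∀
  identity : ∀ n → 2 ℕ.* n ℕ.+ (n ℕ.* 2 ℕ.+ n ℕ.* 2) ≡ 2 ℕ.* (3 ℕ.* n)
  identity = ℕ-solve-∀

keptCount≡ : ∀ d → keptCount (suc d) ≡ 2 ℕ.* 3 ℕ.^ suc d ℕ.∸ 3 ℕ.∸ d
-- The truncated subtraction is exact: `keptCount+2+d` writes 2n as a sum with 2 + suc d = 3 + d.
keptCount≡ d = ≡.sym (≡.trans (ℕₚ.∸-+-assoc (2 ℕ.* 3 ℕ.^ suc d) 3 d)
  (≡.trans (≡.cong (ℕ._∸ (3 ℕ.+ d)) (≡.sym (keptCount+2+d (suc d))))
    (ℕₚ.m+n∸n≡m (keptCount (suc d)) (3 ℕ.+ d))))

-- Double sums and the dimension of a linear image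

module LinearAlgebraLemmas {c ℓ} (R : CommutativeRing c ℓ) where
  open CommutativeRing R hiding (zero)
  open LinearAlgebra R
  open RingLemmas R
  open SumLemmas R

  δ : ∀ {n} → Fin n → Fin n → Carrier
  δ a w = if does (a Finₚ.≟ w) then 1# else 0#

  δ-same : ∀ {n} (a : Fin n) → δ a a ≈ 1#
  δ-same a = reflexive (≡.cong (if_then 1# else 0#) (dec-true (a Finₚ.≟ a) ≡.refl))

  δ-other : ∀ {n} {a w : Fin n} → a ≢ w → δ a w ≈ 0#
  δ-other {a = a} {w} a≢w = reflexive (≡.cong (if_then 1# else 0#) (dec-false (a Finₚ.≟ w) a≢w))

  sum-δ : ∀ {n} (a : Fin n) (g : Vector Carrier n) → sum (λ w → g w * δ a w) ≈ g a
  sum-δ a g = trans (sum-single (λ w → g w * δ a w) a (λ w w≢a → δ-other (w≢a ∘ ≡.sym) *0))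
    (trans (*-congˡ (δ-same a)) (*-identityʳ _))

  sum-++ : ∀ m {n} (f : Vector Carrier (m ℕ.+ n)) →
           sum f ≈ sum (λ i → f (i ↑ˡ n)) + sum (λ j → f (m ↑ʳ j))
  sum-++ zero    f = sym (+-identityˡ _)
  sum-++ (suc m) f = trans (+-congˡ (sum-++ m (f ∘ suc))) (sym (+-assoc _ _ _))

  sum-× : ∀ m n (f : Vector Carrier (m ℕ.* n)) →
          sum f ≈ sum (λ i → sum (λ j → f (combine {m} {n} i j)))
  sum-× zero    n f = refl
  sum-× (suc m) n f = trans (sum-++ n f) (+-congˡ (sum-× m n (λ i → f (n ↑ʳ i))))

  module _ {m ℓm} (M : LeftModule ring m ℓm) where
    open LeftModule M

    linearCombination-cong : ∀ {n} {x y : Vector Carrier n} b → (∀ i → x i ≈ y i) →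
      linearCombination M x b ≈ᴹ linearCombination M y b
    linearCombination-cong {zero}  b x≈y = ≈ᴹ-refl
    linearCombination-cong {suc n} b x≈y =
      +ᴹ-cong (*ₗ-congʳ (x≈y zero)) (linearCombination-cong (b ∘ suc) (x≈y ∘ suc))

    -- A linear bijection carries the delta functions to a basis. The coordinates are indexed by I,
    -- so that structured index types such as `Kept d` are enumerated only here.
    dimension-of-image : ∀ {I : Set} {r} → Fin r ↔ I → (F : (I → Carrier) → Carrierᴹ) →
      (∀ {x y} → (∀ i → x i ≈ y i) → F x ≈ᴹ F y) →
      (∀ {n} (x : Vector Carrier n) y → F (λ j → sum (λ i → x i * y i j)) ≈ᴹ linearCombination M x (F ∘ y)) →
      (∀ x → F x ≈ᴹ 0ᴹ → ∀ i → x i ≈ 0#) →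
      (∀ u → ∃ λ x → u ≈ᴹ F x) →
      HasDimension M r
    dimension-of-image {I} enumeration F F-cong F-linear F-injective F-surjective =
      F ∘ e , independent , spans
      where
      open Inverse enumeration

      e : Vector (I → Carrier) _
      e i j = δ (from j) i

      F-expansion : ∀ x → F x ≈ᴹ linearCombination M (x ∘ to) (F ∘ e)
      F-expansion x = ≈ᴹ-trans
        (F-cong λ j → sym (trans (sum-δ (from j) (x ∘ to))
          (reflexive (≡.cong x (strictlyInverseˡ j)))))
        (F-linear (x ∘ to) e)

      independent : LinearlyIndependent M (F ∘ e)
      independent x x≈0 i = trans (reflexive (≡.cong x (≡.sym (strictlyInverseʳ i))))
        (F-injective (x ∘ from) (≈ᴹ-trans (F-expansion (x ∘ from))
          (≈ᴹ-trans (linearCombination-cong (F ∘ e)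
            (λ i → reflexive (≡.cong x (strictlyInverseʳ i)))) x≈0)) (to i))

      spans : ∀ u → InSpan M (F ∘ e) u
      spans u with F-surjective u
      ... | x , u≈Fx = x ∘ to , ≈ᴹ-trans u≈Fx (F-expansion x)

-- Normalised velocity fields, a complement of the flexes

module NormalisedFields {c ℓ} (R : CommutativeRing c ℓ) (vanish : UnitTriangles.TripleSquaresVanish R) where
  open CommutativeRing R hiding (zero)
  open PlaneRigidity R
  open IntegerCoefficients R
  open RingLemmas R
  open SumLemmas R
  open UnitTriangles R
  open FlexesOfWords R vanish

  -- The vector n is the normal of the line at the origin. In `kept` it is J e for an edge e, so J n
  -- = - e and the line is that of the edge.
  pinned : ∀ {d} → Point → (Pinned d → Carrier) → Word d → Point
  pinned {zero}  n x []       k = x tt * J n k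
  pinned {suc d} n x (0F ∷ w) k = pinned n (x ∘ inj₁) w k
  pinned {suc d} n x (1F ∷ w) k = x (inj₂ (inj₁ (w , k)))
  pinned {suc d} n x (2F ∷ w) k = x (inj₂ (inj₂ (w , k)))

  kept : ∀ {d} → (Fin d → Vector Point 3) → (Kept d → Carrier) → Word d → Point
  kept {zero}  T x []       k = 0#
  kept {suc d} T x (0F ∷ w) k = kept (T ∘ suc) (x ∘ inj₁) w k
  kept {suc d} T x (1F ∷ w) k = pinned (turn (T 0F) 1F) (x ∘ inj₂ ∘ inj₁) w k
  kept {suc d} T x (2F ∷ w) k = x (inj₂ (inj₂ (w , k)))

  pinned-cong : ∀ {d} n {x y : Pinned d → Carrier} → (∀ i → x i ≈ y i) →
                ∀ w k → pinned n x w k ≈ pinned n y w k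
  pinned-cong n x≈y []       k = *-congʳ (x≈y tt)
  pinned-cong n x≈y (0F ∷ w) k = pinned-cong n (x≈y ∘ inj₁) w k
  pinned-cong n x≈y (1F ∷ w) k = x≈y _
  pinned-cong n x≈y (2F ∷ w) k = x≈y _

  kept-cong : ∀ {d} T {x y : Kept d → Carrier} → (∀ i → x i ≈ y i) →
              ∀ w k → kept T x w k ≈ kept T y w k
  kept-cong T x≈y []       k = refl
  kept-cong T x≈y (0F ∷ w) k = kept-cong (T ∘ suc) (x≈y ∘ inj₁) w k
  kept-cong T x≈y (1F ∷ w) k = pinned-cong _ (x≈y ∘ inj₂ ∘ inj₁) w k
  kept-cong T x≈y (2F ∷ w) k = x≈y _

  pinned-linear : ∀ {d m} n (x : Vector Carrier m) (y : Fin m → Pinned d → Carrier) w k →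
    pinned n (λ j → sum (λ i → x i * y i j)) w k ≈ sum (λ i → x i * pinned n (y i) w k)
  pinned-linear n x y [] k = trans (*-comm _ _) (trans
    (*-distribˡ-sum (J n k) (λ i → x i * y i tt))
    (sum-cong-≋ λ i → solve 3 (λ n x y → n :* (x :* y) := x :* (y :* n)) refl (J n k) (x i) (y i tt)))
  pinned-linear n x y (0F ∷ w) k = pinned-linear n x (λ i → y i ∘ inj₁) w k
  pinned-linear n x y (1F ∷ w) k = refl
  pinned-linear n x y (2F ∷ w) k = refl

  kept-linear : ∀ {d m} T (x : Vector Carrier m) (y : Fin m → Kept d → Carrier) w k →
    kept T (λ j → sum (λ i → x i * y i j)) w k ≈ sum (λ i → x i * kept T (y i) w k)
  kept-linear T x y []       k = sym (sum-zero (λ i → x i * 0#) (λ i → zeroʳ (x i)))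
  kept-linear T x y (0F ∷ w) k = kept-linear (T ∘ suc) x (λ i → y i ∘ inj₁) w k
  kept-linear T x y (1F ∷ w) k = pinned-linear _ x (λ i → y i ∘ inj₂ ∘ inj₁) w k
  kept-linear T x y (2F ∷ w) k = refl

  J-unit : ∀ n → n ∙ n ≈ 1# → J n ∙ J n ≈ 1#
  J-unit n |n| = trans
    (solve 2 (λ n n′ → (:- n′) :* (:- n′) :+ n :* n := n :* n :+ n′ :* n′) refl (n 0F) (n 1F)) |n|

  pinned-injective : ∀ {d} n → n ∙ n ≈ 1# → ∀ (x : Pinned d → Carrier) →
                     (∀ w k → pinned n x w k ≈ 0#) → ∀ i → x i ≈ 0#
  pinned-injective {zero}  n |n| x x≈0 tt = scaled-unit-zero (x tt) (J-unit n |n|) (x≈0 [])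
  pinned-injective {suc d} n |n| x x≈0 (inj₁ i) =
    pinned-injective n |n| (x ∘ inj₁) (λ w → x≈0 (0F ∷ w)) i
  pinned-injective {suc d} n |n| x x≈0 (inj₂ (inj₁ (w , k))) = x≈0 (1F ∷ w) k
  pinned-injective {suc d} n |n| x x≈0 (inj₂ (inj₂ (w , k))) = x≈0 (2F ∷ w) k

  pinned-surjective : ∀ {d} n → n ∙ n ≈ 1# → ∀ (V : Word d → Point) → V origin ∙ n ≈ 0# →
                      ∃ λ x → ∀ w k → V w k ≈ pinned n x w k
  pinned-surjective {zero}  n |n| V V⊥n = (λ _ → V [] ∙ J n) ,
    λ { [] → perpendicular-to-unit (V []) n |n| V⊥n }
  pinned-surjective {suc d} n |n| V V⊥n with pinned-surjective n |n| (λ w → V (0F ∷ w)) V⊥n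
  ... | x , V≈ = [ x , [ uncurry (λ w → V (1F ∷ w)) , uncurry (λ w → V (2F ∷ w)) ] ] , λ where
    (0F ∷ w) → V≈ w
    (1F ∷ w) k → refl
    (2F ∷ w) k → refl

  pinned-origin : ∀ {d} n (x : Pinned d → Carrier) → pinned n x origin ∙ n ≈ 0#
  pinned-origin {zero}  n x = solve 3 (λ x n n′ → x :* (:- n′) :* n :+ x :* n :* n′ := con (+ 0))
    refl (x tt) (n 0F) (n 1F)
  pinned-origin {suc d} n x = pinned-origin n (x ∘ inj₁)

  -- For a flex that vanishes at the origin, the pairing with `turn (T i) 1F` at `unit i` is its
  -- rate θᵢ. Hence a normalised flex is zero, and any field becomes normalised after one flex is
  -- subtracted.
  IsNormalised : ∀ {d} → (Fin d → Vector Point 3) → (Word d → Point) → Set _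
  IsNormalised T V = (∀ k → V origin k ≈ 0#) × (∀ i → V (unit i) ∙ turn (T i) 1F ≈ 0#)

  kept-normalised : ∀ {d} T (x : Kept d → Carrier) → IsNormalised T (kept T x)
  kept-normalised {zero}  T x = (λ k → refl) , λ ()
  kept-normalised {suc d} T x with kept-normalised (T ∘ suc) (x ∘ inj₁)
  ... | at-origin , at-units = at-origin , λ where
    zero    → pinned-origin (turn (T 0F) 1F) (x ∘ inj₂ ∘ inj₁)
    (suc i) → at-units i

  kept-injective : ∀ {d} T → (∀ i → UnitEquilateral (T i)) → ∀ (x : Kept d → Carrier) →
                   (∀ w k → kept T x w k ≈ 0#) → ∀ i → x i ≈ 0#
  kept-injective {suc d} T equilateral x x≈0 (inj₁ i) =
    kept-injective (T ∘ suc) (equilateral ∘ suc) (x ∘ inj₁) (λ w → x≈0 (0F ∷ w)) i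
  kept-injective {suc d} T equilateral x x≈0 (inj₂ (inj₁ i)) =
    pinned-injective (turn (T 0F) 1F) (|turn| {T 0F} {1F} (equilateral 0F) λ ())
      (x ∘ inj₂ ∘ inj₁) (λ w → x≈0 (1F ∷ w)) i
  kept-injective {suc d} T equilateral x x≈0 (inj₂ (inj₂ (w , k))) = x≈0 (2F ∷ w) k

  kept-surjective : ∀ {d} T → (∀ i → UnitEquilateral (T i)) → ∀ (V : Word d → Point) →
                    IsNormalised T V → ∃ λ x → ∀ w k → V w k ≈ kept T x w k
  kept-surjective {zero}  T equilateral V (at-origin , _) = (λ ()) , λ { [] → at-origin }
  kept-surjective {suc d} T equilateral V (at-origin , at-units)
    with kept-surjective (T ∘ suc) (equilateral ∘ suc) (λ w → V (0F ∷ w)) (at-origin , at-units ∘ suc)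
       | pinned-surjective (turn (T 0F) 1F) (|turn| {T 0F} {1F} (equilateral 0F) λ ())
           (λ w → V (1F ∷ w)) (at-units zero)
  ... | x , V≈x | y , V≈y = [ x , [ y , uncurry (λ w → V (2F ∷ w)) ] ] , λ where
    (0F ∷ w) → V≈x w
    (1F ∷ w) → V≈y w
    (2F ∷ w) k → refl

-- The column space as an image of the normalised fields

module RigidityRank {c ℓ} (R : CommutativeRing c ℓ) (vanish : UnitTriangles.TripleSquaresVanish R)
    {d : ℕ} (T : Fin d → Vector (PlaneRigidity.Point R) 3)
    (equilateral : ∀ i → UnitTriangles.UnitEquilateral R (T i)) where
  open CommutativeRing R hiding (zero)
  open PlaneRigidity R
  open LinearAlgebra R
  open IntegerCoefficients R
  open RingLemmas R
  open SumLemmas R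
  open UnitTriangles R using (∙-congʳ) renaming (_⊖_ to _∸ᵖ_)
  open FlexesOfWords R vanish
  open NormalisedFields R vanish
  open LinearAlgebraLemmas R
  open HammingFramework R vanish T equilateral
  open Framework (hammingAdjacent? d) P
  open import Relation.Binary.Reasoning.Setoid setoid

  n : ℕ
  n = 3 ℕ.^ d

  columns : Vector (Vector Carrier (length edges)) (n ℕ.* 2)
  columns j e = rigidityMatrix e j

  flatten : Vector Point n → Vector Carrier (n ℕ.* 2)
  flatten v j = let w , k = remQuot {n} 2 j in v w k

  combination : Vector Carrier (n ℕ.* 2) → Vector Carrier (length edges)
  combination y = linearCombination (scalars ^ᴹ Fin (length edges)) y columns

  combination-at : ∀ {m} (x : Vector Carrier m) (b : Vector (Vector Carrier (length edges)) m) e →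
    linearCombination (scalars ^ᴹ Fin (length edges)) x b e ≈ sum (λ i → x i * b i e)
  combination-at {zero}  x b e = refl
  combination-at {suc m} x b e = +-congˡ (combination-at (x ∘ suc) (b ∘ suc) e)

  -- The two `δ`s of a row pick out the end points of its edge, so the matrix applied to v is the
  -- flex condition, and its kernel consists of the flexes.
  combination-flatten : ∀ v e → let a , b = List.lookup edges e in
    combination (flatten v) e ≈ (v a ⊖ v b) ∙ (P a ⊖ P b)
  combination-flatten v e = begin
    combination (flatten v) e   ≈⟨ combination-at (flatten v) columns e ⟩
    sum term                    ≈⟨ sum-× n 2 term ⟩
    sum (λ w → sum (λ k → term (combine {n} {2} w k)))
      ≈⟨ sum-cong-≋ {n} (λ w → trans (+-cong (at w 0F) (+-congʳ (at w 1F)))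
           (solve 6 (λ v v′ x y q q′ → v :* ((x :- y) :* q) :+ (v′ :* ((x :- y) :* q′) :+ con (+ 0)) :=
               (v :* q :+ v′ :* q′) :* x :- (v :* q :+ v′ :* q′) :* y) refl
             (v w 0F) (v w 1F) (δ a w) (δ b w) (q 0F) (q 1F))) ⟩
    sum (λ w → (v w ∙ q) * δ a w - (v w ∙ q) * δ b w)
      ≈⟨ sum-minus (λ w → (v w ∙ q) * δ a w) (λ w → (v w ∙ q) * δ b w) ⟩
    sum (λ w → (v w ∙ q) * δ a w) - sum (λ w → (v w ∙ q) * δ b w)
      ≈⟨ +-cong (sum-δ a (λ w → v w ∙ q)) (-‿cong (sum-δ b (λ w → v w ∙ q))) ⟩
    v a ∙ q - v b ∙ q
      ≈⟨ solve 6 (λ x x′ y y′ q q′ → x :* q :+ x′ :* q′ :- (y :* q :+ y′ :* q′) :=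
           (x :- y) :* q :+ (x′ :- y′) :* q′) refl (v a 0F) (v a 1F) (v b 0F) (v b 1F) (q 0F) (q 1F) ⟩
    (v a ⊖ v b) ∙ q ∎
    where
    a = proj₁ (List.lookup edges e)
    b = proj₂ (List.lookup edges e)
    q : Point
    q = P a ⊖ P b
    term : Vector Carrier (n ℕ.* 2)
    term j = flatten v j * rigidityMatrix e j
    at : ∀ w k → term (combine {n} {2} w k) ≈ v w k * ((δ a w - δ b w) * q k)
    at w k = reflexive (≡.cong (λ (w , k) → v w k * ((δ a w - δ b w) * q k)) (Finₚ.remQuot-combine {n} {2} w k))

  flex⇒kernel : ∀ v → IsFlex v → ∀ e → combination (flatten v) e ≈ 0#
  flex⇒kernel v flex e = trans (combination-flatten v e)
    (flex a b (proj₂ (proj₂ (∈-filter⁻ _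
      {xs = cartesianProduct (allFin n) (allFin n)} (∈-lookup {xs = edges} e)))))
    where
    a = proj₁ (List.lookup edges e)
    b = proj₂ (List.lookup edges e)

  listed-flex : ∀ v → (∀ e → combination (flatten v) e ≈ 0#) →
    ∀ a b → HammingAdjacent d a b → a Fin.< b → (v a ⊖ v b) ∙ (P a ⊖ P b) ≈ 0#
  listed-flex v kernel a b ab a<b = ≡.subst (λ (a , b) → (v a ⊖ v b) ∙ (P a ⊖ P b) ≈ 0#)
    (≡.sym (lookup-index e∈)) (trans (sym (combination-flatten v (index e∈))) (kernel (index e∈)))
    where
    e∈ : (a , b) ∈ edges
    e∈ = ∈-filter⁺ _ (∈-cartesianProduct⁺ (∈-allFin a) (∈-allFin b)) (a<b , ab)

  -- Rows exist only for a < b. Exchanging the end points negates both factors of the product; for a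
  -- = b the first factor is zero.
  kernel⇒flex : ∀ v → (∀ e → combination (flatten v) e ≈ 0#) → IsFlex v
  kernel⇒flex v kernel a b ab with Finₚ.<-cmp a b
  ... | tri< a<b _ _ = listed-flex v kernel a b ab a<b
  ... | tri≈ _ ≡.refl _ = trans
    (∙-congʳ (P a ⊖ P a) {v a ⊖ v a} {λ _ → 0#} (λ k → -‿inverseʳ (v a k))) (zeroˡ _ +0 zeroˡ _)
  ... | tri> _ _ b<a = trans
    (solve 8 (λ x x′ y y′ p p′ q q′ → (x :- y) :* (p :- q) :+ (x′ :- y′) :* (p′ :- q′) :=
      (y :- x) :* (q :- p) :+ (y′ :- x′) :* (q′ :- p′)) refl
      (v a 0F) (v a 1F) (v b 0F) (v b 1F) (P a 0F) (P a 1F) (P b 0F) (P b 1F))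
    (listed-flex v kernel b a (i , i-differs ∘ ≡.sym , λ differs → unique (differs ∘ ≡.sym)) b<a)
    where
    i = proj₁ ab
    i-differs = proj₁ (proj₂ ab)
    unique = proj₂ (proj₂ ab)

  field-of : (Kept d → Carrier) → Vector Point n
  field-of x a = kept T x (letters {d} a)

  image : (Kept d → Carrier) → LeftModule.Carrierᴹ (subspaceModule (columnSpace rigidityMatrix))
  image x = combination (flatten (field-of x)) , flatten (field-of x) , λ e → refl

  image-combination-at : ∀ {m} (x : Vector Carrier m) b e →
    proj₁ (linearCombination (subspaceModule (columnSpace rigidityMatrix)) x b) e ≈
    sum (λ i → x i * proj₁ (b i) e)
  image-combination-at {zero}  x b e = refl
  image-combination-at {suc m} x b e = +-congˡ (image-combination-at (x ∘ suc) (b ∘ suc) e)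

  combination-cong : ∀ {x y} → (∀ j → x j ≈ y j) → ∀ e → combination x e ≈ combination y e
  combination-cong = linearCombination-cong (scalars ^ᴹ Fin (length edges)) columns

  image-linear : ∀ {m} (x : Vector Carrier m) y e →
    proj₁ (image (λ j → sum (λ i → x i * y i j))) e ≈
    proj₁ (linearCombination (subspaceModule (columnSpace rigidityMatrix)) x (image ∘ y)) e
  image-linear x y e = begin
    combination (flatten (field-of (λ j → sum (λ i → x i * y i j)))) e
      ≈⟨ combination-cong (λ j → kept-linear T x y _ _) e ⟩
    combination (λ j → sum (λ i → x i * z i j)) e
      ≈⟨ combination-at (λ j → sum (λ i → x i * z i j)) columns e ⟩
    sum (λ j → sum (λ i → x i * z i j) * columns j e)
      ≈⟨ sum-cong-≋ (λ j → trans (*-comm _ _) (trans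
           (*-distribˡ-sum (columns j e) (λ i → x i * z i j))
           (sum-cong-≋ λ i → solve 3 (λ a x z → a :* (x :* z) := x :* (z :* a)) refl
             (columns j e) (x i) (z i j)))) ⟩
    sum (λ j → sum (λ i → x i * (z i j * columns j e)))
      ≈⟨ ∑-comm (λ j i → x i * (z i j * columns j e)) ⟩
    sum (λ i → sum (λ j → x i * (z i j * columns j e)))
      ≈⟨ sum-cong-≋ (λ i → sym (trans (*-congˡ (combination-at (z i) columns e))
           (*-distribˡ-sum (x i) (λ j → z i j * columns j e)))) ⟩
    sum (λ i → x i * proj₁ (image (y i)) e)
      ≈⟨ image-combination-at x (image ∘ y) e ⟨
    proj₁ (linearCombination (subspaceModule (columnSpace rigidityMatrix)) x (image ∘ y)) e ∎
    where
    z : ∀ i → Vector Carrier (n ℕ.* 2)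
    z i = flatten (field-of (y i))

  -- A field with zero image is a flex, of the form V(origin) + turns θ. The normalisation at the
  -- origin removes the first part, and that at `unit i` gives θᵢ = 0.
  image-injective : ∀ x → (∀ e → proj₁ (image x) e ≈ 0#) → ∀ i → x i ≈ 0#
  image-injective x image≈0 = kept-injective T equilateral x λ w k → begin
    kept T x w k                    ≡⟨ ≡.cong (λ w → kept T x w k) (letters-vertex w) ⟨
    V w k                           ≈⟨ proj₂ form w k ⟩
    V origin k + turns T θ w k      ≈⟨ +-cong (origin≈0 k)
      (sum-zero _ λ i → trans (*-congʳ (θ≈0 i)) (zeroˡ _)) ⟩
    0# + 0#                         ≈⟨ +-identityˡ 0# ⟩
    0#                              ∎
    where
    V : Word d → Point
    V w = field-of x (vertex w)
    form : ∃ λ θ → ∀ w k → V w k ≈ V origin k + turns T θ w k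
    form = flex-form T equilateral V
      (flex⇒word-flex (field-of x) (kernel⇒flex (field-of x) image≈0))
    θ = proj₁ form
    V≡ : ∀ w → V w ≡ kept T x w
    V≡ w = ≡.cong (kept T x) (letters-vertex w)
    origin≈0 : ∀ k → V origin k ≈ 0#
    origin≈0 k = trans (reflexive (≡.cong (λ p → p k) (V≡ origin))) (proj₁ (kept-normalised T x) k)
    unit-turn : ∀ i k → V (unit i) k ≈ θ i * turn (T i) 1F k
    unit-turn i k = trans (proj₂ form (unit i) k)
      (trans (+-cong (origin≈0 k) (turns-unit T θ i k)) (+-identityˡ _))
    θ≈0 : ∀ i → θ i ≈ 0#
    θ≈0 i = begin
      θ i                                      ≈⟨ *-identityʳ (θ i) ⟨
      θ i * 1#                                 ≈⟨ *-congˡ (|turn| {T i} {1F} (equilateral i) λ ()) ⟨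
      θ i * (t ∙ t)                            ≈⟨ solve 3 (λ θ t t′ → θ :* (t :* t :+ t′ :* t′) :=
                                                    θ :* t :* t :+ θ :* t′ :* t′) refl (θ i) (t 0F) (t 1F) ⟩
      (λ k → θ i * t k) ∙ t                    ≈⟨ ∙-congʳ t (unit-turn i) ⟨
      V (unit i) ∙ t                           ≡⟨ ≡.cong (_∙ t) (V≡ (unit i)) ⟩
      kept T x (unit i) ∙ t                    ≈⟨ proj₂ (kept-normalised T x) i ⟩
      0#                                       ∎
      where
      t : Point
      t = turn (T i) 1F

  -- Subtracting from a preimage v the flex r that agrees with its value at the origin and its rates
  -- at the unit words leaves a normalised field. Since r lies in the kernel, the image is
  -- unchanged.
  image-surjective : ∀ (u : LeftModule.Carrierᴹ (subspaceModule (columnSpace rigidityMatrix))) →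
    ∃ λ x → ∀ e → proj₁ u e ≈ proj₁ (image x) e
  image-surjective (u , y , u≈y) = proj₁ normal-form , λ e → begin
    u e                                    ≈⟨ u≈y e ⟩
    combination y e                        ≈⟨ combination-cong (λ j →
                                                reflexive (≡.cong y (≡.sym (Finₚ.combine-remQuot {n} 2 j)))) e ⟩
    combination (flatten v) e              ≈⟨ combination-flatten v e ⟩
    (v (a e) ⊖ v (b e)) ∙ (P (a e) ⊖ P (b e))
      ≈⟨ solve 10 (λ v v′ w w′ r r′ s s′ q q′ → (v :- w) :* q :+ (v′ :- w′) :* q′ :=
           (v :- r :- (w :- s)) :* q :+ (v′ :- r′ :- (w′ :- s′)) :* q′ :+
           ((r :- s) :* q :+ (r′ :- s′) :* q′)) refl
           (v (a e) 0F) (v (a e) 1F) (v (b e) 0F) (v (b e) 1F)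
           (r (a e) 0F) (r (a e) 1F) (r (b e) 0F) (r (b e) 1F)
           ((P (a e) ⊖ P (b e)) 0F) ((P (a e) ⊖ P (b e)) 1F) ⟩
    ((λ k → v (a e) k - r (a e) k) ⊖ (λ k → v (b e) k - r (b e) k)) ∙ (P (a e) ⊖ P (b e))
      + (r (a e) ⊖ r (b e)) ∙ (P (a e) ⊖ P (b e))
      ≈⟨ +-cong (∙-congʳ (P (a e) ⊖ P (b e)) (λ k → +-cong (residue (a e) k) (-‿cong (residue (b e) k))))
           (trans (sym (combination-flatten r e)) (flex⇒kernel r r-flex e)) ⟩
    (field-of x (a e) ⊖ field-of x (b e)) ∙ (P (a e) ⊖ P (b e)) + 0#
      ≈⟨ +-identityʳ _ ⟩
    (field-of x (a e) ⊖ field-of x (b e)) ∙ (P (a e) ⊖ P (b e))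
      ≈⟨ combination-flatten (field-of x) e ⟨
    proj₁ (image x) e ∎
    where
    a b : Fin (length edges) → Fin n
    a e = proj₁ (List.lookup edges e)
    b e = proj₂ (List.lookup edges e)
    v : Vector Point n
    v w k = y (combine {n} {2} w k)
    V : Word d → Point
    V w = v (vertex w)
    θ : Vector Carrier d
    -- The component along the unit vector `turn (T i) 1F`, relative to the origin: subtracting this
    -- rate makes the pairing at `unit i` vanish.
    θ i = (V (unit i) ∸ᵖ V origin) ∙ turn (T i) 1F

    r : Vector Point n
    r a k = V origin k + turns T θ (letters {d} a) k
    r-flex : IsFlex r
    r-flex = resp-≈ {u = λ a k → t a k + s a k} {v = r} r≈
      (+-closed {u = t} {v = s} (trivial-flex t ((λ k → V origin k - rotations θ (vertex {d} origin) k) , 0# ,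
        λ a k → sym (trans (+-congˡ (zeroˡ _)) (+-identityʳ _))))
        (rotations-flex θ))
      where
      open Subspace flexes
      t s : Vector Point n
      t _ k = V origin k - rotations θ (vertex {d} origin) k
      s = linearCombination (Velocities n) θ rotation
      r≈ : ∀ a k → t a k + s a k ≈ r a k
      r≈ a k = begin
        t a k + s a k   ≈⟨ +-congˡ (linearCombination-at θ rotation a k) ⟩
        V origin k - rotations θ (vertex {d} origin) k + rotations θ a k
          ≈⟨ solve 3 (λ x y z → x :- y :+ z := x :+ (z :- y)) refl _ _ _ ⟩
        V origin k + (rotations θ a k - rotations θ (vertex {d} origin) k)
          ≈⟨ +-congˡ (rotations-turns θ a (vertex {d} origin) k word-origin) ⟩
        r a k ∎

    V′ : Word d → Point
    V′ w k = V w k - (V origin k + turns T θ w k)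

    V′-normalised : IsNormalised T V′
    V′-normalised = at-origin , at-units
      where
      at-origin : ∀ k → V′ origin k ≈ 0#
      at-origin k = trans (+-congˡ (-‿cong (+-congˡ (turns-origin T θ k))))
        (solve 1 (λ x → x :- (x :+ con (+ 0)) := con (+ 0)) refl _)
      at-units : ∀ i → V′ (unit i) ∙ turn (T i) 1F ≈ 0#
      at-units i = begin
        V′ (unit i) ∙ t    ≈⟨ ∙-congʳ t {V′ (unit i)} {λ k → V (unit i) k - (V origin k + θ i * t k)}
                               (λ k → +-congˡ (-‿cong (+-congˡ (turns-unit T θ i k)))) ⟩
        (λ k → V (unit i) k - (V origin k + θ i * t k)) ∙ t
          ≈⟨ solve 6 (λ v v′ o o′ t t′ →
               let θ = (v :- o) :* t :+ (v′ :- o′) :* t′ in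
               (v :- (o :+ θ :* t)) :* t :+ (v′ :- (o′ :+ θ :* t′)) :* t′ :=
               con -[1+ 0 ] :* θ :* (t :* t :+ t′ :* t′ :- con (+ 1))) refl
               (V (unit i) 0F) (V (unit i) 1F) (V origin 0F) (V origin 1F) (t 0F) (t 1F) ⟩
        - 1# * θ i * (t ∙ t - 1#)
          ≈⟨ x≈y⇒x-y≈0 (|turn| {T i} {1F} (equilateral i) λ ()) *0 ⟩
        0# ∎
        where
        t : Point
        t = turn (T i) 1F

    normal-form : ∃ λ x → ∀ w k → V′ w k ≈ kept T x w k
    normal-form = kept-surjective T equilateral V′ V′-normalised
    x = proj₁ normal-form

    residue : ∀ a k → v a k - r a k ≈ field-of x a k
    residue a k = trans
      (+-congʳ (reflexive (≡.cong (λ a → v a k) (≡.sym (vertex-letters {d} a)))))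
      (proj₂ normal-form (letters {d} a) k)

  rank : HasRank rigidityMatrix (keptCount d)
  rank = dimension-of-image (subspaceModule (columnSpace rigidityMatrix)) (enumerateKept d) image
    (λ x≈y → combination-cong λ j → kept-cong T x≈y _ _)
    image-linear image-injective image-surjective

-- Limits of real sequences

module OrderedField {c ℓ₁ ℓ₂ ℓ₃} (ℝ : RealNumbers c ℓ₁ ℓ₂ ℓ₃) where
  open RealNumbers ℝ hiding (zero; sum)
  open IntegerCoefficients commutativeRing
  open RingLemmas commutativeRing
  open IsStrictPartialOrder isStrictPartialOrder public using (<-respˡ-≈; <-respʳ-≈)
    renaming (trans to <-trans; irrefl to <-irrefl)

  <-resp : ∀ {x x′ y y′} → x ≈ x′ → y ≈ y′ → x < y → x′ < y′
  <-resp x≈x′ y≈y′ = <-respˡ-≈ x≈x′ ∘ <-respʳ-≈ y≈y′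

  <-asym : ∀ {x y} → x < y → ¬ (y < x)
  <-asym x<y y<x = <-irrefl refl (<-trans x<y y<x)

  -- The substitute for trichotomy, inherited from cotransitivity of apartness.
  <-cotrans : ∀ {x y} → x < y → ∀ z → x < z ⊎ z < y
  <-cotrans x<y z with #-cotrans (Equivalence.from #⇔<⊎> (inj₁ x<y)) z
  ... | inj₁ x#z = [ inj₁ , (λ z<x → inj₂ (<-trans z<x x<y)) ] (Equivalence.to #⇔<⊎> x#z)
  ... | inj₂ z#y = [ inj₂ , (λ y<z → inj₁ (<-trans x<y y<z)) ] (Equivalence.to #⇔<⊎> z#y)

  +-monoʳ-< : ∀ {x y} z → x < y → z + x < z + y
  +-monoʳ-< z x<y = <-resp (+-comm _ z) (+-comm _ z) (+-monoˡ-< z x<y)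

  +-mono-< : ∀ {x y u v} → x < y → u < v → x + u < y + v
  +-mono-< {y = y} {u} x<y u<v = <-trans (+-monoˡ-< u x<y) (+-monoʳ-< y u<v)

  x<y⇒0<y-x : ∀ {x y} → x < y → 0# < y - x
  x<y⇒0<y-x {x} x<y = <-respˡ-≈ (-‿inverseʳ x) (+-monoˡ-< (- x) x<y)

  0<y-x⇒x<y : ∀ {x y} → 0# < y - x → x < y
  0<y-x⇒x<y {x} {y} 0<y-x = <-resp (+-identityˡ x)
    (solve 2 (λ x y → y :- x :+ x := y) refl x y) (+-monoˡ-< x 0<y-x)

  neg-< : ∀ {x y} → x < y → - y < - x
  neg-< {x} {y} x<y = 0<y-x⇒x<y
    (<-respʳ-≈ (solve 2 (λ x y → y :- x := :- x :- :- y) refl x y) (x<y⇒0<y-x x<y))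

  x<x+y : ∀ {x y} → 0# < y → x < x + y
  x<x+y {x} 0<y = <-respˡ-≈ (+-identityʳ x) (+-monoʳ-< x 0<y)

  *-monoˡ-< : ∀ {x y z} → 0# < z → x < y → z * x < z * y
  *-monoˡ-< {x} {y} {z} 0<z x<y = 0<y-x⇒x<y (<-respʳ-≈
    (solve 3 (λ x y z → z :* (y :- x) := z :* y :- z :* x) refl x y z) (*-pos 0<z (x<y⇒0<y-x x<y)))

  -- Cotransitivity places x above 0 or below x + x, and subtracting x from the second inequality
  -- gives the first.
  pos-double⁻¹ : ∀ {x} → 0# < x + x → 0# < x
  pos-double⁻¹ {x} 0<2x with <-cotrans 0<2x x
  ... | inj₁ 0<x = 0<x
  ... | inj₂ x<2x = <-resp (-‿inverseʳ x) (solve 1 (λ x → x :+ x :- x := x) refl x) (+-monoˡ-< (- x) x<2x)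

  -- The product x y is invertible, hence y is, with inverse x (x y)⁻¹. So y is apart from 0, and y
  -- < 0 would make x y negative.
  pos-cancel : ∀ {x y} → 0# < x → 0# < x * y → 0# < y
  pos-cancel {x} {y} 0<x 0<xy with Equivalence.to #⇔<⊎>
      (HeytingProperties.invertibleʳ⇒# heytingCommutativeRing y-invertible)
    where
    i = inverse (x * y) (pos⇒#0 0<xy)
    y-invertible : ∃ λ z → (y - 0#) * z ≈ 1#
    y-invertible = x * i , trans
      (solve 3 (λ x y i → (y :- con (+ 0)) :* (x :* i) := i :* (x :* y :- con (+ 0))) refl x y i)
      (proj₁ (proj₂ (#⇒invertible (pos⇒#0 0<xy))))
  ... | inj₂ 0<y = 0<y
  ... | inj₁ y<0 = contradiction (<-respʳ-≈ (zeroʳ x) (*-monoˡ-< 0<x y<0)) (<-asym 0<xy)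

  *-cancelˡ-< : ∀ {x y z} → 0# < z → z * x < z * y → x < y
  *-cancelˡ-< {x} {y} {z} 0<z zx<zy = 0<y-x⇒x<y (pos-cancel 0<z (<-respʳ-≈
    (solve 3 (λ x y z → z :* y :- z :* x := z :* (y :- x)) refl x y z) (x<y⇒0<y-x zx<zy)))

  x*1/x≈1 : ∀ {x} (x#0 : x # 0#) → x * inverse x x#0 ≈ 1#
  x*1/x≈1 {x} x#0 = trans (*-congʳ (solve 1 (λ x → x := x :- con (+ 0)) refl x))
    (proj₂ (proj₂ (#⇒invertible x#0)))

  1/-pos : ∀ {x} (0<x : 0# < x) → 0# < inverse x (pos⇒#0 0<x)
  1/-pos 0<x = pos-cancel 0<x (<-respʳ-≈ (sym (x*1/x≈1 (pos⇒#0 0<x))) 0<1)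

  fraction : ∀ {K ε} → 0# < K → 0# < ε → ∃ λ δ → 0# < δ × K * δ ≈ ε
  fraction {K} {ε} 0<K 0<ε = i * ε , *-pos (1/-pos 0<K) 0<ε ,
    trans (sym (*-assoc K i ε)) (trans (*-congʳ (x*1/x≈1 (pos⇒#0 0<K))) (*-identityˡ ε))
    where i = inverse K (pos⇒#0 0<K)

  ≮⇒≈ : ∀ {x y} → ¬ (x < y) → ¬ (y < x) → x ≈ y
  ≮⇒≈ x≮y y≮x = proj₁ (tight _ _) λ x#y → [ x≮y , y≮x ] (Equivalence.to #⇔<⊎> x#y)

  infix 4 _within_

  -- |x| < ε without an absolute value. The relation `∣ x - y ∣< ε` unfolds to `x - y within ε`.
  _within_ : Carrier → Carrier → Set ℓ₃
  x within ε = - ε < x × x < ε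

  within-resp : ∀ {x y ε δ} → x ≈ y → ε ≈ δ → x within ε → y within δ
  within-resp x≈y ε≈δ (l , u) = <-resp (-‿cong ε≈δ) x≈y l , <-resp x≈y ε≈δ u

  within-zero : ∀ {ε} → 0# < ε → 0# within ε
  within-zero 0<ε = <-respʳ-≈ -0≈0 (neg-< 0<ε) , 0<ε

  within-weaken : ∀ {x ε δ} → ε < δ → x within ε → x within δ
  within-weaken ε<δ (l , u) = <-trans (neg-< ε<δ) l , <-trans u ε<δ

  within-pos : ∀ {x ε} → x within ε → 0# < ε
  within-pos {x} {ε} (l , u) = pos-double⁻¹ (<-respʳ-≈
    (solve 1 (λ ε → ε :- :- ε := ε :+ ε) refl ε) (x<y⇒0<y-x (<-trans l u)))

  within-+ : ∀ {x y ε δ} → x within ε → y within δ → x + y within ε + δ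
  within-+ {ε = ε} {δ} (l , u) (l′ , u′) =
    <-respˡ-≈ (solve 2 (λ ε δ → :- ε :+ :- δ := :- (ε :+ δ)) refl ε δ) (+-mono-< l l′) , +-mono-< u u′

  within-neg : ∀ {x ε} → x within ε → - x within ε
  within-neg {x} {ε} (l , u) = neg-< u ,
    <-respʳ-≈ (solve 1 (λ ε → :- :- ε := ε) refl ε) (neg-< l)

  -- 2 (ε δ ± x y) = (ε + x) (δ ± y) + (ε - x) (δ ∓ y)
  within-* : ∀ {x y ε δ} → x within ε → y within δ → x * y within ε * δ
  within-* {x} {y} {ε} {δ} (l , u) (l′ , u′) = 0<y-x⇒x<y (pos-double⁻¹ (<-respʳ-≈
      (solve 4 (λ x y ε δ → (ε :- x) :* (δ :- y) :+ (x :- :- ε) :* (y :- :- δ) :=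
        (x :* y :- :- (ε :* δ)) :+ (x :* y :- :- (ε :* δ))) refl x y ε δ)
      (sum-pos (*-pos (x<y⇒0<y-x u) (x<y⇒0<y-x u′)) (*-pos (x<y⇒0<y-x l) (x<y⇒0<y-x l′)))))
    , 0<y-x⇒x<y (pos-double⁻¹ (<-respʳ-≈
      (solve 4 (λ x y ε δ → (ε :- x) :* (y :- :- δ) :+ (x :- :- ε) :* (δ :- y) :=
        (ε :* δ :- x :* y) :+ (ε :* δ :- x :* y)) refl x y ε δ)
      (sum-pos (*-pos (x<y⇒0<y-x u) (x<y⇒0<y-x l′)) (*-pos (x<y⇒0<y-x l) (x<y⇒0<y-x u′)))))
    where
    sum-pos : ∀ {x y} → 0# < x → 0# < y → 0# < x + y
    sum-pos 0<x 0<y = <-respˡ-≈ (+-identityˡ 0#) (+-mono-< 0<x 0<y)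

  within-scale : ∀ {x ε z} → 0# < z → x within ε → z * x within z * ε
  within-scale {x} {ε} {z} 0<z (l , u) =
    <-respˡ-≈ (solve 2 (λ z ε → z :* :- ε := :- (z :* ε)) refl z ε) (*-monoˡ-< 0<z l) , *-monoˡ-< 0<z u

  within-unscale : ∀ {x ε z} → 0# < z → z * x within z * ε → x within ε
  within-unscale {x} {ε} {z} 0<z (l , u) = *-cancelˡ-< 0<z
    (<-respˡ-≈ (solve 2 (λ z ε → :- (z :* ε) := z :* :- ε) refl z ε) l) , *-cancelˡ-< 0<z u

  suc·-pos : ∀ n {x} → 0# < x → 0# < suc n · x
  suc·-pos zero    0<x = <-respʳ-≈ (sym (+-identityʳ _)) 0<x
  suc·-pos (suc n) 0<x = <-trans 0<x (x<x+y (suc·-pos n 0<x))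

  bounded : ∀ x → ∃ λ K → 0# < K × x within K
  bounded x with archimedean x | archimedean (- x)
  -- The successors make both summands positive, so that the sum exceeds each of the two bounds.
  ... | m , x<m | n , -x<n = suc m · 1# + suc n · 1# , <-trans (pos m) (x<x+y (pos n)) ,
      (<-respʳ-≈ (solve 1 (λ x → :- :- x := x) refl x) (neg-< (<-trans -x<n (<-trans (n<1+n n)
        (<-respʳ-≈ (+-comm (suc n · 1#) _) (x<x+y (pos m)))))))
    , <-trans x<m (<-trans (n<1+n m) (x<x+y (pos n)))
    where
    pos : ∀ n → 0# < suc n · 1#
    pos n = suc·-pos n 0<1
    n<1+n : ∀ n → n · 1# < suc n · 1#
    n<1+n n = <-respʳ-≈ (+-comm _ 1#) (x<x+y 0<1)

module Limits {c ℓ₁ ℓ₂ ℓ₃} (ℝ : RealNumbers c ℓ₁ ℓ₂ ℓ₃) where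
  open RealNumbers ℝ hiding (zero; sum)
  open IntegerCoefficients commutativeRing
  open RingLemmas commutativeRing
  open OrderedField ℝ

  -- `s ConvergesTo l` unfolds to `IsNullSequence (λ n → s n - l)`, so limit laws are proved as
  -- closure properties of null sequences.
  IsNullSequence : (ℕ → Carrier) → Set _
  IsNullSequence s = ∀ ε → 0# < ε → ∃ λ N → ∀ n → N ℕ.≤ n → s n within ε

  null-resp : ∀ {s t} → (∀ n → s n ≈ t n) → IsNullSequence s → IsNullSequence t
  null-resp s≈t s→0 ε 0<ε = let N , small = s→0 ε 0<ε in
    N , λ n N≤n → within-resp (s≈t n) refl (small n N≤n)

  -- Estimates may be proved up to a constant factor K; ε is divided by K once, here.
  null-scaled : ∀ {s K} → 0# < K →
    (∀ δ → 0# < δ → ∃ λ N → ∀ n → N ℕ.≤ n → s n within K * δ) → IsNullSequence s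
  null-scaled 0<K small ε 0<ε = let δ , 0<δ , Kδ≈ε = fraction 0<K 0<ε
                                    N , small-δ = small δ 0<δ in
    N , λ n N≤n → within-resp refl Kδ≈ε (small-δ n N≤n)

  null-+ : ∀ {s t} → IsNullSequence s → IsNullSequence t → IsNullSequence (λ n → s n + t n)
  null-+ s→0 t→0 = null-scaled {K = 1# + 1#} (<-trans 0<1 (x<x+y 0<1)) λ δ 0<δ →
    let M , small = s→0 δ 0<δ ; N , small′ = t→0 δ 0<δ in
    M ℕ.⊔ N , λ n M⊔N≤n → within-resp refl (solve 1 (λ δ → δ :+ δ := con (+ 2) :* δ) refl δ)
      (within-+ (small n (ℕₚ.≤-trans (ℕₚ.m≤m⊔n M N) M⊔N≤n))
                (small′ n (ℕₚ.≤-trans (ℕₚ.m≤n⊔m M N) M⊔N≤n)))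

  null-neg : ∀ {s} → IsNullSequence s → IsNullSequence (λ n → - s n)
  null-neg s→0 ε 0<ε = let N , small = s→0 ε 0<ε in N , λ n N≤n → within-neg (small n N≤n)

  null-*-bounded : ∀ {s t : ℕ → Carrier} {K} → (∀ n → t n within K) →
                   IsNullSequence s → IsNullSequence (λ n → t n * s n)
  null-*-bounded {K = K} bound s→0 = null-scaled (within-pos (bound 0)) λ δ 0<δ →
    let N , small = s→0 δ 0<δ in N , λ n N≤n → within-* (bound n) (small n N≤n)

  null-* : ∀ {s t} → IsNullSequence s → IsNullSequence t → IsNullSequence (λ n → s n * t n)
  null-* s→0 t→0 = null-scaled 0<1 λ δ 0<δ →
    let M , small = s→0 1# 0<1 ; N , small′ = t→0 δ 0<δ in
    M ℕ.⊔ N , λ n M⊔N≤n → within-* (small n (ℕₚ.≤-trans (ℕₚ.m≤m⊔n M N) M⊔N≤n))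
                                   (small′ n (ℕₚ.≤-trans (ℕₚ.m≤n⊔m M N) M⊔N≤n))

  null-subsequence : ∀ {s} (f : ℕ → ℕ) → (∀ n → n ℕ.≤ f n) → IsNullSequence s → IsNullSequence (s ∘ f)
  null-subsequence f n≤fn s→0 ε 0<ε = let N , small = s→0 ε 0<ε in
    N , λ n N≤n → small (f n) (ℕₚ.≤-trans N≤n (n≤fn n))

  null-constant : ∀ {x} → IsNullSequence (λ _ → x) → x ≈ 0#
  null-constant {x} x→0 = ≮⇒≈
    (λ x<0 → let 0<-x = <-respˡ-≈ -0≈0 (neg-< x<0) ; N , small = x→0 (- x) 0<-x in
      <-irrefl (solve 1 (λ x → :- :- x := x) refl x) (proj₁ (small N ℕₚ.≤-refl)))
    (λ 0<x → let N , small = x→0 x 0<x in <-irrefl refl (proj₂ (small N ℕₚ.≤-refl)))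

  limit-unique : ∀ {s l m} → s ConvergesTo l → s ConvergesTo m → l ≈ m
  limit-unique {s} {l} {m} s→l s→m = x-y≈0⇒x≈y l m (null-constant (null-resp
    (λ n → solve 3 (λ s l m → (s :- m) :+ :- (s :- l) := l :- m) refl (s n) l m)
    (null-+ {λ n → s n - m} s→m (null-neg {λ n → s n - l} s→l))))

  limit-resp : ∀ {s t l} → (∀ n → s n ≈ t n) → s ConvergesTo l → t ConvergesTo l
  limit-resp s≈t = null-resp (λ n → +-congʳ (s≈t n))

  limit-shift : ∀ {s t l} → IsNullSequence (λ n → t n - s n) → s ConvergesTo l → t ConvergesTo l
  limit-shift {s} {t} {l} t-s→0 s→l = null-resp
    (λ n → solve 3 (λ s t l → (t :- s) :+ (s :- l) := t :- l) refl (s n) (t n) l)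
    (null-+ {λ n → t n - s n} t-s→0 s→l)

  limit-+ : ∀ {s t l m} → s ConvergesTo l → t ConvergesTo m → (λ n → s n + t n) ConvergesTo (l + m)
  limit-+ {s} {t} {l} {m} s→l t→m = null-resp
    (λ n → solve 4 (λ s t l m → (s :- l) :+ (t :- m) := s :+ t :- (l :+ m)) refl (s n) (t n) l m)
    (null-+ {λ n → s n - l} s→l t→m)

  limit-neg : ∀ {s l} → s ConvergesTo l → (λ n → - s n) ConvergesTo (- l)
  limit-neg {s} {l} s→l = null-resp
    (λ n → solve 2 (λ s l → :- (s :- l) := :- s :- :- l) refl (s n) l) (null-neg {λ n → s n - l} s→l)

  limit-* : ∀ {s t l m} → s ConvergesTo l → t ConvergesTo m → (λ n → s n * t n) ConvergesTo (l * m)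
  limit-* {s} {t} {l} {m} s→l t→m = null-resp
    (λ n → solve 4 (λ s t l m → (s :- l) :* (t :- m) :+ (l :* (t :- m) :+ m :* (s :- l)) :=
      s :* t :- l :* m) refl (s n) (t n) l m)
    (null-+ {λ n → (s n - l) * (t n - m)} (null-* {λ n → s n - l} s→l t→m)
      (null-+ {λ n → l * (t n - m)}
        (null-*-bounded {λ n → t n - m} {λ _ → l} {proj₁ (bounded l)} (λ _ → proj₂ (proj₂ (bounded l))) t→m)
        (null-*-bounded {λ n → s n - l} {λ _ → m} {proj₁ (bounded m)} (λ _ → proj₂ (proj₂ (bounded m))) s→l)))

-- Trigonometric functions from their Taylor series

nCk*k!*[n∸k]!≡n! : ∀ {n k} → k ℕ.≤ n → (n C k) ℕ.* (k ! ℕ.* (n ℕ.∸ k) !) ≡ n !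
nCk*k!*[n∸k]!≡n! {n} {k} k≤n = ≡.trans
  (≡.cong (ℕ._* (k ! ℕ.* (n ℕ.∸ k) !)) (nCk≡n!/k![n-k]! k≤n))
  (m/n*n≡m (k![n∸k]!∣n! k≤n))
  where instance _ = k ℕₚ.!* (n ℕ.∸ k) !≢0

[1+n]²≤4^n : ∀ n → suc n ℕ.* suc n ℕ.≤ 4 ℕ.^ n
[1+n]²≤4^n zero    = ℕₚ.≤-refl
[1+n]²≤4^n (suc n) = begin
  suc (suc n) ℕ.* suc (suc n)         ≤⟨ ℕₚ.*-mono-≤ 2+n≤2[1+n] 2+n≤2[1+n] ⟩
  (2 ℕ.* suc n) ℕ.* (2 ℕ.* suc n)     ≡⟨ identity n ⟩
  4 ℕ.* (suc n ℕ.* suc n)             ≤⟨ ℕₚ.*-monoʳ-≤ 4 ([1+n]²≤4^n n) ⟩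
  4 ℕ.^ suc n                         ∎
  where
  open ℕₚ.≤-Reasoning
  identity : ∀ n → (2 ℕ.* suc n) ℕ.* (2 ℕ.* suc n) ≡ 4 ℕ.* (suc n ℕ.* suc n)
  identity = ℕ-solve-∀
  2+n≤2[1+n] : suc (suc n) ℕ.≤ 2 ℕ.* suc n
  2+n≤2[1+n] = ℕ.s≤s (ℕₚ.≤-trans (ℕₚ.m≤m+n (suc n) 0) (ℕₚ.m≤n+m (suc n ℕ.+ 0) n))

2*-suc : ∀ n → 2 ℕ.* suc n ≡ suc (suc (2 ℕ.* n))
2*-suc = ℕₚ.*-suc 2

even-or-odd : ∀ n → ∃ λ k → n ≡ 2 ℕ.* k ⊎ n ≡ suc (2 ℕ.* k)
even-or-odd zero    = 0 , inj₁ ≡.refl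
even-or-odd (suc n) with even-or-odd n
... | k , inj₁ n≡2k   = k , inj₂ (≡.cong suc n≡2k)
... | k , inj₂ n≡1+2k = suc k , inj₁ (≡.trans (≡.cong suc n≡1+2k) (≡.sym (2*-suc k)))

-- Partial sums and Cauchy products

module PartialSums {c ℓ₁ ℓ₂ ℓ₃} (ℝ : RealNumbers c ℓ₁ ℓ₂ ℓ₃) where
  open RealNumbers ℝ hiding (zero; sum)
  open IntegerCoefficients commutativeRing
  open RingLemmas commutativeRing
  open SumLemmas commutativeRing
  open OrderedField ℝ
  open import Relation.Binary.Reasoning.Setoid setoid

  partialSum-cong : ∀ {f g} → (∀ k → f k ≈ g k) → ∀ N → partialSum f N ≈ partialSum g N
  partialSum-cong f≈g N = sum-cong-≋ {N} (f≈g ∘ toℕ)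

  partialSum-+ : ∀ f g N → partialSum (λ k → f k + g k) N ≈ partialSum f N + partialSum g N
  partialSum-+ f g N = ∑-distrib-+ {N} (f ∘ toℕ) (g ∘ toℕ)

  partialSum-minus : ∀ f g N → partialSum (λ k → f k - g k) N ≈ partialSum f N - partialSum g N
  partialSum-minus f g N = sum-minus {N} (f ∘ toℕ) (g ∘ toℕ)

  partialSum-neg : ∀ f N → partialSum (λ k → - f k) N ≈ - partialSum f N
  partialSum-neg f N = sum-neg {N} (f ∘ toℕ)

  partialSum-* : ∀ x f N → x * partialSum f N ≈ partialSum (λ k → x * f k) N
  partialSum-* x f N = *-distribˡ-sum {N} x (f ∘ toℕ)

  partialSum-last : ∀ f N → partialSum f (suc N) ≈ partialSum f N + f N
  partialSum-last f zero    = +-comm _ _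
  partialSum-last f (suc N) = trans (+-congˡ (partialSum-last (f ∘ suc) N)) (sym (+-assoc _ _ _))

  partialSum-pairs : ∀ f N → partialSum f (2 ℕ.* N) ≈
    partialSum (λ k → f (2 ℕ.* k) + f (suc (2 ℕ.* k))) N
  partialSum-pairs f zero    = refl
  partialSum-pairs f (suc N) = begin
    partialSum f (2 ℕ.* suc N)       ≡⟨ ≡.cong (partialSum f) (2*-suc N) ⟩
    f 0 + (f 1 + partialSum (λ k → f (suc (suc k))) (2 ℕ.* N)) ≈⟨ +-assoc _ _ _ ⟨
    f 0 + f 1 + partialSum (λ k → f (suc (suc k))) (2 ℕ.* N)
      ≈⟨ +-congˡ (partialSum-pairs (λ k → f (suc (suc k))) N) ⟩
    f 0 + f 1 + partialSum (λ k → f (suc (suc (2 ℕ.* k))) + f (suc (suc (suc (2 ℕ.* k))))) N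
      ≈⟨ +-congˡ (partialSum-cong (λ k → reflexive
           (≡.cong (λ m → f m + f (suc m)) (≡.sym (2*-suc k)))) N) ⟩
    partialSum (λ k → f (2 ℕ.* k) + f (suc (2 ℕ.* k))) (suc N) ∎

  -- There are N terms, but the factor is `suc N`: the bound is strict and has to hold for the empty
  -- sum as well.
  partialSum-within : ∀ {f B} → 0# < B → (∀ k → f k within B) → ∀ N → partialSum f N within suc N · B
  partialSum-within 0<B bound zero    =
    within-resp refl (sym (+-identityʳ _)) (within-zero 0<B)
  partialSum-within 0<B bound (suc N) = within-+ (bound 0) (partialSum-within 0<B (bound ∘ suc) N)

  partialSum-tail-within : ∀ {f B} → 0# < B → ∀ {m N} → m ℕ.≤ N → (∀ k → m ℕ.≤ k → f k within B) →
                           partialSum f N - partialSum f m within suc N · B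
  partialSum-tail-within 0<B {zero} {N} m≤N bound = within-resp
    (solve 1 (λ x → x := x :- con (+ 0)) refl _) refl
    (partialSum-within 0<B (λ k → bound k ℕ.z≤n) N)
  partialSum-tail-within {f} 0<B {suc m} {suc N} (ℕ.s≤s m≤N) bound = within-resp
    (solve 3 (λ a x y → x :- y := a :+ x :- (a :+ y)) refl (f 0) _ _) refl
    (within-weaken (<-respʳ-≈ (+-comm _ _) (x<x+y 0<B))
      (partialSum-tail-within 0<B m≤N (λ k m≤k → bound (suc k) (ℕ.s≤s m≤k))))

  convolution : (ℕ → ℕ → Carrier) → ℕ → Carrier
  convolution g n = partialSum (λ j → g j (n ℕ.∸ j)) (suc n)

  -- The sums over j + k < N and over j, k < N. A general g of two indices admits a weight that
  -- depends on j + k.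
  triangle square : (ℕ → ℕ → Carrier) → ℕ → Carrier
  triangle g N = partialSum (λ j → partialSum (g j) (N ℕ.∸ j)) N
  square   g N = partialSum (λ j → partialSum (g j) N) N

  -- Summation by antidiagonals. Splitting off row j = 0 leaves the triangle of `g ∘ suc`, and takes
  -- the first term off each convolution.
  triangle-convolution : ∀ g N → triangle g N ≈ partialSum (convolution g) N
  triangle-convolution g zero    = refl
  triangle-convolution g (suc N) = begin
    g 0 0 + partialSum (g 0 ∘ suc) N + triangle (g ∘ suc) N
      ≈⟨ +-congˡ (triangle-convolution (g ∘ suc) N) ⟩
    g 0 0 + partialSum (g 0 ∘ suc) N + partialSum (convolution (g ∘ suc)) N
      ≈⟨ solve 3 (λ x y z → x :+ y :+ z := x :+ con (+ 0) :+ (y :+ z)) refl _ _ _ ⟩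
    g 0 0 + 0# + (partialSum (g 0 ∘ suc) N + partialSum (convolution (g ∘ suc)) N)
      ≈⟨ +-congˡ (partialSum-+ (g 0 ∘ suc) (convolution (g ∘ suc)) N) ⟨
    partialSum (convolution g) (suc N) ∎

  square-triangle-within : ∀ {g B} → 0# < B → ∀ N → (∀ j k → N ℕ.≤ j ℕ.+ k → g j k within B) →
                           square g N - triangle g N within suc N · (suc N · B)
  square-triangle-within {g} {B} 0<B N bound = within-resp
    (partialSum-minus (λ j → partialSum (g j) N) (λ j → partialSum (g j) (N ℕ.∸ j)) N) refl
    (partialSum-within (suc·-pos N 0<B) (λ j → partialSum-tail-within 0<B (ℕₚ.m∸n≤m N j)
      λ k N∸j≤k → bound j k (ℕₚ.≤-trans (ℕₚ.m≤n+m∸n N j) (ℕₚ.+-monoʳ-≤ j N∸j≤k))) N)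

  square-* : ∀ f g N → square (λ j k → f j * g k) N ≈ partialSum f N * partialSum g N
  square-* f g N = begin
    square (λ j k → f j * g k) N
      ≈⟨ partialSum-cong (λ j → trans (sym (partialSum-* (f j) g N)) (*-comm _ _)) N ⟩
    partialSum (λ j → partialSum g N * f j) N ≈⟨ partialSum-* (partialSum g N) f N ⟨
    partialSum g N * partialSum f N ≈⟨ *-comm _ _ ⟩
    partialSum f N * partialSum g N ∎

  square-minus : ∀ g h N → square (λ j k → g j k - h j k) N ≈ square g N - square h N
  square-minus g h N = trans (partialSum-cong (λ j → partialSum-minus (g j) (h j) N) N)
    (partialSum-minus (λ j → partialSum (g j) N) (λ j → partialSum (h j) N) N)

  square-+ : ∀ g h N → square (λ j k → g j k + h j k) N ≈ square g N + square h N
  square-+ g h N = trans (partialSum-cong (λ j → partialSum-+ (g j) (h j) N) N)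
    (partialSum-+ (λ j → partialSum (g j) N) (λ j → partialSum (h j) N) N)

  square-cong : ∀ {g h} → (∀ j k → g j k ≈ h j k) → ∀ N → square g N ≈ square h N
  square-cong g≈h N = partialSum-cong (λ j → partialSum-cong (g≈h j) N) N

  -- The other summands are positive. It serves to bound a single product (Mʲ/j!)(Mᵏ/k!) through the
  -- whole convolution (2M)ⁿ/n!.
  summand-< : ∀ {n} (f : Vector Carrier n) → (∀ i → 0# < f i) → ∀ {y} → sum f < y → ∀ i → f i < y
  summand-< f f-pos Σ<y zero    = drop (f ∘ suc) (f-pos ∘ suc) Σ<y
    where
    drop : ∀ {n x y} (f : Vector Carrier n) → (∀ i → 0# < f i) → x + sum f < y → x < y
    drop {zero}  f f-pos x+0<y = <-respˡ-≈ (+-identityʳ _) x+0<y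
    drop {suc n} f f-pos x+Σ<y = <-trans (x<x+y (f-pos zero))
      (drop (f ∘ suc) (f-pos ∘ suc) (<-respˡ-≈ (sym (+-assoc _ _ _)) x+Σ<y))
  summand-< {suc n} f f-pos Σ<y (suc i) = summand-< (f ∘ suc) (f-pos ∘ suc)
    (<-trans (<-respʳ-≈ (+-comm _ _) (x<x+y (f-pos zero))) Σ<y) i

  drop-· : ∀ n {x y z} → 0# < z → x + n · z < y → x < y
  drop-· zero    0<z x+0<y = <-respˡ-≈ (+-identityʳ _) x+0<y
  drop-· (suc n) 0<z x+nz<y = <-trans (x<x+y 0<z)
    (drop-· n 0<z (<-respˡ-≈ (sym (+-assoc _ _ _)) x+nz<y))

module Taylor {c ℓ₁ ℓ₂ ℓ₃} (ℝ : RealNumbers c ℓ₁ ℓ₂ ℓ₃) where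
  open RealNumbers ℝ hiding (zero; sum)
  open CommutativeRing commutativeRing using (commutativeSemiring)
  open IntegerCoefficients commutativeRing
  open RingLemmas commutativeRing
  open SumLemmas commutativeRing
  open OrderedField ℝ
  open PartialSums ℝ
  open Mult semiring using (×-assoc-*; ×1-homo-*; ×-congʳ)
  open import Relation.Binary.Reasoning.Setoid setoid

  taylor : Carrier → ℕ → Carrier
  taylor x n = x ^ n * 1/[ n !]

  n!*1/n!≈1 : ∀ n → (n !) · 1# * 1/[ n !] ≈ 1#
  n!*1/n!≈1 n = x*1/x≈1 _

  0<1/n! : ∀ n → 0# < 1/[ n !]
  0<1/n! n = 1/-pos _

  ·≈* : ∀ n x → n · x ≈ n · 1# * x
  ·≈* n x = sym (trans (×-assoc-* n 1# x) (×-congʳ n (*-identityˡ x)))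

  binomial-factorial : ∀ {n k} → k ℕ.≤ n → (n C k) · 1# * 1/[ n !] ≈ 1/[ k !] * 1/[ n ℕ.∸ k !]
  binomial-factorial {n} {k} k≤n = modulo
    (solve 7 (λ C a b N ia ib iN → C :* iN := ia :* ib :+
      ((:- (C :* iN :* b :* ib)) :* (a :* ia :- con (+ 1))
      :+ ((:- (C :* iN)) :* (b :* ib :- con (+ 1))
      :+ ((iN :* ia :* ib) :* (C :* (a :* b) :- N)
      :+ (ia :* ib) :* (N :* iN :- con (+ 1)))))) refl
      ((n C k) · 1#) ((k !) · 1#) (((n ℕ.∸ k) !) · 1#) ((n !) · 1#) 1/[ k !] 1/[ n ℕ.∸ k !] 1/[ n !])
    (x≈y⇒x-y≈0 (n!*1/n!≈1 k) *0 +0 (x≈y⇒x-y≈0 (n!*1/n!≈1 (n ℕ.∸ k)) *0 +0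
      (x≈y⇒x-y≈0 factorials *0 +0 x≈y⇒x-y≈0 (n!*1/n!≈1 n) *0)))
    where
    factorials : (n C k) · 1# * ((k !) · 1# * ((n ℕ.∸ k) !) · 1#) ≈ (n !) · 1#
    factorials = begin
      (n C k) · 1# * ((k !) · 1# * ((n ℕ.∸ k) !) · 1#)  ≈⟨ *-congˡ (×1-homo-* (k !) ((n ℕ.∸ k) !)) ⟨
      (n C k) · 1# * (k ! ℕ.* (n ℕ.∸ k) !) · 1#         ≈⟨ ×1-homo-* (n C k) _ ⟨
      ((n C k) ℕ.* (k ! ℕ.* (n ℕ.∸ k) !)) · 1#            ≡⟨ ≡.cong (_· 1#) (nCk*k!*[n∸k]!≡n! k≤n) ⟩
      (n !) · 1#                                        ∎

  -- The binomial theorem divided by n!.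
  taylor-convolution : ∀ x y n → convolution (λ j k → taylor x j * taylor y k) n ≈ taylor (x + y) n
  taylor-convolution x y n = sym (begin
    (x + y) ^ n * 1/[ n !]
      ≈⟨ *-congʳ (Binomial.theorem commutativeSemiring n x y) ⟩
    sum (term) * 1/[ n !]              ≈⟨ *-comm _ _ ⟩
    1/[ n !] * sum term                ≈⟨ *-distribˡ-sum 1/[ n !] term ⟩
    sum (λ k → 1/[ n !] * term k)      ≈⟨ sum-cong-≋ (λ k → let j = toℕ k in begin
      1/[ n !] * (n C j) · (x ^ j * y ^ (n ℕ.∸ j))
        ≈⟨ *-congˡ (·≈* (n C j) _) ⟩
      1/[ n !] * ((n C j) · 1# * (x ^ j * y ^ (n ℕ.∸ j)))
        ≈⟨ solve 3 (λ i c z → i :* (c :* z) := z :* (c :* i)) refl _ _ _ ⟩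
      x ^ j * y ^ (n ℕ.∸ j) * ((n C j) · 1# * 1/[ n !])
        ≈⟨ *-congˡ (binomial-factorial (ℕ.s≤s⁻¹ (Finₚ.toℕ<n k))) ⟩
      x ^ j * y ^ (n ℕ.∸ j) * (1/[ j !] * 1/[ n ℕ.∸ j !])
        ≈⟨ solve 4 (λ x y i i′ → x :* y :* (i :* i′) := x :* i :* (y :* i′)) refl _ _ _ _ ⟩
      taylor x j * taylor y (n ℕ.∸ j) ∎) ⟩
    convolution (λ j k → taylor x j * taylor y k) n ∎)
    where
    term : Vector Carrier (suc n)
    term = Binomial.binomialTerm commutativeSemiring x y n

  weighted-convolution : ∀ (w : ℕ → Carrier) x y n →
    convolution (λ j k → w (j ℕ.+ k) * (taylor x j * taylor y k)) n ≈ w n * taylor (x + y) n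
  weighted-convolution w x y n = begin
    convolution (λ j k → w (j ℕ.+ k) * (taylor x j * taylor y k)) n
      ≈⟨ sum-cong-≋ {suc n} (λ k → *-congʳ {taylor x (toℕ k) * taylor y (n ℕ.∸ toℕ k)}
           (reflexive (≡.cong w (ℕₚ.m+[n∸m]≡n (ℕ.s≤s⁻¹ (Finₚ.toℕ<n k)))))) ⟩
    partialSum (λ j → w n * (taylor x j * taylor y (n ℕ.∸ j))) (suc n)
      ≈⟨ partialSum-* (w n) (λ j → taylor x j * taylor y (n ℕ.∸ j)) (suc n) ⟨
    w n * convolution (λ j k → taylor x j * taylor y k) n ≈⟨ *-congˡ (taylor-convolution x y n) ⟩
    w n * taylor (x + y) n ∎

-- Addition formulas for cosine and sine

module AdditionFormulas {c ℓ₁ ℓ₂ ℓ₃} {ℝ : RealNumbers c ℓ₁ ℓ₂ ℓ₃} (trig : Trigonometry ℝ) where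
  open RealNumbers ℝ hiding (zero; sum; product)
  open Trigonometry trig
  open CommutativeRing commutativeRing using (commutativeSemiring)
  open IntegerCoefficients commutativeRing
  open RingLemmas commutativeRing
  open SumLemmas commutativeRing
  open OrderedField ℝ
  open Limits ℝ
  open PartialSums ℝ
  open Taylor ℝ
  open Exp commutativeSemiring using (^-distrib-*)
  open Mult semiring using (×1-homo-*; ×-homo-+; ×-assocˡ)
  open import Relation.Binary.Reasoning.Setoid setoid

  2# : Carrier
  2# = 1# + 1#

  1<2 : 1# < 2#
  1<2 = x<x+y 0<1

  0<2 : 0# < 2#
  0<2 = <-trans 0<1 1<2

  -- Bounds are strict, so quantities of modulus at most 1, such as signs and powers of i, are
  -- bounded by 2. This is also the source of the factor 2 in `^-within`.
  1-within-2 : 1# within 2#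
  1-within-2 = <-trans (<-respʳ-≈ -0≈0 (neg-< 0<2)) 0<1 , 1<2

  sign : ℕ → Carrier
  sign k = (- 1#) ^ k

  sign² : ∀ k → sign k * sign k ≈ 1#
  sign² zero    = *-identityʳ 1#
  sign² (suc k) = trans
    (solve 1 (λ s → (con -[1+ 0 ] :* s) :* (con -[1+ 0 ] :* s) := s :* s) refl (sign k)) (sign² k)

  sign-within : ∀ k → sign k within 2#
  sign-within zero    = 1-within-2
  sign-within (suc k) = within-resp
    (solve 1 (λ s → :- s := con -[1+ 0 ] :* s) refl (sign k)) refl (within-neg (sign-within k))

  series-terms-null : ∀ f {l} → partialSum f ConvergesTo l → IsNullSequence f
  series-terms-null f {l} f→l = null-resp
    (λ n → trans (+-congʳ (+-congʳ (partialSum-last f n)))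
      (solve 3 (λ s x l → (s :+ x :- l) :- (s :- l) := x) refl (partialSum f n) (f n) l))
    (null-+ {λ n → partialSum f (suc n) - l}
      (null-subsequence {λ n → partialSum f n - l} suc ℕₚ.n≤1+n f→l)
      (null-neg {λ n → partialSum f n - l} f→l))

  unsigned-null : ∀ f → IsNullSequence (λ k → sign k * f k) → IsNullSequence f
  unsigned-null f sf→0 = null-resp
    (λ k → trans (sym (*-assoc _ _ _)) (trans (*-congʳ (sign² k)) (*-identityˡ _)))
    (null-*-bounded {λ k → sign k * f k} {sign} sign-within sf→0)

  cosTerm sinTerm : Carrier → ℕ → Carrier
  cosTerm x k = sign k * x ^ (2 ℕ.* k) * 1/[ 2 ℕ.* k !]
  sinTerm x k = sign k * x ^ suc (2 ℕ.* k) * 1/[ suc (2 ℕ.* k) !]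

  cosTerm≈ : ∀ x k → cosTerm x k ≈ sign k * taylor x (2 ℕ.* k)
  cosTerm≈ x k = *-assoc (sign k) (x ^ (2 ℕ.* k)) 1/[ 2 ℕ.* k !]

  sinTerm≈ : ∀ x k → sinTerm x k ≈ sign k * taylor x (suc (2 ℕ.* k))
  sinTerm≈ x k = *-assoc (sign k) (x ^ suc (2 ℕ.* k)) 1/[ suc (2 ℕ.* k) !]

  even-taylor-null : ∀ x → IsNullSequence (λ k → taylor x (2 ℕ.* k))
  even-taylor-null x = unsigned-null (λ k → taylor x (2 ℕ.* k))
    (null-resp {cosTerm x} (cosTerm≈ x) (series-terms-null (cosTerm x) (cos-series x)))

  odd-taylor-null : ∀ x → IsNullSequence (λ k → taylor x (suc (2 ℕ.* k)))
  odd-taylor-null x = unsigned-null (λ k → taylor x (suc (2 ℕ.* k)))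
    (null-resp {sinTerm x} (sinTerm≈ x) (series-terms-null (sinTerm x) (sin-series x)))

  interleave-within : ∀ (s : ℕ → Carrier) {ε} N →
                      (∀ k → N ℕ.≤ k → s (2 ℕ.* k) within ε × s (suc (2 ℕ.* k)) within ε) →
                      ∀ n → suc (2 ℕ.* N) ℕ.≤ n → s n within ε
  interleave-within s N small n N≤n with even-or-odd n
  ... | k , inj₁ ≡.refl =
    proj₁ (small k (ℕₚ.*-cancelˡ-≤ {N} {k} 2 (ℕₚ.≤-trans (ℕₚ.n≤1+n (2 ℕ.* N)) N≤n)))
  ... | k , inj₂ ≡.refl = proj₂ (small k (ℕₚ.*-cancelˡ-≤ {N} {k} 2 (ℕ.s≤s⁻¹ N≤n)))

  -- The terms of a convergent series tend to 0: the cosine series covers even n and the sine series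
  -- odd n, and the signs are undone by multiplying with them again.
  taylor-null : ∀ x → IsNullSequence (taylor x)
  taylor-null x ε 0<ε = let M , even = even-taylor-null x ε 0<ε
                            N , odd = odd-taylor-null x ε 0<ε in
    suc (2 ℕ.* (M ℕ.⊔ N)) , interleave-within (taylor x) (M ℕ.⊔ N) λ k M⊔N≤k →
      even k (ℕₚ.≤-trans (ℕₚ.m≤m⊔n M N) M⊔N≤k) , odd k (ℕₚ.≤-trans (ℕₚ.m≤n⊔m M N) M⊔N≤k)

  ^-pos : ∀ {x} → 0# < x → ∀ n → 0# < x ^ n
  ^-pos 0<x zero    = 0<1
  ^-pos 0<x (suc n) = *-pos 0<x (^-pos 0<x n)

  taylor-pos : ∀ {x} → 0# < x → ∀ n → 0# < taylor x n
  taylor-pos 0<x n = *-pos (^-pos 0<x n) (0<1/n! n)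

  ^-within : ∀ {x M} → x within M → ∀ n → x ^ n within 2# * M ^ n
  ^-within xM zero    = within-resp refl (sym (*-identityʳ 2#)) 1-within-2
  ^-within {x} {M} xM (suc n) = within-resp refl
    (solve 2 (λ m y → m :* (con (+ 2) :* y) := con (+ 2) :* (m :* y)) refl M (M ^ n))
    (within-* xM (^-within xM n))

  taylor-within : ∀ {x M} → x within M → ∀ n → taylor x n within 2# * taylor M n
  taylor-within {x} {M} xM n = within-resp (*-comm _ _)
    (solve 2 (λ i y → i :* (con (+ 2) :* y) := con (+ 2) :* (y :* i)) refl 1/[ n !] (M ^ n))
    (within-scale (0<1/n! n) (^-within xM n))

  [n·1]^k : ∀ n k → (n · 1#) ^ k ≈ (n ℕ.^ k) · 1#
  [n·1]^k n zero    = sym (+-identityʳ 1#)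
  [n·1]^k n (suc k) = trans (*-congˡ ([n·1]^k n k)) (sym (×1-homo-* n (n ℕ.^ k)))

  taylor-scale : ∀ m x n → taylor (m · 1# * x) n ≈ (m ℕ.^ n) · taylor x n
  taylor-scale m x n = begin
    (m · 1# * x) ^ n * 1/[ n !]           ≈⟨ *-congʳ (^-distrib-* (m · 1#) x n) ⟩
    (m · 1#) ^ n * x ^ n * 1/[ n !]       ≈⟨ *-congʳ (*-congʳ ([n·1]^k m n)) ⟩
    (m ℕ.^ n) · 1# * x ^ n * 1/[ n !]     ≈⟨ *-assoc _ _ _ ⟩
    (m ℕ.^ n) · 1# * taylor x n           ≈⟨ ·≈* (m ℕ.^ n) (taylor x n) ⟨
    (m ℕ.^ n) · taylor x n                ∎

  -- The square and the triangle differ by fewer than (1 + N)² terms, each bounded by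
  -- 8 (2M)ⁿ / n! for some n ≥ N; and (1 + N)² ≤ 4ⁿ while 4ⁿ (2M)ⁿ / n! tends to 0.
  defect-null : ∀ (w : ℕ → Carrier) → (∀ n → w n within 2#) → ∀ x y →
    let g j k = w (j ℕ.+ k) * (taylor x j * taylor y k) in
    IsNullSequence (λ N → square g N - triangle g N)
  -- 8 = 2 · 2 · 2, with one factor from the bound on w and one from each of the two
  -- `taylor-within`.
  defect-null w w-within x y = null-scaled {K = 8 · 1#} (suc·-pos 7 0<1) λ δ 0<δ → let
      N₀ , small = taylor-null (4 · 1# * (M + M)) δ 0<δ in
    N₀ , λ N N₀≤N → estimate δ 0<δ N (λ n N≤n → proj₂ (small n (ℕₚ.≤-trans N₀≤N N≤n)))
    where
    g : ℕ → ℕ → Carrier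
    g j k = w (j ℕ.+ k) * (taylor x j * taylor y k)
    M₀ M₁ M : Carrier
    M₀ = proj₁ (bounded x)
    M₁ = proj₁ (bounded y)
    M = M₀ + M₁
    0<M₀ = proj₁ (proj₂ (bounded x))
    0<M₁ = proj₁ (proj₂ (bounded y))
    0<M : 0# < M
    0<M = <-trans 0<M₀ (x<x+y 0<M₁)
    x-within : x within M
    x-within = within-weaken (x<x+y 0<M₁) (proj₂ (proj₂ (bounded x)))
    y-within : y within M
    y-within = within-weaken (<-respʳ-≈ (+-comm _ _) (x<x+y 0<M₀)) (proj₂ (proj₂ (bounded y)))

    product : ℕ → ℕ → Carrier
    product j k = taylor M j * taylor M k

    g-within : ∀ j k → g j k within 8 · 1# * product j k
    g-within j k = within-resp refl
      (solve 2 (λ s t → con (+ 2) :* (con (+ 2) :* s :* (con (+ 2) :* t)) :=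
        (con (+ 1) :+ (con (+ 1) :+ (con (+ 1) :+ (con (+ 1) :+ (con (+ 1) :+ (con (+ 1) :+
        (con (+ 1) :+ (con (+ 1) :+ con (+ 0)))))))) ) :* (s :* t)) refl (taylor M j) (taylor M k))
      (within-* (w-within (j ℕ.+ k)) (within-* (taylor-within x-within j) (taylor-within y-within k)))

    module _ (δ : Carrier) (0<δ : 0# < δ) (N : ℕ)
             (small : ∀ n → N ℕ.≤ n → taylor (4 · 1# * (M + M)) n < δ) where

      p : Carrier
      p = (suc N ℕ.* suc N) · 1#
      0<p : 0# < p
      0<p = suc·-pos (N ℕ.+ N ℕ.* suc N) 0<1

      -- Scaling the argument by 4 multiplies the term by 4ⁿ; of these 4ⁿ positive copies only (1 +
      -- N)² are kept.
      small-sum : ∀ n → N ℕ.≤ n → p * taylor (M + M) n < δ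
      small-sum n N≤n = drop-· (4 ℕ.^ n ℕ.∸ suc N ℕ.* suc N) (taylor-pos (<-trans 0<M (x<x+y 0<M)) n)
        (<-respˡ-≈ (begin
          taylor (4 · 1# * (M + M)) n      ≈⟨ taylor-scale 4 (M + M) n ⟩
          (4 ℕ.^ n) · taylor (M + M) n     ≡⟨ ≡.cong (_· taylor (M + M) n) (ℕₚ.m+[n∸m]≡n [1+N]²≤4^n) ⟨
          (suc N ℕ.* suc N ℕ.+ (4 ℕ.^ n ℕ.∸ suc N ℕ.* suc N)) · taylor (M + M) n
            ≈⟨ ×-homo-+ (taylor (M + M) n) (suc N ℕ.* suc N) _ ⟩
          (suc N ℕ.* suc N) · taylor (M + M) n + (4 ℕ.^ n ℕ.∸ suc N ℕ.* suc N) · taylor (M + M) n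
            ≈⟨ +-congʳ (·≈* (suc N ℕ.* suc N) (taylor (M + M) n)) ⟩
          p * taylor (M + M) n + (4 ℕ.^ n ℕ.∸ suc N ℕ.* suc N) · taylor (M + M) n ∎)
          (small n N≤n))
        where
        [1+N]²≤4^n : suc N ℕ.* suc N ℕ.≤ 4 ℕ.^ n
        [1+N]²≤4^n = ℕₚ.≤-trans (ℕₚ.*-mono-≤ (ℕ.s≤s N≤n) (ℕ.s≤s N≤n)) ([1+n]²≤4^n n)

      small-product : ∀ j k → N ℕ.≤ j ℕ.+ k → p * product j k < δ
      small-product j k N≤j+k = <-respˡ-≈ (reflexive (≡.cong₂ (λ j k → p * product j k)
          (Finₚ.toℕ-fromℕ< j<1+j+k)
          (≡.trans (≡.cong (j ℕ.+ k ℕ.∸_) (Finₚ.toℕ-fromℕ< j<1+j+k)) (ℕₚ.m+n∸m≡n j k))))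
        (summand-< (λ i → p * product (toℕ i) (j ℕ.+ k ℕ.∸ toℕ i))
          (λ i → *-pos 0<p (*-pos (taylor-pos 0<M (toℕ i)) (taylor-pos 0<M (j ℕ.+ k ℕ.∸ toℕ i))))
          (<-respˡ-≈ (trans (*-congˡ (sym (taylor-convolution M M (j ℕ.+ k))))
            (partialSum-* p (λ i → product i (j ℕ.+ k ℕ.∸ i)) (suc (j ℕ.+ k))))
            (small-sum (j ℕ.+ k) N≤j+k))
          (fromℕ< j<1+j+k))
        where
        j<1+j+k : j ℕ.< suc (j ℕ.+ k)
        j<1+j+k = ℕ.s≤s (ℕₚ.m≤m+n j k)

      8δ : Carrier
      8δ = 8 · 1# * δ

      -- B is the bound for a single term: (1 + N)² of them add up to 8δ.
      share : ∃ λ B → 0# < B × p * B ≈ 8δ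
      share = fraction 0<p (*-pos (suc·-pos 7 0<1) 0<δ)
      B = proj₁ share

      estimate : square g N - triangle g N within 8δ
      estimate = within-resp refl
        (trans (×-assocˡ B (suc N) (suc N)) (trans (·≈* (suc N ℕ.* suc N) B) (proj₂ (proj₂ share))))
        (square-triangle-within (proj₁ (proj₂ share)) N λ j k N≤j+k →
          within-unscale 0<p (within-weaken
            (<-resp (solve 3 (λ e p q → e :* (p :* q) := p :* (e :* q)) refl (8 · 1#) p (product j k))
              (sym (proj₂ (proj₂ share)))
              (*-monoˡ-< (suc·-pos 7 0<1) (small-product j k N≤j+k)))
            (within-scale 0<p (g-within j k))))

  -- The real and imaginary parts of iⁿ.
  re im : ℕ → Carrier
  re zero    = 1#
  re (suc n) = - im n
  im zero    = 0#
  im (suc n) = re n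

  re-im-within : ∀ n → re n within 2# × im n within 2#
  re-im-within zero    = 1-within-2 , within-zero 0<2
  re-im-within (suc n) = within-neg (proj₂ (re-im-within n)) , proj₁ (re-im-within n)

  re-im-+ : ∀ m n → re (m ℕ.+ n) ≈ re m * re n - im m * im n × im (m ℕ.+ n) ≈ im m * re n + re m * im n
  re-im-+ zero    n = solve 2 (λ r i → r := con (+ 1) :* r :- con (+ 0) :* i) refl (re n) (im n)
                    , solve 2 (λ r i → i := con (+ 0) :* r :+ con (+ 1) :* i) refl (re n) (im n)
  re-im-+ (suc m) n with re-im-+ m n
  ... | re-+ , im-+ =
      trans (-‿cong im-+) (solve 4 (λ r i r′ i′ → :- (i :* r′ :+ r :* i′) := :- i :* r′ :- r :* i′) refl
        (re m) (im m) (re n) (im n))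
    , trans re-+ (solve 4 (λ r i r′ i′ → r :* r′ :- i :* i′ := r :* r′ :+ (:- i) :* i′) refl
        (re m) (im m) (re n) (im n))

  re-im-2* : ∀ k → re (2 ℕ.* k) ≈ sign k × im (2 ℕ.* k) ≈ 0#
  re-im-2* zero    = refl , refl
  re-im-2* (suc k) with re-im-2* k
  ... | re-2k , im-2k =
      trans (reflexive (≡.cong re (2*-suc k)))
        (trans (-‿cong re-2k) (solve 1 (λ s → :- s := con -[1+ 0 ] :* s) refl (sign k)))
    , trans (reflexive (≡.cong im (2*-suc k))) (trans (-‿cong im-2k) -0≈0)

  -- Real and imaginary parts of the series of exp(ix). With zeros in the alternate places both
  -- series run over the same n, as the Cauchy products require.
  reTerm imTerm reSum imSum : Carrier → ℕ → Carrier
  reTerm x n = re n * taylor x n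
  imTerm x n = im n * taylor x n
  reSum x = partialSum (reTerm x)
  imSum x = partialSum (imTerm x)

  reSum→cos : ∀ x → (λ N → reSum x (2 ℕ.* N)) ConvergesTo cos x
  reSum→cos x = limit-resp {partialSum (cosTerm x)} (λ N → sym (trans
    (partialSum-pairs (reTerm x) N)
    (partialSum-cong (λ k → trans
      (+-cong (*-congʳ (proj₁ (re-im-2* k))) (*-congʳ (-‿cong (proj₂ (re-im-2* k)))))
      (solve 4 (λ s p i t → s :* (p :* i) :+ (:- con (+ 0)) :* t := s :* p :* i) refl
        (sign k) (x ^ (2 ℕ.* k)) 1/[ 2 ℕ.* k !] (taylor x (suc (2 ℕ.* k))))) N)))
    (cos-series x)

  imSum→sin : ∀ x → (λ N → imSum x (2 ℕ.* N)) ConvergesTo sin x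
  imSum→sin x = limit-resp {partialSum (sinTerm x)} (λ N → sym (trans
    (partialSum-pairs (imTerm x) N)
    (partialSum-cong (λ k → trans
      (+-cong (*-congʳ (proj₂ (re-im-2* k))) (*-congʳ (proj₁ (re-im-2* k))))
      (solve 4 (λ s p i t → con (+ 0) :* t :+ s :* (p :* i) := s :* p :* i) refl
        (sign k) (x ^ suc (2 ℕ.* k)) 1/[ suc (2 ℕ.* k) !] (taylor x (2 ℕ.* k)))) N)))
    (sin-series x)

  -- The weight w (j + k) is constant on antidiagonals, so the triangle is the weighted partial sum
  -- at x + y, and it differs from the square by a null sequence.
  addition : ∀ (w : ℕ → Carrier) → (∀ n → w n within 2#) → ∀ x y {l} →
    (λ N → square (λ j k → w (j ℕ.+ k) * (taylor x j * taylor y k)) (2 ℕ.* N)) ConvergesTo l →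
    (λ N → partialSum (λ n → w n * taylor (x + y) n) (2 ℕ.* N)) ConvergesTo l
  addition w w-within x y square→l = limit-shift
    {λ N → square g (2 ℕ.* N)}
    (null-resp (λ N → trans
      (solve 2 (λ s t → :- (s :- t) := t :- s) refl (square g (2 ℕ.* N)) (triangle g (2 ℕ.* N)))
      (+-congʳ (trans (triangle-convolution g (2 ℕ.* N))
        (partialSum-cong (weighted-convolution w x y) (2 ℕ.* N)))))
      (null-neg {λ N → square g (2 ℕ.* N) - triangle g (2 ℕ.* N)}
        (null-subsequence {λ N → square g N - triangle g N} (2 ℕ.*_) (λ n → ℕₚ.m≤n*m n 2)
          (defect-null w w-within x y))))
    square→l
    where
    g : ℕ → ℕ → Carrier
    g j k = w (j ℕ.+ k) * (taylor x j * taylor y k)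

  -- The real part of exp(ix) exp(iy): expanding re (j + k) splits the square into two products of
  -- partial sums.
  cos-+ : ∀ x y → cos (x + y) ≈ cos x * cos y - sin x * sin y
  cos-+ x y = limit-unique (reSum→cos (x + y)) (addition re (proj₁ ∘ re-im-within) x y
    (limit-resp (λ N → sym (squares (2 ℕ.* N)))
      (limit-+ (limit-* (reSum→cos x) (reSum→cos y))
               (limit-neg (limit-* (imSum→sin x) (imSum→sin y))))))
    where
    squares : ∀ N → square (λ j k → re (j ℕ.+ k) * (taylor x j * taylor y k)) N ≈
                    reSum x N * reSum y N - imSum x N * imSum y N
    squares N = trans (square-cong {h = λ j k → reTerm x j * reTerm y k - imTerm x j * imTerm y k}
      (λ j k → trans (*-congʳ (proj₁ (re-im-+ j k)))
      (solve 6 (λ r i r′ i′ s t → (r :* r′ :- i :* i′) :* (s :* t) := r :* s :* (r′ :* t) :- i :* s :* (i′ :* t))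
        refl (re j) (im j) (re k) (im k) (taylor x j) (taylor y k))) N)
      (trans (square-minus (λ j k → reTerm x j * reTerm y k) (λ j k → imTerm x j * imTerm y k) N)
        (+-cong (square-* (reTerm x) (reTerm y) N) (-‿cong (square-* (imTerm x) (imTerm y) N))))

  sin-+ : ∀ x y → sin (x + y) ≈ sin x * cos y + cos x * sin y
  sin-+ x y = limit-unique (imSum→sin (x + y)) (addition im (proj₂ ∘ re-im-within) x y
    (limit-resp (λ N → sym (squares (2 ℕ.* N)))
      (limit-+ (limit-* (imSum→sin x) (reSum→cos y))
               (limit-* (reSum→cos x) (imSum→sin y)))))
    where
    squares : ∀ N → square (λ j k → im (j ℕ.+ k) * (taylor x j * taylor y k)) N ≈
                    imSum x N * reSum y N + reSum x N * imSum y N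
    squares N = trans (square-cong {h = λ j k → imTerm x j * reTerm y k + reTerm x j * imTerm y k}
      (λ j k → trans (*-congʳ (proj₂ (re-im-+ j k)))
      (solve 6 (λ r i r′ i′ s t → (i :* r′ :+ r :* i′) :* (s :* t) := i :* s :* (r′ :* t) :+ r :* s :* (i′ :* t))
        refl (re j) (im j) (re k) (im k) (taylor x j) (taylor y k))) N)
      (trans (square-+ (λ j k → imTerm x j * reTerm y k) (λ j k → reTerm x j * imTerm y k) N)
        (+-cong (square-* (imTerm x) (reTerm y) N) (square-* (reTerm x) (imTerm y) N)))

-- The angle 2π/3 and the sides of the triangles

module TrigonometricValues {ℓ₀ ℓ₁ ℓ₂ ℓ₃} {ℝ : RealNumbers ℓ₀ ℓ₁ ℓ₂ ℓ₃} (trig : Trigonometry ℝ) where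
  open RealNumbers ℝ hiding (zero; sum; product)
  open Trigonometry trig
  open CommutativeRing commutativeRing using (commutativeSemiring)
  open IntegerCoefficients commutativeRing
  open RingLemmas commutativeRing
  open SumLemmas commutativeRing using (sum-zero)
  open OrderedField ℝ
  open Limits ℝ
  open PartialSums ℝ
  open Taylor ℝ
  open AdditionFormulas trig
  open Exp commutativeSemiring using (^-congˡ)
  open UnitTriangles commutativeRing using (TripleSquaresVanish; UnitEquilateral)
  open import Relation.Binary.Reasoning.Setoid setoid

  triple-squares-vanish : TripleSquaresVanish
  triple-squares-vanish x 3x²≈0 = ≮⇒≈
    (λ x<0 → let 0<-x = <-respˡ-≈ -0≈0 (neg-< x<0) in
      3x²≮0 (<-respʳ-≈ (solve 1 (λ x → :- x :* :- x := x :* x) refl x) (*-pos 0<-x 0<-x)))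
    (λ 0<x → 3x²≮0 (*-pos 0<x 0<x))
    where
    0<3 : 0# < 1# + 1# + 1#
    0<3 = <-trans 0<2 (x<x+y 0<1)
    3x²≮0 = λ (0<x² : 0# < x * x) → <-irrefl (sym 3x²≈0) (*-pos 0<3 0<x²)

  -- The field `cos` is a bare function; its compatibility with `_≈_` comes from uniqueness of the
  -- limit of its series.
  cos-cong : ∀ {x y} → x ≈ y → cos x ≈ cos y
  cos-cong {x} {y} x≈y = limit-unique (cos-series x) (limit-resp {partialSum (cosTerm y)}
    (partialSum-cong λ k → *-congʳ {1/[ 2 ℕ.* k !]} (*-congˡ {sign k} (^-congˡ (2 ℕ.* k) (sym x≈y))))
    (cos-series y))

  sin-cong : ∀ {x y} → x ≈ y → sin x ≈ sin y
  sin-cong {x} {y} x≈y = limit-unique (sin-series x) (limit-resp {partialSum (sinTerm y)}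
    (partialSum-cong λ k → *-congʳ {1/[ suc (2 ℕ.* k) !]} (*-congˡ {sign k} (^-congˡ (suc (2 ℕ.* k)) (sym x≈y))))
    (sin-series y))

  ^-even-neg : ∀ x k → (- x) ^ (2 ℕ.* k) ≈ x ^ (2 ℕ.* k)
  ^-even-neg x zero    = refl
  ^-even-neg x (suc k) = begin
    (- x) ^ (2 ℕ.* suc k)             ≡⟨ ≡.cong ((- x) ^_) (2*-suc k) ⟩
    - x * (- x * (- x) ^ (2 ℕ.* k))   ≈⟨ solve 2 (λ x y → :- x :* (:- x :* y) := x :* (x :* y)) refl x _ ⟩
    x * (x * (- x) ^ (2 ℕ.* k))       ≈⟨ *-congˡ (*-congˡ (^-even-neg x k)) ⟩
    x * (x * x ^ (2 ℕ.* k))           ≡⟨ ≡.cong (x ^_) (2*-suc k) ⟨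
    x ^ (2 ℕ.* suc k)                 ∎

  cos-neg : ∀ x → cos (- x) ≈ cos x
  cos-neg x = limit-unique (cos-series (- x)) (limit-resp {partialSum (cosTerm x)}
    (partialSum-cong λ k → *-congʳ {1/[ 2 ℕ.* k !]} (*-congˡ {sign k} (sym (^-even-neg x k))))
    (cos-series x))

  sin-neg : ∀ x → sin (- x) ≈ - sin x
  sin-neg x = limit-unique (sin-series (- x)) (limit-resp {λ N → - partialSum (sinTerm x) N}
    (λ N → trans (sym (partialSum-neg (sinTerm x) N)) (partialSum-cong (λ k → trans
      (solve 4 (λ s x y i → :- (s :* (x :* y) :* i) := s :* (:- x :* y) :* i) refl
        (sign k) x (x ^ (2 ℕ.* k)) 1/[ suc (2 ℕ.* k) !])
      (*-congʳ {1/[ suc (2 ℕ.* k) !]} (*-congˡ {sign k} (*-congˡ { - x} (sym (^-even-neg x k)))))) N))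
    (limit-neg (sin-series x)))

  cos-0 : cos 0# ≈ 1#
  -- The index starts at 1 because the empty partial sum is 0; all later ones equal 1.
  cos-0 = limit-unique (cos-series 0#) λ ε 0<ε → 1 ,
    λ { (suc N) _ → within-resp (sym (x≈y⇒x-y≈0 (partial-sums N))) refl (within-zero 0<ε) }
    where
    first : cosTerm 0# 0 ≈ 1#
    first = trans (*-congʳ (*-identityˡ 1#))
      (trans (*-congʳ (sym (+-identityʳ 1#))) (n!*1/n!≈1 0))
    rest : ∀ k → cosTerm 0# (suc k) ≈ 0#
    rest k = trans (*-congʳ {1/[ 2 ℕ.* suc k !]} (trans (*-congˡ (zeroˡ _)) (zeroʳ (sign (suc k))))) (zeroˡ _)
    partial-sums : ∀ N → partialSum (cosTerm 0#) (suc N) ≈ 1#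
    partial-sums N = trans (+-cong first (sum-zero {N} _ (rest ∘ toℕ))) (+-identityʳ 1#)

  cos²+sin² : ∀ x → cos x * cos x + sin x * sin x ≈ 1#
  cos²+sin² x = begin
    cos x * cos x + sin x * sin x
      ≈⟨ solve 2 (λ c s → c :* c :+ s :* s := c :* c :- s :* :- s) refl (cos x) (sin x) ⟩
    cos x * cos x - sin x * - sin x       ≈⟨ +-cong (*-congˡ (cos-neg x)) (-‿cong (*-congˡ (sin-neg x))) ⟨
    cos x * cos (- x) - sin x * sin (- x) ≈⟨ cos-+ x (- x) ⟨
    cos (x - x)                           ≈⟨ cos-cong (-‿inverseʳ x) ⟩
    cos 0#                                ≈⟨ cos-0 ⟩
    1#                                    ∎

  pos-cancel-zero : ∀ {x y} → 0# < x → x * y ≈ 0# → y ≈ 0#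
  pos-cancel-zero {x} {y} 0<x xy≈0 = begin
    y               ≈⟨ *-identityˡ y ⟨
    1# * y          ≈⟨ *-congʳ (x*1/x≈1 (pos⇒#0 0<x)) ⟨
    x * x⁻¹ * y     ≈⟨ solve 3 (λ x i y → x :* i :* y := i :* (x :* y)) refl x x⁻¹ y ⟩
    x⁻¹ * (x * y)   ≈⟨ xy≈0 *0 ⟩
    0#              ∎
    where x⁻¹ = inverse x (pos⇒#0 0<x)

  τ : Carrier
  τ = 2 · π * 1/ 3

  -- If c = cos (π/3) and s = sin (π/3) > 0, then 0 = sin π = s (4 c² - 1), whereas
  -- 2 cos τ + 1 = 4 c² - 1.
  cos-τ : cos τ + cos τ + 1# ≈ 0#
  cos-τ = begin
    cos τ + cos τ + 1#                          ≈⟨ +-congʳ (+-cong (cos-cong τ≈2p) (cos-cong τ≈2p)) ⟩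
    cos (p + p) + cos (p + p) + 1#              ≈⟨ +-congʳ (+-cong (cos-+ p p) (cos-+ p p)) ⟩
    (c * c - s * s) + (c * c - s * s) + 1#      ≈⟨ modulo (solve 2 (λ c s →
        (c :* c :- s :* s) :+ (c :* c :- s :* s) :+ con (+ 1) :=
        (con (+ 4) :* c :* c :- con (+ 1)) :+ con -[1+ 1 ] :* (c :* c :+ s :* s :- con (+ 1)))
        refl c s) (x≈y⇒x-y≈0 (cos²+sin² p) *0) ⟩
    4# * c * c - 1#                             ≈⟨ 4c²≈1 ⟩
    0#                                          ∎
    where
    i p c s 4# : Carrier
    i = 1/ 3
    p = π * i
    c = cos p
    s = sin p
    4# = (1# + 1# + 1#) + 1#

    τ≈2p : τ ≈ p + p
    τ≈2p = solve 2 (λ π i → (π :+ (π :+ con (+ 0))) :* i := π :* i :+ π :* i) refl π i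

    3p≈π : p + p + p ≈ π
    3p≈π = modulo (solve 2 (λ π i → π :* i :+ π :* i :+ π :* i := π :+
        π :* ((con (+ 1) :+ (con (+ 1) :+ (con (+ 1) :+ con (+ 0)))) :* i :- con (+ 1))) refl π i)
      (x≈y⇒x-y≈0 (x*1/x≈1 (pos⇒#0 (n·1-pos 3))) *0)

    0<p : 0# < p
    0<p = *-pos 0<π (1/-pos (n·1-pos 3))
    2p<π : p + p < π
    2p<π = <-respʳ-≈ 3p≈π (x<x+y 0<p)
    0<s : 0# < s
    0<s = sin-pos<π p 0<p (<-trans (x<x+y 0<p) 2p<π)
    4c²≈1 : 4# * c * c - 1# ≈ 0#
    4c²≈1 = pos-cancel-zero 0<s (begin
      s * (4# * c * c - 1#)
        ≈⟨ modulo (solve 2 (λ s c → s :* (con (+ 4) :* c :* c :- con (+ 1)) :=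
             ((s :* c :+ c :* s) :* c :+ (c :* c :- s :* s) :* s) :+
               s :* (c :* c :+ s :* s :- con (+ 1))) refl s c)
             (x≈y⇒x-y≈0 (cos²+sin² p) *0) ⟩
      (s * c + c * s) * c + (c * c - s * s) * s   ≈⟨ +-cong (*-congʳ (sin-+ p p)) (*-congʳ (cos-+ p p)) ⟨
      sin (p + p) * c + cos (p + p) * s           ≈⟨ sin-+ (p + p) p ⟨
      sin (p + p + p)                             ≈⟨ sin-cong 3p≈π ⟩
      sin π                                       ≈⟨ sin-π ⟩
      0#                                          ∎)

  cos-minus : ∀ x y → cos (x - y) ≈ cos x * cos y + sin x * sin y
  cos-minus x y = begin
    cos (x - y)                             ≈⟨ cos-+ x (- y) ⟩
    cos x * cos (- y) - sin x * sin (- y)   ≈⟨ +-cong (*-congˡ (cos-neg y)) (-‿cong (*-congˡ (sin-neg y))) ⟩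
    cos x * cos y - sin x * - sin y
      ≈⟨ solve 4 (λ c s c′ s′ → c :* c′ :- s :* :- s′ := c :* c′ :+ s :* s′) refl
           (cos x) (sin x) (cos y) (sin y) ⟩
    cos x * cos y + sin x * sin y           ∎

  -- Stable under negation and doubling, so it passes from τ to all the differences ±τ and ±2τ of
  -- corner angles.
  HasCosine-1/2 : Carrier → Set ℓ₁
  HasCosine-1/2 x = cos x + cos x + 1# ≈ 0#

  cosine-1/2-resp : ∀ {x y} → x ≈ y → HasCosine-1/2 x → HasCosine-1/2 y
  cosine-1/2-resp x≈y = trans (+-congʳ (+-cong cos-y≈cos-x cos-y≈cos-x))
    where cos-y≈cos-x = cos-cong (sym x≈y)

  cosine-1/2-neg : ∀ {x} → HasCosine-1/2 x → HasCosine-1/2 (- x)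
  cosine-1/2-neg {x} = trans (+-congʳ (+-cong (cos-neg x) (cos-neg x)))

  -- 2 cos 2x + 1 = 4 cos² x - 1 = (2 cos x - 1)(2 cos x + 1).
  cosine-1/2-double : ∀ {x} → HasCosine-1/2 x → HasCosine-1/2 (x + x)
  cosine-1/2-double {x} cos-x = trans (+-congʳ (+-cong (cos-+ x x) (cos-+ x x))) (modulo
    (solve 2 (λ c s → c :* c :- s :* s :+ (c :* c :- s :* s) :+ con (+ 1) := con (+ 0) :+
      ((c :+ c :- con (+ 1)) :* (c :+ c :+ con (+ 1)) :+
      con -[1+ 1 ] :* (c :* c :+ s :* s :- con (+ 1)))) refl (cos x) (sin x))
    (cos-x *0 +0 x≈y⇒x-y≈0 (cos²+sin² x) *0))

  corner-difference : ∀ φ (k l : Fin 3) → k ≢ l → HasCosine-1/2 ((φ + toℕ k · τ) - (φ + toℕ l · τ))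
  corner-difference φ 0F 0F k≢l = contradiction ≡.refl k≢l
  corner-difference φ 0F 1F _ = cosine-1/2-resp
    (solve 2 (λ φ τ → :- τ := φ :+ con (+ 0) :- (φ :+ (τ :+ con (+ 0)))) refl φ τ)
    (cosine-1/2-neg cos-τ)
  corner-difference φ 0F 2F _ = cosine-1/2-resp
    (solve 2 (λ φ τ → :- (τ :+ τ) := φ :+ con (+ 0) :- (φ :+ (τ :+ (τ :+ con (+ 0))))) refl φ τ)
    (cosine-1/2-neg (cosine-1/2-double cos-τ))
  corner-difference φ 1F 0F _ = cosine-1/2-resp
    (solve 2 (λ φ τ → τ := φ :+ (τ :+ con (+ 0)) :- (φ :+ con (+ 0))) refl φ τ) cos-τ
  corner-difference φ 1F 1F k≢l = contradiction ≡.refl k≢l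
  corner-difference φ 1F 2F _ = cosine-1/2-resp
    (solve 2 (λ φ τ → :- τ := φ :+ (τ :+ con (+ 0)) :- (φ :+ (τ :+ (τ :+ con (+ 0))))) refl φ τ)
    (cosine-1/2-neg cos-τ)
  corner-difference φ 2F 0F _ = cosine-1/2-resp
    (solve 2 (λ φ τ → τ :+ τ := φ :+ (τ :+ (τ :+ con (+ 0))) :- (φ :+ con (+ 0))) refl φ τ)
    (cosine-1/2-double cos-τ)
  corner-difference φ 2F 1F _ = cosine-1/2-resp
    (solve 2 (λ φ τ → τ := φ :+ (τ :+ (τ :+ con (+ 0))) :- (φ :+ (τ :+ con (+ 0)))) refl φ τ) cos-τ
  corner-difference φ 2F 2F k≢l = contradiction ≡.refl k≢l

  -- The law of cosines: a squared side is r² (2 - 2 cos (x - y)) = 3 r², and r = 1/√3.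
  triangle-equilateral : ∀ d φ → UnitEquilateral (MinkowskiRealization.triangle trig d φ)
  triangle-equilateral d φ k l k≢l = modulo
    (solve 5 (λ r c s c′ s′ →
      (r :* c :- r :* c′) :* (r :* c :- r :* c′) :+ (r :* s :- r :* s′) :* (r :* s :- r :* s′) :=
      con (+ 1) :+ (r :* r :* (c :* c :+ s :* s :- con (+ 1))
        :+ (r :* r :* (c′ :* c′ :+ s′ :* s′ :- con (+ 1))
        :+ ((:- (r :* r)) :* (c :* c′ :+ s :* s′ :+ (c :* c′ :+ s :* s′) :+ con (+ 1))
        :+ con (+ 1) :* (con (+ 3) :* (r :* r) :- con (+ 1)))))) refl
      r (cos x) (sin x) (cos y) (sin y))
    (x≈y⇒x-y≈0 (cos²+sin² x) *0 +0 (x≈y⇒x-y≈0 (cos²+sin² y) *0 +0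
      (trans (+-congʳ (+-cong (sym (cos-minus x y)) (sym (cos-minus x y)))) (corner-difference φ k l k≢l) *0 +0
      x≈y⇒x-y≈0 3r²≈1 *0)))
    where
    r x y : Carrier
    r = inverse √3 (pos⇒#0 0<√3)
    x = φ + toℕ k · τ
    y = φ + toℕ l · τ
    3r²≈1 : (1# + 1# + 1#) * (r * r) ≈ 1#
    3r²≈1 = modulo
      (solve 2 (λ t r → con (+ 3) :* (r :* r) := con (+ 1) :+
        ((:- (r :* r)) :* (t :* t :- (con (+ 1) :+ (con (+ 1) :+ (con (+ 1) :+ con (+ 0)))))
        :+ (t :* r :+ con (+ 1)) :* (t :* r :- con (+ 1)))) refl √3 r)
      (x≈y⇒x-y≈0 √3*√3 *0 +0 x≈y⇒x-y≈0 (x*1/x≈1 (pos⇒#0 0<√3)) *0)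

-- The empty exceptional set

module Genericity {ℓ₀ ℓ₁ ℓ₂ ℓ₃} (ℝ : RealNumbers ℓ₀ ℓ₁ ℓ₂ ℓ₃) (d : ℕ) where
  open RealNumbers ℝ using (Carrier; _≈_; 0#; 1#; _+_; _-_; -_; 0<1; commutativeRing; refl; trans; sym;
    reflexive; +-cong; +-congˡ; +-identityˡ; +-identityʳ; *-congʳ; *-identityˡ; zeroˡ; -‿inverseʳ; product)
    renaming (_*_ to _·_)
  open Analytic ℝ (suc d)
  open OrderedField ℝ
  open SumLemmas commutativeRing using (sum-zero)
  open RingLemmas commutativeRing using (x≈y⇒x-y≈0)

  listSum : (MultiIndex → Carrier) → List MultiIndex → Carrier
  listSum f = List.foldr (λ α s → f α + s) 0#

  listSum-zero : ∀ f S → (∀ α → α ∈ S → f α ≈ 0#) → listSum f S ≈ 0#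
  listSum-zero f []      f≈0 = refl
  listSum-zero f (α ∷ S) f≈0 =
    trans (+-cong (f≈0 α (here ≡.refl)) (listSum-zero f S (λ β → f≈0 β ∘ there))) (+-identityˡ 0#)

  listSum-single : ∀ f α S → (∀ β → β ≢ α → f β ≈ 0#) → Unique S → α ∈ S → listSum f S ≈ f α
  listSum-single f α (.α ∷ S) f≈0 (α∉S ∷ _) (here ≡.refl) =
    trans (+-congˡ (listSum-zero f S λ β β∈S → f≈0 β (All.lookup α∉S β∈S ∘ ≡.sym))) (+-identityʳ _)
  listSum-single f α (β ∷ S) f≈0 (β∉S ∷ unique) (there α∈S) =
    trans (+-cong (f≈0 β (All.lookup β∉S α∈S)) (listSum-single f α S f≈0 unique α∈S)) (+-identityˡ _)

  -- Around any point the expansion is the single monomial with exponent 0, so every finite index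
  -- set containing that exponent sums to exactly 1. The radius 1 is arbitrary.
  constant-analytic : IsAnalytic (λ _ → 1#)
  constant-analytic p = coefficient , 1# , 0<1 , λ x _ ε 0<ε → (0̂ ∷ []) , λ S unique 0̂∈S →
    within-resp (sym (x≈y⇒x-y≈0 (trans
      (listSum-single (term x) 0̂ S (other x) unique (0̂∈S (here ≡.refl)))
      (constant-term x)))) refl (within-zero 0<ε)
    where
    0̂ : MultiIndex
    0̂ = Vec.replicate (suc d) 0
    coefficient : MultiIndex → Carrier
    coefficient α = if does (Vecₚ.≡-dec ℕₚ._≟_ α 0̂) then 1# else 0#
    term : Vector Carrier (suc d) → MultiIndex → Carrier
    term x α = coefficient α · monomial (λ i → x i - p i) α
    other : ∀ x α → α ≢ 0̂ → term x α ≈ 0#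
    other x α α≢0̂ = trans
      (*-congʳ (reflexive (≡.cong (if_then 1# else 0#) (dec-false (Vecₚ.≡-dec ℕₚ._≟_ α 0̂) α≢0̂))))
      (zeroˡ _)
    zero-power : ∀ {n} (x : Vector Carrier n) →
                 product (λ i → RealNumbers._^_ ℝ (x i) (Vec.lookup (Vec.replicate n 0) i)) ≈ 1#
    zero-power {zero}  x = refl
    zero-power {suc n} x = trans (*-identityˡ _) (zero-power (x ∘ suc))
    constant-term : ∀ x → term x 0̂ ≈ 1#
    constant-term x = trans
      (*-congʳ (reflexive (≡.cong (if_then 1# else 0#) (dec-true (Vecₚ.≡-dec ℕₚ._≟_ 0̂ 0̂) ≡.refl))))
      (trans (*-identityˡ _) (zero-power (λ i → x i - p i)))

  -- The empty set is written as `1# ≈ 0#`: this is literally the zero set of the constant 1, at the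
  -- required level ℓ₁.
  generically-if-always : ∀ {q} {Q : Vector Carrier (suc d) → Set q} → (∀ φ → Q φ) → Generically Q
  generically-if-always always = (λ _ → 1# ≈ 0#)
    , (((λ _ → 1#) , constant-analytic , λ _ → mk⇔ id id) , (λ _ → 0#) , 1≉0)
    -- All boxes are the single point 0. Their volume is 0 because the dimension `suc d` provides a
    -- zero factor, and they have nothing to cover.
    , (λ ε 0<ε → (λ _ _ → 0#) , (λ _ _ → 0#)
        , (λ _ _ → <-irrefl refl)
        , (λ x 1≈0 → contradiction 1≈0 1≉0)
        , λ N ε<Σ → <-irrefl refl (<-trans 0<ε (<-respʳ-≈
            (sum-zero {N} _ λ k → trans (*-congʳ (-‿inverseʳ 0#)) (zeroˡ _)) ε<Σ)))
    , λ φ _ → always φ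
    where
    1≉0 : 1# ≈ 0# → _
    1≉0 1≈0 = <-irrefl (sym 1≈0) 0<1

-- Infinitesimal flexes and rank of the Minkowski realizations of H(d,3)

open import Data.Nat using (_≤_; _*_; _∸_; _^_)

theorem3 : ∀ {c ℓ₁ ℓ₂ ℓ₃} (ℝ : RealNumbers c ℓ₁ ℓ₂ ℓ₃) (trig : Trigonometry ℝ) (d : ℕ) → 1 ≤ d →
    let open RealNumbers ℝ using (Carrier)
        open MinkowskiRealization trig d
        open Analytic ℝ d
        n = 3 ^ d
    in Generically λ φ →
      let open Hamming φ
      in HasDimension internalFlexibility (d ∸ 1)
         × (∀ (v : Vector Point n) → IsFlex v ⇔ (∃ λ (θ : Vector Carrier d) → IsTrivial (v -ⱽ relativeRotations φ θ)))
         × LinearlyIndependent (Velocities n) (triangleRotation φ)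
         × HasRank rigidityMatrix (2 * n ∸ 3 ∸ (d ∸ 1))
theorem3 ℝ trig (suc d) _ = Genericity.generically-if-always ℝ d λ φ →
  let T i = triangle (φ i)
      equilateral i = triangle-equilateral (suc d) (φ i)
      open HammingFramework R triple-squares-vanish T equilateral
      open Hamming φ
  in InternalFlexibility.dimension R triple-squares-vanish T equilateral
   , flex⇔rotations+trivial
   , independent
   , ≡.subst (HasRank rigidityMatrix) (keptCount≡ d) (RigidityRank.rank R triple-squares-vanish T equilateral)
  where
  R = RealNumbers.commutativeRing ℝ
  open TrigonometricValues trig
  open MinkowskiRealization trig (suc d)
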